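{- Every Coxeter group whose Coxeter graph is complete (that is, with $m(i,i')\ge 3$, possibly $\infty$, for all distinct $i,i'\in I$) is futuristic.
   Context: Let $(W,S)$ be a Coxeter system with $S=\{s_i:i\in I\}$, $I$ a finite index set; $m(i,i')$ is the order of $s_is_{i'}$. The Coxeter graph has vertex set $I$, with distinct $i,i'$ joined by an edge labeled $m(i,i')$ whenever $m(i,i')\ge 3$. The root space is $V=\mathbb R^I$ with standard basis the simple roots $\{\alpha_i:i\in I\}$ and symmetric bilinear form $B(\alpha_i,\alpha_{i'})=-\cos(\pi/m(i,i'))$ (and $-1$ if $m(i,i')=\infty$). $W$ acts on $V$ by $s_i\beta=\beta-2B(\beta,\alpha_i)\alpha_i$. The root system is $\Phi=\{w\alpha_i:w\in W,i\in I\}=\Phi^+\sqcup\Phi^-$, where $\Phi^+$ are the roots that are nonnegative combinations of simple roots and $\Phi^-=-\Phi^+$. For $\beta\in\Phi$ the half-space $H_\beta^+$ is $\{w\in W:w\beta\in\Phi^+\}$. A subset of $W$ is convex if it is an intersection of half-spaces (the empty intersection being $W$). For a nonempty convex set $\mathscr L\subseteq W$ let $\mathrm R(\mathscr L)=\{\beta\in\Phi:\mathscr L\subseteq H_\beta^+\}$. For $i\in I$, the toggle $\tau_i\colon W\to W$ is defined by $\tau_i(u)=u$ if $u^{ -1}\alpha_i\in\mathrm R(\mathscr L)$ and $\tau_i(u)=s_iu$ otherwise. A Coxeter element is a product $c=s_{i_n}\cdots s_{i_1}$ where $i_1,\ldots,i_n$ is an ordering of $I$ (each element once); $\mathrm{Pro}_c=\tau_{i_n}\cdots\tau_{i_1}$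 (composition), which depends only on $c$ and $\mathscr L$. The set $\mathscr L$ is heavy with respect to $c$ if every periodic point of $\mathrm{Pro}_c$ (i.e. every $u\in W$ with $\mathrm{Pro}_c^K(u)=u$ for some $K\ge 1$) lies in $\mathscr L$. The Coxeter group $W$ is futuristic if every nonempty convex subset of $W$ is heavy with respect to every Coxeter element of $W$. -}

module Defs where

open import Level using (0ℓ)
open import Algebra.Bundles using (CommutativeRing; Group)
import Algebra.Definitions.RawMonoid as RawMonoidOps
open import Axiom.ExcludedMiddle using (ExcludedMiddle)
open import Data.Bool.Base using (if_then_else_)
open import Data.Fin.Base using (Fin)
open import Data.Fin.Properties using (_≟_)
open import Data.List.Base
  using (List; []; _∷_; _++_; foldr; foldl; map; reverse; concat; replicate; allFin)
open import Data.List.Relation.Binary.Permutation.Propositional using (_↭_)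
open import Data.Nat.Base as ℕ using (ℕ)
open import Data.Nat.GeneralisedArithmetic using (iterate)
open import Data.Product.Base using (Σ-syntax; ∃-syntax; _×_; proj₁)
open import Function.Definitions using (Injective)
open import Relation.Binary.Core using (Rel)
import Relation.Binary.Construct.Add.Supremum.NonStrict as AddSupremum
import Relation.Binary.Construct.StrictToNonStrict as StrictToNonStrict
open import Relation.Binary.PropositionalEquality.Core using (_≡_; _≢_)
open import Relation.Binary.Structures using (IsStrictTotalOrder)
open import Relation.Nullary.Construct.Add.Supremum using (_⁺; [_]; ⊤⁺)
open import Relation.Nullary.Decidable.Core using (does)
open import Relation.Nullary.Negation.Core using (¬_)
open import Relation.Unary using (Pred; Satisfiable; _∈_; _⊆_; _≐_)

-- A Dedekind-complete ordered field.  Classically there is exactly one up to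
-- isomorphism, so quantifying over this record is quantifying over the
-- possible constructions of ℝ.  The value of _⁻¹ at 0 is unspecified.
record RealNumbers : Set₁ where
  field
    commutativeRing : CommutativeRing 0ℓ 0ℓ
  open CommutativeRing commutativeRing public
  infix  4 _<_
  infix  9 _⁻¹
  field
    _<_                : Rel Carrier 0ℓ
    isStrictTotalOrder : IsStrictTotalOrder _≈_ _<_
    0<1                : 0# < 1#
    +-monoʳ-<          : ∀ x {y z} → y < z → x + y < x + z
    *-pos              : ∀ {x y} → 0# < x → 0# < y → 0# < x * y
    _⁻¹                : Carrier → Carrier
    *-inverseʳ         : ∀ {x} → ¬ x ≈ 0# → x * x ⁻¹ ≈ 1#

  open StrictToNonStrict _≈_ _<_ public using (_≤_)
  open RawMonoidOps +-rawMonoid public using (sum)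

  UpperBound : Pred Carrier 0ℓ → Pred Carrier 0ℓ
  UpperBound P b = ∀ x → x ∈ P → x ≤ b

  field
    complete : ∀ (P : Pred Carrier 0ℓ) → Satisfiable P → Satisfiable (UpperBound P) →
               ∃[ b ] (b ∈ UpperBound P × (∀ b′ → b′ ∈ UpperBound P → b ≤ b′))

  fromℕ : ℕ → Carrier
  fromℕ k = RawMonoidOps._×_ +-rawMonoid k 1#

  2# : Carrier
  2# = fromℕ 2

-- Apostol's axioms for sine and cosine (Calculus, vol. 1, §2.5), with the
-- inequalities cos x < sin x / x < 1 / cos x cleared of denominators.  Over a
-- Dedekind-complete ordered field they are satisfied by exactly one triple
-- (sin, cos, π), the usual one.
record Trigonometry (ℝ : RealNumbers) : Set where
  open RealNumbers ℝ
  field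
    sin cos  : Carrier → Carrier
    π        : Carrier
    sin-cong : ∀ {x y} → x ≈ y → sin x ≈ sin y
    cos-cong : ∀ {x y} → x ≈ y → cos x ≈ cos y
    0<π      : 0# < π
    cos-0    : cos 0# ≈ 1#
    sin-π/2  : sin (π * 2# ⁻¹) ≈ 1#
    cos-π    : cos π ≈ - 1#
    cos-sub  : ∀ x y → cos (y - x) ≈ cos y * cos x + sin y * sin x
    cos-pos  : ∀ {x} → 0# < x → x < π * 2# ⁻¹ → 0# < cos x
    sin-lower : ∀ {x} → 0# < x → x < π * 2# ⁻¹ → x * cos x < sin x
    sin-upper : ∀ {x} → 0# < x → x < π * 2# ⁻¹ → sin x * cos x < x

-- ℕ ⁺ is ℕ ∪ {∞}, with ⊤⁺ = ∞.
module _ (G : Group 0ℓ 0ℓ) where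
  open Group G
  open RawMonoidOps rawMonoid using () renaming (_×_ to _times_)

  HasOrder : Carrier → ℕ ⁺ → Set
  HasOrder g [ k ] = 1 ℕ.≤ k × k times g ≈ ε ×
                     (∀ j → 1 ℕ.≤ j → j ℕ.< k → ¬ j times g ≈ ε)
  HasOrder g ⊤⁺    = ∀ j → 1 ℕ.≤ j → ¬ j times g ≈ ε

-- Congruence on words over I = Fin n generated by (i j)^{m(i,j)} ∼ 1 for
-- finite m(i,j).  Since m(i,i) = 1 yields i i ∼ 1, no formal inverses of
-- letters are needed.
module _ {n} (m : Fin n → Fin n → ℕ ⁺) where
  infix 4 _∼_
  data _∼_ : Rel (List (Fin n)) 0ℓ where
    relator : ∀ {i j k} → m i j ≡ [ k ] → concat (replicate k (i ∷ j ∷ [])) ∼ []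
    ++-cong : ∀ {u u′ v v′} → u ∼ u′ → v ∼ v′ → u ++ v ∼ u′ ++ v′
    refl    : ∀ {u} → u ∼ u
    sym     : ∀ {u v} → u ∼ v → v ∼ u
    trans   : ∀ {u v w} → u ∼ v → v ∼ w → u ∼ w

-- W is generated by the elements s i of order 2, m i j is the order of
-- s i ∙ s j, and the relations (s i ∙ s j)^{m i j} = 1 present W.
record CoxeterSystem (n : ℕ) : Set₁ where
  field
    group : Group 0ℓ 0ℓ
  open Group group public
  field
    s           : Fin n → Carrier
    s-injective : Injective _≡_ _≈_ s
    s-order     : ∀ i → HasOrder group (s i) [ 2 ]
    m           : Fin n → Fin n → ℕ ⁺
    m-order     : ∀ i j → HasOrder group (s i ∙ s j) (m i j)

  ⟦_⟧ : List (Fin n) → Carrier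
  ⟦ u ⟧ = foldr _∙_ ε (map s u)

  field
    generates : ∀ w → ∃[ u ] ⟦ u ⟧ ≈ w
    presents  : ∀ u v → ⟦ u ⟧ ≈ ⟦ v ⟧ → _∼_ m u v

module _ {n} (W : CoxeterSystem n) where
  open CoxeterSystem W
  open AddSupremum ℕ._≤_ using (_≤⁺_)

  Adjacent : Rel (Fin n) 0ℓ
  Adjacent i j = i ≢ j × [ 3 ] ≤⁺ m i j

  HasCompleteCoxeterGraph : Set
  HasCompleteCoxeterGraph = ∀ i j → i ≢ j → Adjacent i j

  -- An ordering i₁ ∷ … ∷ iₙ ∷ [] of the index set.
  Ordering : Set
  Ordering = Σ[ is ∈ List (Fin n) ] is ↭ allFin n

  -- The product s iₙ ∙ … ∙ s i₁.
  coxeterProduct : Ordering → Carrier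
  coxeterProduct o = ⟦ reverse (proj₁ o) ⟧

  IsCoxeterElement : Pred Carrier 0ℓ
  IsCoxeterElement c = ∃[ o ] c ≈ coxeterProduct o

module RootSystem (ℝ : RealNumbers) (trig : Trigonometry ℝ)
                  {n} (W : CoxeterSystem n) where
  open RealNumbers ℝ using (0#; 1#; _+_; _*_; -_; _-_; _⁻¹; _≤_; sum; fromℕ; 2#)
    renaming (Carrier to R; _≈_ to _≈ᴿ_)
  open Trigonometry trig using (cos; π)
  open CoxeterSystem W using (m; generates) renaming (Carrier to ∣W∣)

  V : Set
  V = Fin n → R

  infix 4 _≋_
  _≋_ : Rel V 0ℓ
  β ≋ γ = ∀ i → β i ≈ᴿ γ i

  α : Fin n → V
  α i j = if does (i ≟ j) then 1# else 0#

  gram : ℕ ⁺ → R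
  gram [ k ] = - cos (π * fromℕ k ⁻¹)
  gram ⊤⁺    = - 1#

  B : V → V → R
  B β γ = sum λ i → sum λ j → β i * gram (m i j) * γ j

  reflect : Fin n → V → V
  reflect i β j = β j - 2# * B β (α i) * α i j

  -- The generators s i act by reflect i; w acts through an expression of w as
  -- a product of generators.  All expressions of w give the same operator
  -- (up to _≋_), so it does not matter which one `generates` provides.
  infixr 7 _·_
  _·_ : ∣W∣ → V → V
  w · β = foldr reflect β (proj₁ (generates w))

  Root : Pred V 0ℓ
  Root β = ∃[ w ] ∃[ i ] β ≋ w · α i

  PositiveRoot : Pred V 0ℓ
  PositiveRoot β = Root β × (∀ i → 0# ≤ β i)

  HalfSpace : V → Pred ∣W∣ 0ℓ
  HalfSpace β w = PositiveRoot (w · β)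

  Convex : Pred ∣W∣ 0ℓ → Set₁
  Convex L = Σ[ A ∈ Pred V 0ℓ ] (A ⊆ Root × L ≐ (λ w → ∀ β → β ∈ A → w ∈ HalfSpace β))

  -- The set R(L).
  Rts : Pred ∣W∣ 0ℓ → Pred V 0ℓ
  Rts L β = Root β × L ⊆ HalfSpace β

-- Excluded middle is what makes the case distinction in the definition of a
-- toggle legitimate for an arbitrary convex set.
module Billiards (em : ExcludedMiddle 0ℓ) (ℝ : RealNumbers) (trig : Trigonometry ℝ)
                 {n} (W : CoxeterSystem n) where
  open CoxeterSystem W
  open RootSystem ℝ trig W

  toggle : Pred Carrier 0ℓ → Fin n → Carrier → Carrier
  toggle L i u = if does (em {P = (u ⁻¹ · α i) ∈ Rts L}) then u else s i ∙ u

  -- τ_{iₙ} ∘ … ∘ τ_{i₁}: the toggle at i₁ is applied first.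
  Pro : Pred Carrier 0ℓ → Ordering W → Carrier → Carrier
  Pro L o u = foldl (λ v i → toggle L i v) u (proj₁ o)

  Periodic : (Carrier → Carrier) → Pred Carrier 0ℓ
  Periodic f u = ∃[ K ] (1 ℕ.≤ K × iterate f u K ≈ u)

  -- Pro depends on the ordering only through the Coxeter element c, so one may
  -- range over all orderings that yield c.
  Heavy : Pred Carrier 0ℓ → Carrier → Set
  Heavy L c = ∀ o → c ≈ coxeterProduct W o → Periodic (Pro L o) ⊆ L

  Futuristic : Set₁
  Futuristic = ∀ L → Convex L → Satisfiable L → ∀ c → IsCoxeterElement W c → Heavy L c

{-# OPTIONS --safe #-}

-- Suppose that u is a periodic point outside L.  A toggle never adds a root to
-- the set of roots of R(L) separating u from L, so this set is constant along
-- the orbit, and no root of R(L) or -R(L) is ever crossed.  Call a positive root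
-- γ facing u if u⁻¹(-γ) lies in R(L).
--
-- Roots dominated by a facing root are facing, so some small root faces u; in a
-- complete graph a small root is simple or lies in a finite dihedral standard
-- parabolic subgroup.  If γ faces u and B(γ, α i) ≤ -1, then τ i fixes u.  Hence
-- while a nonsimple root of the plane of α j and α k faces u, only the toggles at
-- j and k can move u, and since R(L) is closed under positive combinations each
-- of them does, until a simple root faces u.
--
-- From the first move on, the moves therefore form alternating words in pairs
-- {j , k}, too short for a braid relation.  The image η of minus the root crossed
-- by the first move stays positive under such moves, because its coordinates at
-- the current pair keep exceeding all others.  On return to u it would be
-- negative.
module Submission where

open import Algebra.Bundles using (RawRing)
import Algebra.Definitions.RawMonoid
import Algebra.Properties.AbelianGroup
import Algebra.Properties.Ring
import Algebra.Properties.Semiring.Mult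
import Algebra.Properties.Semiring.Sum
import Algebra.Solver.Ring
open import Algebra.Solver.Ring.AlmostCommutativeRing
  using (fromCommutativeRing; _-Raw-AlmostCommutative⟶_)
open import Axiom.ExcludedMiddle using (ExcludedMiddle)
open import Data.Bool.Base using (Bool; true; false; not; _xor_; if_then_else_)
open import Data.Bool.Properties using (not-involutive)
open import Data.Empty using (⊥; ⊥-elim)
open import Data.Fin.Base using (Fin)
import Data.Fin.Properties as Fin
open import Data.List.Base using (List; allFin; []; _∷_; _++_; _∷ʳ_; reverse; length; foldr; foldl; concat; replicate; [_])
open import Data.List.Membership.Propositional using (_∈_)
open import Data.List.Membership.Propositional.Properties using (∈-allFin; ∈-++⁻)
import Data.List.Properties as List
open import Data.List.Relation.Binary.Permutation.Propositional using (_↭_; ↭-sym; ↭-trans; ↭⇒↭ₛ)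
open import Data.List.Relation.Binary.Permutation.Propositional.Properties using (∈-resp-↭; ∷↭∷ʳ)
import Data.List.Relation.Binary.Permutation.Setoid.Properties as Permutationₛ
open import Data.List.Relation.Unary.All using (All; []; _∷_)
open import Data.List.Relation.Unary.AllPairs using (_∷_)
open import Data.List.Relation.Unary.Any using (here; there)
open import Data.List.Relation.Unary.Unique.Propositional.Properties using (allFin⁺)
open import Data.List.Reverse using (Reverse; reverseView; _∶_∶ʳ_) renaming ([] to [])
open import Data.Maybe.Base using (Maybe; just; nothing)
open import Data.Nat.Base as ℕ using (ℕ; zero; suc; z≤n; s≤s)
open import Data.Nat.GeneralisedArithmetic using (iterate)
import Data.Nat.Properties as ℕ
open import Data.Product.Base using (_×_; _,_; proj₁; proj₂; ∃-syntax)
open import Data.Sum.Base using (_⊎_; inj₁; inj₂)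
open import Function.Base using (_∘_)
open import Level using (0ℓ)
import Relation.Binary.Construct.Add.Supremum.NonStrict as AddSupremum
open import Relation.Binary.Definitions using (tri<; tri≈; tri>)
open import Relation.Binary.PropositionalEquality.Core as ≡ using (_≡_; _≢_)
import Relation.Binary.PropositionalEquality.Properties as ≡
import Relation.Binary.Reasoning.Setoid
open import Relation.Binary.Structures using (module IsStrictTotalOrder)
open import Relation.Nullary.Construct.Add.Supremum using (_⁺; ⊤⁺) renaming ([_] to fin)
open import Relation.Nullary.Decidable.Core using (yes; no; does)
open import Relation.Nullary.Negation.Core using (¬_)
open import Relation.Unary using (Pred)
open import Defs

-- Completeness of the graph enters as `a i j` = -2 B(α i, α j) ≥ 1 for i ≠ j. This makes the
-- pairing 2 B of a nonsimple root of a finite plane with a third simple root at most -2, so that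
-- third letters are stuck, and it makes an outside coordinate of η contribute at least its own size
-- when a coordinate of the pair is reflected. An infinite label blocks the move altogether, since
-- B(α i, α l) = -1 already suffices. The obstacle is the alternating run. In a plane with label M
-- the coordinates of η at j and k obey a Chebyshev recurrence whose homogeneous solutions change
-- sign within M steps, so a run entered with a bad ratio of coordinates could leave the positive
-- cone before it ends. The ratio is therefore compared with that of the facing root, which walks
-- through the plane in step with the run: their Casoratian stays nonnegative, helped by the largest
-- outside coordinate, which acts as a source term. The run is over when the facing root reaches the
-- last root of the plane, which is simple.

-- Ordered field arithmetic and a ring solver with integer coefficients

module RealProperties (ℝ : RealNumbers) where
  open RealNumbers ℝ public hiding (zero) renaming (refl to ≈-refl; sym to ≈-sym; trans to ≈-trans)
  open Algebra.Properties.Ring ring public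
    using (-‿distribˡ-*; -‿distribʳ-*; -0#≈0#; -‿involutive)
  open Algebra.Properties.AbelianGroup +-abelianGroup using () renaming (⁻¹-∙-comm to -‿+-comm)
  open Algebra.Properties.Semiring.Sum semiring public
    using (sum-cong-≋; ∑-distrib-+; ∑-comm; *-distribˡ-sum)
  module ≈-Reasoning = Relation.Binary.Reasoning.Setoid setoid

  -- A pair (a , b) stands for the integer a - b.  The operations return pairs
  -- with a zero component, because the solver compares coefficients of normal
  -- forms syntactically.
  module Coefficients where
    open Algebra.Properties.Semiring.Mult semiring using (×-homo-+; ×1-homo-*)

    reduced : ℕ → ℕ → ℕ × ℕ
    reduced (suc a) (suc b) = reduced a b
    reduced a       b       = a , b

    Coefficient : RawRing 0ℓ 0ℓ
    Coefficient = record
      { Carrier = ℕ × ℕ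
      ; _≈_     = _≡_
      ; _+_     = λ { (a , b) (c , d) → reduced (a ℕ.+ c) (b ℕ.+ d) }
      ; _*_     = λ { (a , b) (c , d) → reduced (a ℕ.* c ℕ.+ b ℕ.* d) (a ℕ.* d ℕ.+ b ℕ.* c) }
      ; -_      = λ { (a , b) → b , a }
      ; 0#      = 0 , 0
      ; 1#      = 1 , 0
      }

    -- `fromℕ 1` unfolds to `1# + 0#`; the special case makes the constant `:1` denote `1#` on the
    -- nose, so that `1-homo` is reflexivity.
    nat : ℕ → Carrier
    nat 1 = 1#
    nat k = fromℕ k

    eval : ℕ × ℕ → Carrier
    eval (a , zero)      = nat a
    eval (a , b@(suc _)) = nat a - nat b

    nat≈fromℕ : ∀ k → nat k ≈ fromℕ k
    nat≈fromℕ zero          = ≈-refl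
    nat≈fromℕ (suc zero)    = ≈-sym (+-identityʳ 1#)
    nat≈fromℕ (suc (suc k)) = ≈-refl

    eval≈ : ∀ a b → eval (a , b) ≈ fromℕ a - fromℕ b
    eval≈ a zero    = ≈-trans (nat≈fromℕ a) (≈-trans (≈-sym (+-identityʳ _)) (+-congˡ (≈-sym -0#≈0#)))
    eval≈ a (suc b) = +-cong (nat≈fromℕ a) (-‿cong (nat≈fromℕ (suc b)))

    open ≈-Reasoning

    interchange : ∀ w x y z → (w + x) + (y + z) ≈ (w + y) + (x + z)
    interchange w x y z = begin
      (w + x) + (y + z) ≈⟨ +-assoc w x _ ⟩
      w + (x + (y + z)) ≈⟨ +-congˡ (+-assoc x y z) ⟨
      w + ((x + y) + z) ≈⟨ +-congˡ (+-congʳ (+-comm x y)) ⟩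
      w + ((y + x) + z) ≈⟨ +-congˡ (+-assoc y x z) ⟩
      w + (y + (x + z)) ≈⟨ +-assoc w y _ ⟨
      (w + y) + (x + z) ∎

    eval-reduced : ∀ a b → eval (reduced a b) ≈ fromℕ a - fromℕ b
    eval-reduced zero    b       = eval≈ zero b
    eval-reduced (suc a) zero    = eval≈ (suc a) zero
    eval-reduced (suc a) (suc b) = begin
      eval (reduced a b)                       ≈⟨ eval-reduced a b ⟩
      fromℕ a - fromℕ b                        ≈⟨ +-identityˡ _ ⟨
      0# + (fromℕ a - fromℕ b)                 ≈⟨ +-congʳ (-‿inverseʳ 1#) ⟨
      (1# - 1#) + (fromℕ a - fromℕ b)          ≈⟨ interchange _ _ _ _ ⟩
      (1# + fromℕ a) + (- 1# + - fromℕ b)      ≈⟨ +-congˡ (-‿+-comm _ _) ⟩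
      fromℕ (suc a) - fromℕ (suc b)            ∎

    +-homo : ∀ p q → eval (RawRing._+_ Coefficient p q) ≈ eval p + eval q
    +-homo (a , b) (c , d) = begin
      eval (reduced (a ℕ.+ c) (b ℕ.+ d))               ≈⟨ eval-reduced (a ℕ.+ c) (b ℕ.+ d) ⟩
      fromℕ (a ℕ.+ c) - fromℕ (b ℕ.+ d)                ≈⟨ +-cong (×-homo-+ 1# a c) (-‿cong (×-homo-+ 1# b d)) ⟩
      (fromℕ a + fromℕ c) - (fromℕ b + fromℕ d)        ≈⟨ +-congˡ (-‿+-comm _ _) ⟨
      (fromℕ a + fromℕ c) + (- fromℕ b + - fromℕ d)    ≈⟨ interchange _ _ _ _ ⟩
      (fromℕ a - fromℕ b) + (fromℕ c - fromℕ d)        ≈⟨ +-cong (eval≈ a b) (eval≈ c d) ⟨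
      eval (a , b) + eval (c , d)                      ∎

    *-homo : ∀ p q → eval (RawRing._*_ Coefficient p q) ≈ eval p * eval q
    *-homo (a , b) (c , d) = begin
      eval (reduced (a ℕ.* c ℕ.+ b ℕ.* d) (a ℕ.* d ℕ.+ b ℕ.* c))
        ≈⟨ eval-reduced (a ℕ.* c ℕ.+ b ℕ.* d) (a ℕ.* d ℕ.+ b ℕ.* c) ⟩
      fromℕ (a ℕ.* c ℕ.+ b ℕ.* d) - fromℕ (a ℕ.* d ℕ.+ b ℕ.* c)
        ≈⟨ +-cong (hom a c b d) (-‿cong (hom a d b c)) ⟩
      (A * C + B * D) - (A * D + B * C)                ≈⟨ +-congˡ (-‿+-comm _ _) ⟨
      (A * C + B * D) + (- (A * D) + - (B * C))        ≈⟨ interchange _ _ _ _ ⟩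
      (A * C + - (A * D)) + (B * D + - (B * C))        ≈⟨ +-congˡ (+-comm _ _) ⟩
      (A * C + - (A * D)) + (- (B * C) + B * D)
        ≈⟨ +-cong (+-congˡ (-‿distribʳ-* A D)) (+-cong (-‿distribˡ-* B C) negsq) ⟩
      (A * C + A * - D) + (- B * C + - B * - D)        ≈⟨ +-cong (distribˡ A C (- D)) (distribˡ (- B) C (- D)) ⟨
      A * (C - D) + - B * (C - D)                      ≈⟨ distribʳ (C - D) A (- B) ⟨
      (A - B) * (C - D)                                ≈⟨ *-cong (eval≈ a b) (eval≈ c d) ⟨
      eval (a , b) * eval (c , d)                      ∎
      where
      A B C D : Carrier
      A = fromℕ a
      B = fromℕ b
      C = fromℕ c
      D = fromℕ d
      hom : ∀ x y z w → fromℕ (x ℕ.* y ℕ.+ z ℕ.* w) ≈ fromℕ x * fromℕ y + fromℕ z * fromℕ w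
      hom x y z w = ≈-trans (×-homo-+ 1# (x ℕ.* y) (z ℕ.* w)) (+-cong (×1-homo-* x y) (×1-homo-* z w))
      negsq : B * D ≈ - B * - D
      negsq = begin
        B * D       ≈⟨ -‿involutive _ ⟨
        - - (B * D) ≈⟨ -‿cong (-‿distribʳ-* B D) ⟩
        - (B * - D) ≈⟨ -‿distribˡ-* B (- D) ⟩
        - B * - D   ∎

    -‿homo : ∀ p → eval (RawRing.-_ Coefficient p) ≈ - eval p
    -‿homo (a , b) = begin
      eval (b , a)               ≈⟨ eval≈ b a ⟩
      fromℕ b - fromℕ a          ≈⟨ +-comm _ _ ⟩
      - fromℕ a + fromℕ b        ≈⟨ +-congˡ (-‿involutive _) ⟨
      - fromℕ a + - - fromℕ b    ≈⟨ -‿+-comm _ _ ⟩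
      - (fromℕ a - fromℕ b)      ≈⟨ -‿cong (eval≈ a b) ⟨
      - eval (a , b)             ∎

    morphism : Coefficient -Raw-AlmostCommutative⟶ fromCommutativeRing commutativeRing
    morphism = record
      { ⟦_⟧ = eval ; +-homo = +-homo ; *-homo = *-homo ; -‿homo = -‿homo
      ; 0-homo = ≈-refl ; 1-homo = ≈-refl }

    fromℕ-diff : ∀ a b c d → a ℕ.+ d ≡ c ℕ.+ b → fromℕ a - fromℕ b ≈ fromℕ c - fromℕ d
    fromℕ-diff a b c d e = begin
      fromℕ a - fromℕ b                               ≈⟨ +-congʳ (+-identityʳ _) ⟨
      (fromℕ a + 0#) - fromℕ b                        ≈⟨ +-congʳ (+-congˡ (-‿inverseʳ (fromℕ d))) ⟨
      (fromℕ a + (fromℕ d - fromℕ d)) - fromℕ b       ≈⟨ +-congʳ (+-assoc _ _ _) ⟨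
      ((fromℕ a + fromℕ d) - fromℕ d) - fromℕ b       ≈⟨ +-congʳ (+-congʳ a+d≈c+b) ⟩
      ((fromℕ c + fromℕ b) - fromℕ d) - fromℕ b       ≈⟨ +-assoc _ _ _ ⟩
      (fromℕ c + fromℕ b) + (- fromℕ d - fromℕ b)     ≈⟨ interchange _ _ _ _ ⟩
      (fromℕ c - fromℕ d) + (fromℕ b - fromℕ b)       ≈⟨ +-congˡ (-‿inverseʳ _) ⟩
      (fromℕ c - fromℕ d) + 0#                        ≈⟨ +-identityʳ _ ⟩
      fromℕ c - fromℕ d                               ∎
      where
      a+d≈c+b : fromℕ a + fromℕ d ≈ fromℕ c + fromℕ b
      a+d≈c+b = ≈-trans (≈-sym (×-homo-+ 1# a d)) (≈-trans (reflexive (≡.cong fromℕ e)) (×-homo-+ 1# c b))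

    eval-≟ : ∀ p q → Maybe (eval p ≈ eval q)
    eval-≟ (a , b) (c , d) with a ℕ.+ d ℕ.≟ c ℕ.+ b
    ... | yes e = just (≈-trans (eval≈ a b) (≈-trans (fromℕ-diff a b c d e) (≈-sym (eval≈ c d))))
    ... | no  _ = nothing

  module Solver = Algebra.Solver.Ring Coefficients.Coefficient (fromCommutativeRing commutativeRing)
                    Coefficients.morphism Coefficients.eval-≟
  open Solver public using (solve; Polynomial; con; _:+_; _:*_; _:-_; :-_; _:=_)

  :0 :1 :2 : ∀ {k} → Polynomial k
  :0 = con (0 , 0)
  :1 = con (1 , 0)
  :2 = con (2 , 0)

  open IsStrictTotalOrder isStrictTotalOrder public using ()
    renaming (trans to <-trans; compare to <-cmp; irrefl to <-irrefl; <-respˡ-≈ to <-respˡ; <-respʳ-≈ to <-respʳ)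

  ≤-refl : ∀ {x} → x ≤ x
  ≤-refl = inj₂ ≈-refl

  ≤-reflexive : ∀ {x y} → x ≈ y → x ≤ y
  ≤-reflexive = inj₂

  <⇒≤ : ∀ {x y} → x < y → x ≤ y
  <⇒≤ = inj₁

  ≤-trans : ∀ {x y z} → x ≤ y → y ≤ z → x ≤ z
  ≤-trans (inj₁ p) (inj₁ q) = inj₁ (<-trans p q)
  ≤-trans (inj₁ p) (inj₂ q) = inj₁ (<-respʳ q p)
  ≤-trans (inj₂ p) (inj₁ q) = inj₁ (<-respˡ (≈-sym p) q)
  ≤-trans (inj₂ p) (inj₂ q) = inj₂ (≈-trans p q)

  <-≤-trans : ∀ {x y z} → x < y → y ≤ z → x < z
  <-≤-trans p (inj₁ q) = <-trans p q
  <-≤-trans p (inj₂ q) = <-respʳ q p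

  <⇒≱ : ∀ {x y} → x < y → ¬ y ≤ x
  <⇒≱ p q = <-irrefl ≈-refl (<-≤-trans p q)

  ≮⇒≥ : ∀ {x y} → ¬ x < y → y ≤ x
  ≮⇒≥ {x} {y} ¬p with <-cmp x y
  ... | tri< p _ _ = ⊥-elim (¬p p)
  ... | tri≈ _ p _ = inj₂ (≈-sym p)
  ... | tri> _ _ p = inj₁ p

  <-or-≥ : ∀ x y → x < y ⊎ y ≤ x
  <-or-≥ x y with <-cmp x y
  ... | tri< p _ _ = inj₁ p
  ... | tri≈ _ p _ = inj₂ (inj₂ (≈-sym p))
  ... | tri> _ _ p = inj₂ (inj₁ p)

  ≤-antisym : ∀ {x y} → x ≤ y → y ≤ x → x ≈ y
  ≤-antisym (inj₁ p) q = ⊥-elim (<⇒≱ p q)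
  ≤-antisym (inj₂ p) q = p

  ≤-respʳ : ∀ {x y z} → y ≈ z → x ≤ y → x ≤ z
  ≤-respʳ e p = ≤-trans p (inj₂ e)

  ≤-respˡ : ∀ {x y z} → x ≈ y → x ≤ z → y ≤ z
  ≤-respˡ e p = ≤-trans (inj₂ (≈-sym e)) p

  +-pos-pos : ∀ {x y} → 0# < x → 0# < y → 0# < x + y
  +-pos-pos {x} p q = <-trans p (<-respˡ (+-identityʳ x) (+-monoʳ-< x q))

  +-nonneg : ∀ {x y} → 0# ≤ x → 0# ≤ y → 0# ≤ x + y
  +-nonneg (inj₁ p) (inj₁ q) = inj₁ (+-pos-pos p q)
  +-nonneg {x} p (inj₂ q) = ≤-respʳ (≈-trans (≈-sym (+-identityʳ x)) (+-congˡ q)) p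
  +-nonneg {y = y} (inj₂ p) q@(inj₁ _) = ≤-respʳ (≈-trans (≈-sym (+-identityˡ y)) (+-congʳ p)) q

  +-pos-nonneg : ∀ {x y} → 0# < x → 0# ≤ y → 0# < x + y
  +-pos-nonneg p (inj₁ q) = +-pos-pos p q
  +-pos-nonneg {x} p (inj₂ q) = <-respʳ (≈-trans (≈-sym (+-identityʳ x)) (+-congˡ q)) p

  *-nonneg : ∀ {x y} → 0# ≤ x → 0# ≤ y → 0# ≤ x * y
  *-nonneg (inj₁ p) (inj₁ q) = inj₁ (*-pos p q)
  *-nonneg {x} _ (inj₂ q) = inj₂ (≈-trans (≈-sym (zeroʳ x)) (*-congˡ q))
  *-nonneg {y = y} (inj₂ p) (inj₁ _) = inj₂ (≈-trans (≈-sym (zeroˡ y)) (*-congʳ p))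

  0≤1 : 0# ≤ 1#
  0≤1 = inj₁ 0<1

  0<⇒< : ∀ {x y d} → 0# < d → y ≈ x + d → x < y
  0<⇒< {x} p e = <-respʳ (≈-sym e) (<-respˡ (+-identityʳ x) (+-monoʳ-< x p))

  0≤⇒≤ : ∀ {x y d} → 0# ≤ d → y ≈ x + d → x ≤ y
  0≤⇒≤ (inj₁ p) e = inj₁ (0<⇒< p e)
  0≤⇒≤ {x} (inj₂ p) e = inj₂ (≈-trans (≈-trans (≈-sym (+-identityʳ x)) (+-congˡ p)) (≈-sym e))

  <⇒0< : ∀ {x y} → x < y → 0# < y - x
  <⇒0< {x} {y} p = <-respʳ (+-comm (- x) y) (<-respˡ (-‿inverseˡ x) (+-monoʳ-< (- x) p))

  ≤⇒0≤ : ∀ {x y} → x ≤ y → 0# ≤ y - x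
  ≤⇒0≤ (inj₁ p) = inj₁ (<⇒0< p)
  ≤⇒0≤ {x} (inj₂ p) = inj₂ (≈-trans (≈-sym (-‿inverseʳ x)) (+-congʳ p))

  neg-nonneg : ∀ {x} → x ≤ 0# → 0# ≤ - x
  neg-nonneg {x} p = ≤-respʳ (+-identityˡ (- x)) (≤⇒0≤ p)

  neg-nonpos : ∀ {x} → 0# ≤ x → - x ≤ 0#
  neg-nonpos {x} p = 0≤⇒≤ p (≈-sym (-‿inverseˡ x))

  neg-pos : ∀ {x} → x < 0# → 0# < - x
  neg-pos {x} p = <-respʳ (+-identityˡ (- x)) (<⇒0< p)

  *-cancel-nonneg : ∀ {x y} → 0# < x → 0# ≤ x * y → 0# ≤ y
  *-cancel-nonneg {x} {y} p q = ≮⇒≥ λ y<0 → <⇒≱ (*-pos p (neg-pos y<0))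
    (≤-respˡ (-‿distribʳ-* x y) (neg-nonpos q))

  *-nonzero : ∀ {x y} → ¬ x ≈ 0# → x * y ≈ 0# → y ≈ 0#
  *-nonzero {x} {y} x≉0 e = begin
    y                ≈⟨ *-identityˡ y ⟨
    1# * y           ≈⟨ *-congʳ (*-inverseʳ x≉0) ⟨
    (x * x ⁻¹) * y   ≈⟨ solve 3 (λ x z y → (x :* z) :* y := z :* (x :* y)) ≈-refl x (x ⁻¹) y ⟩
    x ⁻¹ * (x * y)   ≈⟨ *-congˡ e ⟩
    x ⁻¹ * 0#        ≈⟨ zeroʳ _ ⟩
    0#               ∎
    where open ≈-Reasoning

  >⇒≉ : ∀ {x y} → x < y → ¬ y ≈ x
  >⇒≉ p e = <-irrefl (≈-sym e) p

  0<2 : 0# < 2#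
  0<2 = <-respʳ (solve 0 (:1 :+ :1 := :2) ≈-refl) (+-pos-pos 0<1 0<1)

  ⁻¹-pos : ∀ {x} → 0# < x → 0# < x ⁻¹
  ⁻¹-pos {x} p with <-cmp 0# (x ⁻¹)
  ... | tri< q _ _ = q
  ... | tri≈ _ q _ = ⊥-elim (>⇒≉ 0<1 (≈-trans (≈-sym (*-inverseʳ (>⇒≉ p))) (≈-trans (*-congˡ (≈-sym q)) (zeroʳ x))))
  ... | tri> _ _ q = ⊥-elim (<⇒≱ 0<1 (≤-respˡ
          (≈-trans (solve 2 (λ x y → :- (x :* :- y) := x :* y) ≈-refl x (x ⁻¹)) (*-inverseʳ (>⇒≉ p)))
          (neg-nonpos (inj₁ (*-pos p (neg-pos q))))))

  fromℕ-nonneg : ∀ k → 0# ≤ fromℕ k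
  fromℕ-nonneg zero    = ≤-refl
  fromℕ-nonneg (suc k) = +-nonneg 0≤1 (fromℕ-nonneg k)

  fromℕ-pos : ∀ {k} → 1 ℕ.≤ k → 0# < fromℕ k
  fromℕ-pos {suc k} _ = +-pos-nonneg 0<1 (fromℕ-nonneg k)

  fromℕ-< : ∀ {k l} → k ℕ.< l → fromℕ k < fromℕ l
  fromℕ-< {zero}  {suc l} _       = fromℕ-pos {suc l} (s≤s z≤n)
  fromℕ-< {suc k} {suc l} (s≤s p) = +-monoʳ-< 1# (fromℕ-< p)

  sum-nonneg : ∀ {k} (f : Fin k → Carrier) → (∀ i → 0# ≤ f i) → 0# ≤ sum f
  sum-nonneg {zero}  f p = ≤-refl
  sum-nonneg {suc k} f p = +-nonneg (p Fin.zero) (sum-nonneg (f ∘ Fin.suc) (p ∘ Fin.suc))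

-- Chebyshev numbers

module Chebyshev (ℝ : RealNumbers) where
  open RealProperties ℝ

  -- The Chebyshev numbers sin (k θ) / sin θ for a = 2 cos θ.
  cheb : Carrier → ℕ → Carrier
  cheb a zero          = 0#
  cheb a (suc zero)    = 1#
  cheb a (suc (suc k)) = a * cheb a (suc k) - cheb a k

  cheb-cong : ∀ {a b} → a ≈ b → ∀ k → cheb a k ≈ cheb b k
  cheb-cong e zero          = ≈-refl
  cheb-cong e (suc zero)    = ≈-refl
  cheb-cong e (suc (suc k)) = +-cong (*-cong e (cheb-cong e (suc k))) (-‿cong (cheb-cong e k))

  cheb-2 : ∀ a → cheb a 2 ≈ a
  cheb-2 = solve 1 (λ a → a :* :1 :- :0 := a) ≈-refl

  -- A solution of the recurrence is determined by its first two values. The index starts at 1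
  -- because the coefficient of `f 0` in `f k` is minus the Chebyshev number at k - 1.
  cheb-unique : ∀ a (f : ℕ → Carrier) → (∀ k → f (suc (suc k)) ≈ a * f (suc k) - f k) →
                ∀ k → f (suc k) ≈ cheb a (suc k) * f 1 - cheb a k * f 0
  cheb-unique a f rec k = proj₁ (both k)
    where
    open ≈-Reasoning
    both : ∀ k → f (suc k) ≈ cheb a (suc k) * f 1 - cheb a k * f 0 ×
                 f (suc (suc k)) ≈ cheb a (suc (suc k)) * f 1 - cheb a (suc k) * f 0
    both zero    = solve 2 (λ x y → x := :1 :* x :- :0 :* y) ≈-refl (f 1) (f 0) ,
                   ≈-trans (rec 0) (solve 3 (λ a x y → a :* x :- y := (a :* :1 :- :0) :* x :- :1 :* y) ≈-refl a (f 1) (f 0))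
    both (suc k) with p , q ← both k = q , (begin
      f (suc (suc (suc k)))                 ≈⟨ rec (suc k) ⟩
      a * f (suc (suc k)) - f (suc k)       ≈⟨ +-cong (*-congˡ q) (-‿cong p) ⟩
      _ ≈⟨ solve 6 (λ a x y c d e → a :* (c :* x :- d :* y) :- (d :* x :- e :* y)
                   := (a :* c :- d) :* x :- (a :* d :- e) :* y) ≈-refl a (f 1) (f 0)
             (cheb a (suc (suc k))) (cheb a (suc k)) (cheb a k) ⟩
      cheb a (suc (suc (suc k))) * f 1 - cheb a (suc (suc k)) * f 0 ∎)

  cheb-unique₀ : ∀ a (f : ℕ → Carrier) → (∀ k → f (suc (suc k)) ≈ a * f (suc k) - f k) →
                 f 0 ≈ 0# → ∀ k → f k ≈ cheb a k * f 1
  cheb-unique₀ a f rec e zero    = ≈-trans e (≈-sym (zeroˡ _))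
  cheb-unique₀ a f rec e (suc k) = begin
    f (suc k)                             ≈⟨ cheb-unique a f rec k ⟩
    cheb a (suc k) * f 1 - cheb a k * f 0 ≈⟨ +-congˡ (-‿cong (*-congˡ e)) ⟩
    cheb a (suc k) * f 1 - cheb a k * 0#  ≈⟨ solve 3 (λ c x d → c :* x :- d :* :0 := c :* x) ≈-refl _ (f 1) (cheb a k) ⟩
    cheb a (suc k) * f 1                  ∎
    where open ≈-Reasoning

  cheb-at-2 : ∀ {a} → a ≈ 2# → ∀ k → cheb a k ≈ fromℕ k
  cheb-at-2 {a} e k = ≈-sym (≈-trans (cheb-unique₀ a fromℕ rec ≈-refl k) (≈-trans (*-congˡ (+-identityʳ 1#)) (*-identityʳ _)))
    where
    rec : ∀ k → fromℕ (suc (suc k)) ≈ a * fromℕ (suc k) - fromℕ k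
    rec k = ≈-trans (solve 1 (λ x → :1 :+ (:1 :+ x) := :2 :* (:1 :+ x) :- x) ≈-refl (fromℕ k))
                    (+-congʳ (*-congʳ (≈-sym e)))

  -- The algebraic content of a = 2 cos (π / M): boundary values at M and M - 1, and nonnegativity
  -- in between. The sharper inequalities follow from the recurrence.
  record IsFiniteCoefficient (a : Carrier) (M : ℕ) : Set where
    field
      1<M       : 2 ℕ.≤ M
      a<2       : a < 2#
      cheb-end  : cheb a M ≈ 0#
      cheb-last : cheb a (ℕ.pred M) ≈ 1#
      cheb≥0    : ∀ {k} → k ℕ.≤ M → 0# ≤ cheb a k

    -- Concavity: the second difference is (a - 2) `cheb a (suc k)`, a product of a negative and a
    -- nonnegative factor.
    difference-decreasing : ∀ {k} → suc k ℕ.≤ M →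
      cheb a (suc (suc k)) - cheb a (suc k) ≤ cheb a (suc k) - cheb a k
    difference-decreasing {k} k<M = 0≤⇒≤ (*-nonneg (inj₁ (<⇒0< a<2)) (cheb≥0 k<M))
      (solve 3 (λ a x y → x :- y := ((a :* x :- y) :- x) :+ (:2 :- a) :* x) ≈-refl a (cheb a (suc k)) (cheb a k))

    decreasing-after : ∀ k → cheb a (suc k) ≤ cheb a k → ∀ i → suc (i ℕ.+ k) ℕ.≤ M →
                       cheb a (suc (i ℕ.+ k)) ≤ cheb a k × cheb a (suc (i ℕ.+ k)) ≤ cheb a (i ℕ.+ k)
    decreasing-after k le zero    _ = le , le
    decreasing-after k le (suc i) b with p , q ← decreasing-after k le i (ℕ.≤-trans (ℕ.n≤1+n _) b) = ≤-trans r p , r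
      where
      r : cheb a (suc (suc (i ℕ.+ k))) ≤ cheb a (suc (i ℕ.+ k))
      r = 0≤⇒≤ (+-nonneg (≤⇒0≤ (difference-decreasing (ℕ.≤-trans (ℕ.n≤1+n _) b))) (≤⇒0≤ q))
            (solve 3 (λ x y z → y := x :+ (((y :- z) :- (x :- y)) :+ (z :- y))) ≈-refl _ _ _)

    -- A concave sequence that has dropped once keeps dropping; it could not fall below 1 and still
    -- take the value 1 at M - 1.
    cheb≥1-step : ∀ k → suc (suc k) ℕ.< M → 1# ≤ cheb a (suc k) → 1# ≤ cheb a (suc (suc k))
    cheb≥1-step k b 1≤ with <-or-≥ (cheb a (suc (suc k))) (cheb a (suc k))
    ... | inj₂ le = ≤-trans 1≤ le
    ... | inj₁ lt = ≮⇒≥ λ c<1 → <⇒≱ c<1 (≤-trans (≤-reflexive (≈-sym last)) (last≤ (ℕ.m+[n∸m]≡n b)))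
      where
      i : ℕ
      i = M ℕ.∸ suc (suc (suc k))
      last : cheb a (suc (suc (k ℕ.+ i))) ≈ 1#
      last = ≈-trans (reflexive (≡.cong (cheb a ∘ ℕ.pred) (ℕ.m+[n∸m]≡n b))) cheb-last
      last≤ : suc (suc (suc (k ℕ.+ i))) ≡ M → cheb a (suc (suc (k ℕ.+ i))) ≤ cheb a (suc (suc k))
      last≤ e with i
      ... | zero  = ≤-reflexive (reflexive (≡.cong (λ l → cheb a (suc (suc l))) (ℕ.+-identityʳ k)))
      ... | suc i = ≤-respˡ (reflexive (≡.cong (cheb a ∘ suc) (ℕ.+-comm (suc i) (suc k)))) (step (suc i) bound)
        where
        bound : suc (suc i ℕ.+ suc k) ℕ.≤ M
        bound = ℕ.≤-trans (ℕ.≤-reflexive (≡.cong suc (ℕ.+-comm (suc i) (suc k))))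
                          (ℕ.≤-trans (ℕ.n≤1+n _) (ℕ.≤-reflexive e))
        step : ∀ i → suc (i ℕ.+ suc k) ℕ.≤ M → cheb a (suc (i ℕ.+ suc k)) ≤ cheb a (suc (suc k))
        step zero    _ = ≤-refl
        step (suc i) b = ≤-trans (proj₂ (decreasing-after (suc k) (inj₁ lt) (suc i) b)) (step i (ℕ.≤-trans (ℕ.n≤1+n _) b))

    cheb≥1 : ∀ {k} → 1 ℕ.≤ k → k ℕ.< M → 1# ≤ cheb a k
    cheb≥1 {suc zero}    _ _ = ≤-refl
    cheb≥1 {suc (suc k)} _ b = cheb≥1-step k b (cheb≥1 (s≤s z≤n) (ℕ.<-trans (ℕ.n<1+n _) b))

    -- This is sin (kθ + π) = - sin kθ: the shifted sequence solves the same recurrence, with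
    -- initial values 0 and -1.
    cheb-shift : ∀ k → cheb a (k ℕ.+ M) ≈ - cheb a k
    cheb-shift k = ≈-trans (cheb-unique₀ a (λ k → cheb a (k ℕ.+ M)) (λ _ → ≈-refl) cheb-end k)
      (≈-trans (*-congˡ next) (solve 1 (λ x → x :* :- :1 := :- x) ≈-refl _))
      where
      after : ∀ {K} → 2 ℕ.≤ K → cheb a K ≈ 0# → cheb a (ℕ.pred K) ≈ 1# → cheb a (suc K) ≈ - 1#
      after {suc K} _ end last = ≈-trans (+-cong (*-congˡ end) (-‿cong last)) (solve 1 (λ a → a :* :0 :- :1 := :- :1) ≈-refl a)
      next : cheb a (suc M) ≈ - 1#
      next = after 1<M cheb-end cheb-last

    cheb-reflect : ∀ k l → k ℕ.+ l ≡ M → cheb a k ≈ cheb a l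
    cheb-reflect zero          l e = ≈-sym (≈-trans (reflexive (≡.cong (cheb a) e)) cheb-end)
    cheb-reflect (suc zero)    l e = ≈-sym (≈-trans (reflexive (≡.cong (cheb a ∘ ℕ.pred) e)) cheb-last)
    cheb-reflect (suc (suc k)) l e = ≈-trans (+-cong (*-congˡ (cheb-reflect (suc k) (suc l) e₁)) (-‿cong (cheb-reflect k (suc (suc l)) e₂)))
      (solve 3 (λ a x y → a :* x :- (a :* x :- y) := y) ≈-refl a _ _)
      where
      e₁ : suc k ℕ.+ suc l ≡ M
      e₁ = ≡.trans (ℕ.+-suc (suc k) l) e
      e₂ : k ℕ.+ suc (suc l) ≡ M
      e₂ = ≡.trans (ℕ.+-suc k (suc l)) e₁

    -- By concavity no increment exceeds the first one, `1# - 0#`.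
    cheb-growth : ∀ k → suc k ℕ.≤ M → cheb a (suc k) - cheb a k ≤ 1#
    cheb-growth zero    _ = ≤-reflexive (solve 0 (:1 :- :0 := :1) ≈-refl)
    cheb-growth (suc k) b = ≤-trans (difference-decreasing (ℕ.≤-trans (ℕ.n≤1+n _) b)) (cheb-growth k (ℕ.≤-trans (ℕ.n≤1+n _) b))

    -- The symmetry k ↦ M - k turns a decrease into an increase. This bound is what keeps the
    -- coordinates large in the second half of an alternating run.
    cheb-decay : ∀ k → suc k ℕ.≤ M → cheb a k - cheb a (suc k) ≤ 1#
    cheb-decay k b = ≤-respˡ (+-cong (cheb-reflect (suc l) k e) (-‿cong (cheb-reflect l (suc k) e′))) (cheb-growth l bound)
      where
      l : ℕ
      l = M ℕ.∸ suc k
      e′ : l ℕ.+ suc k ≡ M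
      e′ = ℕ.m∸n+n≡m b
      e : suc l ℕ.+ k ≡ M
      e = ≡.trans (≡.sym (ℕ.+-suc l k)) e′
      bound : suc l ℕ.≤ M
      bound = ℕ.≤-trans (ℕ.m≤m+n (suc l) k) (ℕ.≤-reflexive e)

    1≤a : 3 ℕ.≤ M → 1# ≤ a
    1≤a 3≤M = ≤-respʳ (cheb-2 a) (cheb≥1 (s≤s z≤n) 3≤M)

-- The numbers 2 cos (π / M)

module CosineCoefficients (ℝ : RealNumbers) (trig : Trigonometry ℝ) where
  open RealProperties ℝ
  open Chebyshev ℝ
  open Trigonometry trig

  half : Carrier
  half = π * 2# ⁻¹

  2#≉0 : ¬ 2# ≈ 0#
  2#≉0 = >⇒≉ 0<2

  half+half : half + half ≈ π
  half+half = begin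
    π * 2# ⁻¹ + π * 2# ⁻¹ ≈⟨ solve 2 (λ p x → p :* x :+ p :* x := p :* (:2 :* x)) ≈-refl π (2# ⁻¹) ⟩
    π * (2# * 2# ⁻¹)      ≈⟨ *-congˡ (*-inverseʳ 2#≉0) ⟩
    π * 1#                ≈⟨ *-identityʳ π ⟩
    π                     ∎
    where open ≈-Reasoning

  square-zero : ∀ {x} → x * x ≈ 0# → x ≈ 0#
  square-zero {x} e with <-cmp x 0#
  ... | tri< p _ _ = ⊥-elim (>⇒≉ (*-pos (neg-pos p) (neg-pos p)) (≈-trans (solve 1 (λ x → :- x :* :- x := x :* x) ≈-refl x) e))
  ... | tri≈ _ p _ = p
  ... | tri> _ _ p = ⊥-elim (>⇒≉ (*-pos p p) e)

  pythagoras : ∀ x → cos x * cos x + sin x * sin x ≈ 1#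
  pythagoras x = ≈-trans (≈-sym (cos-sub x x)) (≈-trans (cos-cong (-‿inverseʳ x)) cos-0)

  sum-one : ∀ {x y} → x + y ≈ 1# → y ≈ 1# → x ≈ 0#
  sum-one {x} {y} e f = begin
    x           ≈⟨ solve 2 (λ x y → x := (x :+ y) :- y) ≈-refl x y ⟩
    (x + y) - y ≈⟨ +-cong e (-‿cong f) ⟩
    1# - 1#     ≈⟨ -‿inverseʳ 1# ⟩
    0#          ∎
    where open ≈-Reasoning

  cos-half : cos half ≈ 0#
  cos-half = square-zero (sum-one (pythagoras half) (≈-trans (*-cong sin-π/2 sin-π/2) (*-identityʳ 1#)))

  sin-0 : sin 0# ≈ 0#
  sin-0 = square-zero (sum-one (≈-trans (+-comm _ _) (pythagoras 0#)) (≈-trans (*-cong cos-0 cos-0) (*-identityʳ 1#)))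

  cos-complement : ∀ x → cos (half - x) ≈ sin x
  cos-complement x = begin
    cos (half - x)                        ≈⟨ cos-sub x half ⟩
    cos half * cos x + sin half * sin x   ≈⟨ +-cong (*-congʳ cos-half) (*-congʳ sin-π/2) ⟩
    0# * cos x + 1# * sin x               ≈⟨ solve 2 (λ c s → :0 :* c :+ :1 :* s := s) ≈-refl (cos x) (sin x) ⟩
    sin x                                 ∎
    where open ≈-Reasoning

  cos-even : ∀ x → cos (- x) ≈ cos x
  cos-even x = begin
    cos (- x)                       ≈⟨ cos-cong (+-identityˡ (- x)) ⟨
    cos (0# - x)                    ≈⟨ cos-sub x 0# ⟩
    cos 0# * cos x + sin 0# * sin x ≈⟨ +-cong (*-congʳ cos-0) (*-congʳ sin-0) ⟩
    1# * cos x + 0# * sin x         ≈⟨ solve 2 (λ c s → :1 :* c :+ :0 :* s := c) ≈-refl (cos x) (sin x) ⟩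
    cos x                           ∎
    where open ≈-Reasoning

  sin-neg-half : sin (- half) ≈ - 1#
  sin-neg-half = begin
    sin (- half)          ≈⟨ cos-complement (- half) ⟨
    cos (half - (- half)) ≈⟨ cos-cong (≈-trans (+-congˡ (-‿involutive half)) half+half) ⟩
    cos π                 ≈⟨ cos-π ⟩
    - 1#                  ∎
    where open ≈-Reasoning

  sin-odd : ∀ x → sin (- x) ≈ - sin x
  sin-odd x = begin
    sin (- x)                                 ≈⟨ cos-complement (- x) ⟨
    cos (half - (- x))                        ≈⟨ cos-cong (solve 2 (λ h x → h :- :- x := x :- :- h) ≈-refl half x) ⟩
    cos (x - (- half))                        ≈⟨ cos-sub (- half) x ⟩
    cos x * cos (- half) + sin x * sin (- half)
      ≈⟨ +-cong (*-congˡ (≈-trans (cos-even half) cos-half)) (*-congˡ sin-neg-half) ⟩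
    cos x * 0# + sin x * - 1#                 ≈⟨ solve 2 (λ c s → c :* :0 :+ s :* :- :1 := :- s) ≈-refl (cos x) (sin x) ⟩
    - sin x                                   ∎
    where open ≈-Reasoning

  cos-sum : ∀ x y → cos (y - x) + cos (y + x) ≈ (2# * cos x) * cos y
  cos-sum x y = begin
    cos (y - x) + cos (y + x)     ≈⟨ +-congˡ (cos-cong (+-congˡ (-‿involutive x))) ⟨
    cos (y - x) + cos (y - (- x)) ≈⟨ +-cong (cos-sub x y) (cos-sub (- x) y) ⟩
    (cos y * cos x + sin y * sin x) + (cos y * cos (- x) + sin y * sin (- x))
      ≈⟨ +-congˡ (+-cong (*-congˡ (cos-even x)) (*-congˡ (sin-odd x))) ⟩
    (cos y * cos x + sin y * sin x) + (cos y * cos x + sin y * - sin x)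
      ≈⟨ solve 4 (λ c s d t → (c :* d :+ s :* t) :+ (c :* d :+ s :* :- t) := (:2 :* d) :* c) ≈-refl (cos y) (sin y) (cos x) (sin x) ⟩
    (2# * cos x) * cos y          ∎
    where open ≈-Reasoning

  cos-pos-symmetric : ∀ {x} → - half < x → x < half → 0# < cos x
  cos-pos-symmetric {x} p q with <-cmp 0# x
  ... | tri< 0<x _ _ = cos-pos 0<x q
  ... | tri≈ _ 0≈x _ = <-respʳ (≈-sym (≈-trans (cos-cong (≈-sym 0≈x)) cos-0)) 0<1
  ... | tri> _ _ x<0 = <-respʳ (cos-even x) (cos-pos (neg-pos x<0)
          (0<⇒< (<⇒0< p) (solve 2 (λ x h → h := :- x :+ (x :- :- h)) ≈-refl x half)))

  module _ {M : ℕ} (2≤M : 2 ℕ.≤ M) where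
    private
      N θ a : Carrier
      N = fromℕ M
      θ = π * N ⁻¹
      a = 2# * cos θ

      0<N : 0# < N
      0<N = fromℕ-pos (ℕ.≤-trans (ℕ.n≤1+n 1) 2≤M)

      0<θ : 0# < θ
      0<θ = *-pos 0<π (⁻¹-pos 0<N)

      Nθ : N * θ ≈ π
      Nθ = begin
        N * (π * N ⁻¹) ≈⟨ solve 3 (λ n p i → n :* (p :* i) := p :* (n :* i)) ≈-refl N π (N ⁻¹) ⟩
        π * (N * N ⁻¹) ≈⟨ *-congˡ (*-inverseʳ (>⇒≉ 0<N)) ⟩
        π * 1#         ≈⟨ *-identityʳ π ⟩
        π              ∎
        where open ≈-Reasoning

      -- sin (kθ) in the form of a cosine: `cos-sum` then yields the recurrence and
      -- `cos-pos-symmetric` the sign, and dividing by `f 1` = sin θ gives the Chebyshev numbers.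
      f : ℕ → Carrier
      f k = cos (half - fromℕ k * θ)

      f-rec : ∀ k → f (suc (suc k)) ≈ a * f (suc k) - f k
      f-rec k = begin
        f (suc (suc k))                   ≈⟨ solve 2 (λ x y → x := (x :+ y) :- y) ≈-refl _ (f k) ⟩
        (f (suc (suc k)) + f k) - f k
          ≈⟨ +-congʳ (+-cong (cos-cong (solve 3 (λ h x t → h :- (:1 :+ (:1 :+ x)) :* t := (h :- (:1 :+ x) :* t) :- t) ≈-refl half (fromℕ k) θ))
                             (cos-cong (solve 3 (λ h x t → h :- x :* t := (h :- (:1 :+ x) :* t) :+ t) ≈-refl half (fromℕ k) θ))) ⟩
        (cos ((half - fromℕ (suc k) * θ) - θ) + cos ((half - fromℕ (suc k) * θ) + θ)) - f k ≈⟨ +-congʳ (cos-sum θ _) ⟩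
        a * f (suc k) - f k               ∎
        where open ≈-Reasoning

      f-0 : f 0 ≈ 0#
      f-0 = ≈-trans (cos-cong (solve 2 (λ h t → h :- :0 :* t := h) ≈-refl half θ)) cos-half

      f≈ : ∀ k → f k ≈ cheb a k * f 1
      f≈ = cheb-unique₀ a f f-rec f-0

      f-pos : ∀ {k} → 1 ℕ.≤ k → k ℕ.< M → 0# < f k
      f-pos {k} 1≤k k<M = cos-pos-symmetric
        (0<⇒< (*-pos (<⇒0< (fromℕ-< k<M)) 0<θ) lower)
        (0<⇒< (*-pos (fromℕ-pos 1≤k) 0<θ) (solve 2 (λ h x → h := (h :- x) :+ x) ≈-refl half _))
        where
        open ≈-Reasoning
        lower : half - fromℕ k * θ ≈ - half + (N - fromℕ k) * θ
        lower = begin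
          half - fromℕ k * θ                    ≈⟨ solve 2 (λ h x → h :- x := :- h :+ ((h :+ h) :- x)) ≈-refl half _ ⟩
          - half + ((half + half) - fromℕ k * θ) ≈⟨ +-congˡ (+-congʳ (≈-trans half+half (≈-sym Nθ))) ⟩
          - half + (N * θ - fromℕ k * θ)        ≈⟨ +-congˡ (solve 3 (λ n k t → n :* t :- k :* t := (n :- k) :* t) ≈-refl N (fromℕ k) θ) ⟩
          - half + (N - fromℕ k) * θ            ∎

      0<f1 : 0# < f 1
      0<f1 = f-pos (s≤s z≤n) 2≤M

      cancel : ∀ {x y} → x * f 1 ≈ y * f 1 → x ≈ y
      cancel {x} {y} e = begin
        x           ≈⟨ solve 2 (λ x y → x := (x :- y) :+ y) ≈-refl x y ⟩
        (x - y) + y ≈⟨ +-congʳ (*-nonzero (>⇒≉ 0<f1) difference) ⟩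
        0# + y      ≈⟨ +-identityˡ y ⟩
        y           ∎
        where
        open ≈-Reasoning
        difference : f 1 * (x - y) ≈ 0#
        difference = ≈-trans (solve 3 (λ f x y → f :* (x :- y) := x :* f :- y :* f) ≈-refl (f 1) x y)
                             (≈-trans (+-congʳ e) (-‿inverseʳ _))

      f-end : f M ≈ 0#
      f-end = begin
        cos (half - N * θ)          ≈⟨ cos-cong (+-congˡ (-‿cong (≈-trans Nθ (≈-sym half+half)))) ⟩
        cos (half - (half + half))  ≈⟨ cos-cong (solve 1 (λ h → h :- (h :+ h) := :- h) ≈-refl half) ⟩
        cos (- half)                ≈⟨ cos-even half ⟩
        cos half                    ≈⟨ cos-half ⟩
        0#                          ∎
        where open ≈-Reasoning

      f-last : ∀ {k} → suc k ≡ M → f k ≈ f 1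
      f-last {k} ≡.refl = begin
        cos (half - fromℕ k * θ)
          ≈⟨ cos-cong (solve 3 (λ h k t → h :- k :* t := h :- ((:1 :+ k) :* t :- t)) ≈-refl half (fromℕ k) θ) ⟩
        cos (half - (N * θ - θ))
          ≈⟨ cos-cong (+-congˡ (-‿cong (+-congʳ (≈-trans Nθ (≈-sym half+half))))) ⟩
        cos (half - ((half + half) - θ))
          ≈⟨ cos-cong (solve 2 (λ h t → h :- ((h :+ h) :- t) := :- (h :- (:1 :+ :0) :* t)) ≈-refl half θ) ⟩
        cos (- (half - fromℕ 1 * θ)) ≈⟨ cos-even _ ⟩
        f 1                         ∎
        where open ≈-Reasoning

      cheb-pos : ∀ {k} → 1 ℕ.≤ k → k ℕ.< M → 0# < cheb a k
      cheb-pos {k} p q with <-or-≥ 0# (cheb a k)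
      ... | inj₁ r = r
      ... | inj₂ r = ⊥-elim (<⇒≱ (f-pos p q) (≤-respˡ negated (neg-nonpos (*-nonneg (neg-nonneg r) (inj₁ 0<f1)))))
        where
        negated : - (- cheb a k * f 1) ≈ f k
        negated = ≈-trans (solve 2 (λ x y → :- (:- x :* y) := x :* y) ≈-refl (cheb a k) (f 1)) (≈-sym (f≈ k))

      -- With c = cos θ and sin θ = `f 1` > 0, the identity c² - 1 = (c - 1)² + 2 (c - 1) shows that
      -- c ≥ 1 contradicts c² + sin² θ = 1.
      cos<1 : cos θ < 1#
      cos<1 with <-or-≥ (cos θ) 1#
      ... | inj₁ p = p
      ... | inj₂ p = ⊥-elim (<⇒≱ (*-pos 0<f1 0<f1) (0≤⇒≤ (+-nonneg (*-nonneg (≤⇒0≤ p) (≤⇒0≤ p))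
                       (*-nonneg (inj₁ 0<2) (≤⇒0≤ p))) eq))
        where
        open ≈-Reasoning
        sinθ : f 1 ≈ sin θ
        sinθ = ≈-trans (cos-cong (solve 2 (λ h t → h :- (:1 :+ :0) :* t := h :- t) ≈-refl half θ)) (cos-complement θ)
        eq : 0# ≈ f 1 * f 1 + ((cos θ - 1#) * (cos θ - 1#) + 2# * (cos θ - 1#))
        eq = begin
          0#                                       ≈⟨ -‿inverseʳ 1# ⟨
          1# - 1#                                  ≈⟨ +-congʳ (pythagoras θ) ⟨
          (cos θ * cos θ + sin θ * sin θ) - 1#     ≈⟨ +-congʳ (+-congˡ (*-cong sinθ sinθ)) ⟨
          (cos θ * cos θ + f 1 * f 1) - 1#
            ≈⟨ solve 2 (λ c f → (c :* c :+ f :* f) :- :1 := f :* f :+ ((c :- :1) :* (c :- :1) :+ :2 :* (c :- :1))) ≈-refl (cos θ) (f 1) ⟩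
          f 1 * f 1 + ((cos θ - 1#) * (cos θ - 1#) + 2# * (cos θ - 1#)) ∎

    cosine-coefficient : IsFiniteCoefficient (2# * cos (π * fromℕ M ⁻¹)) M
    cosine-coefficient = record
      { 1<M       = 2≤M
      ; a<2       = 0<⇒< (*-pos 0<2 (<⇒0< cos<1)) (solve 1 (λ c → :2 := :2 :* c :+ :2 :* (:1 :- c)) ≈-refl (cos θ))
      ; cheb-end  = end
      ; cheb-last = last 2≤M ≡.refl
      ; cheb≥0    = nonneg
      }
      where
      end : cheb a M ≈ 0#
      end = cancel (≈-trans (≈-sym (f≈ M)) (≈-trans f-end (≈-sym (zeroˡ _))))
      last : ∀ {K} → 2 ℕ.≤ K → K ≡ M → cheb a (ℕ.pred K) ≈ 1#
      last {suc k} _ e = cancel (≈-trans (≈-sym (f≈ k)) (≈-trans (f-last e) (≈-sym (*-identityˡ _))))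
      nonneg : ∀ {k} → k ℕ.≤ M → 0# ≤ cheb a k
      nonneg {zero} _ = ≤-refl
      nonneg {suc k} b with ℕ.m≤n⇒m<n∨m≡n b
      ... | inj₁ lt = inj₁ (cheb-pos (s≤s z≤n) lt)
      ... | inj₂ ≡.refl = inj₂ (≈-sym end)

-- Words, length and reduced expressions

module Words (em : ExcludedMiddle 0ℓ) {n} (W : CoxeterSystem n) where
  open CoxeterSystem W renaming (refl to ≈-refl; sym to ≈-sym; trans to ≈-trans; ⟦_⟧ to eval) public
  open Algebra.Definitions.RawMonoid rawMonoid using () renaming (_×_ to _times_)
  module ≈-Reasoning = Relation.Binary.Reasoning.Setoid setoid

  Word : Set
  Word = List (Fin n)

  infix 4 _≃_
  _≃_ : Word → Word → Set
  _≃_ = _∼_ m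

  s∙s : ∀ i → s i ∙ s i ≈ ε
  s∙s i = ≈-trans (∙-congˡ (≈-sym (identityʳ (s i)))) (proj₁ (proj₂ (s-order i)))

  order-unique : ∀ {g h} k l → (∀ t → t times g ≈ ε → t times h ≈ ε) → (∀ t → t times h ≈ ε → t times g ≈ ε) →
                 HasOrder group g k → HasOrder group h l → k ≡ l
  order-unique (fin k) (fin l) gh hg (1≤k , gᵏ , mink) (1≤l , hˡ , minl) =
    ≡.cong fin (ℕ.≤-antisym (ℕ.≮⇒≥ λ l<k → mink l 1≤l l<k (hg l hˡ)) (ℕ.≮⇒≥ λ k<l → minl k 1≤k k<l (gh k gᵏ)))
  order-unique (fin k) ⊤⁺ gh hg (1≤k , gᵏ , _) inf = ⊥-elim (inf k 1≤k (gh k gᵏ))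
  order-unique ⊤⁺ (fin l) gh hg inf (1≤l , hˡ , _) = ⊥-elim (inf l 1≤l (hg l hˡ))
  order-unique ⊤⁺ ⊤⁺ gh hg _ _ = ≡.refl

  m-diagonal : ∀ i → m i i ≡ fin 1
  m-diagonal i = order-unique {s i ∙ s i} {ε} (m i i) (fin 1) (λ t _ → trivial t) (λ t _ → power t) (m-order i i)
                   (s≤s z≤n , identityʳ ε , λ { (suc _) _ (s≤s ()) _ })
    where
    trivial : ∀ t → t times ε ≈ ε
    trivial zero    = ≈-refl
    trivial (suc t) = ≈-trans (identityˡ _) (trivial t)
    power : ∀ t → t times (s i ∙ s i) ≈ ε
    power zero    = ≈-refl
    power (suc t) = ≈-trans (∙-cong (s∙s i) (power t)) (identityˡ ε)

  conjugate-power : ∀ i j t → t times (s j ∙ s i) ≈ s i ∙ (t times (s i ∙ s j) ∙ s i)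
  conjugate-power i j zero    = ≈-sym (≈-trans (∙-congˡ (identityˡ (s i))) (s∙s i))
  conjugate-power i j (suc t) = begin
    (s j ∙ s i) ∙ t times (s j ∙ s i)             ≈⟨ ∙-congˡ (conjugate-power i j t) ⟩
    (s j ∙ s i) ∙ (s i ∙ (x ∙ s i))               ≈⟨ assoc _ _ _ ⟨
    ((s j ∙ s i) ∙ s i) ∙ (x ∙ s i)               ≈⟨ ∙-congʳ (assoc _ _ _) ⟩
    (s j ∙ (s i ∙ s i)) ∙ (x ∙ s i)               ≈⟨ ∙-congʳ (≈-trans (∙-congˡ (s∙s i)) (identityʳ (s j))) ⟩
    s j ∙ (x ∙ s i)                               ≈⟨ identityˡ _ ⟨
    ε ∙ (s j ∙ (x ∙ s i))                         ≈⟨ ∙-congʳ (s∙s i) ⟨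
    (s i ∙ s i) ∙ (s j ∙ (x ∙ s i))               ≈⟨ assoc _ _ _ ⟩
    s i ∙ (s i ∙ (s j ∙ (x ∙ s i)))               ≈⟨ ∙-congˡ (assoc _ _ _) ⟨
    s i ∙ ((s i ∙ s j) ∙ (x ∙ s i))               ≈⟨ ∙-congˡ (assoc _ _ _) ⟨
    s i ∙ (((s i ∙ s j) ∙ x) ∙ s i)               ∎
    where
    open ≈-Reasoning
    x : Carrier
    x = t times (s i ∙ s j)

  m-symmetric : ∀ i j → m i j ≡ m j i
  m-symmetric i j = order-unique (m i j) (m j i) (λ t → transport i j t) (λ t → transport j i t) (m-order i j) (m-order j i)
    where
    transport : ∀ i j t → t times (s i ∙ s j) ≈ ε → t times (s j ∙ s i) ≈ ε
    transport i j t e = ≈-trans (conjugate-power i j t)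
      (≈-trans (∙-congˡ (≈-trans (∙-congʳ e) (identityˡ (s i)))) (s∙s i))

  eval-++ : ∀ u v → eval (u ++ v) ≈ eval u ∙ eval v
  eval-++ []      v = ≈-sym (identityˡ _)
  eval-++ (i ∷ u) v = ≈-trans (∙-congˡ (eval-++ u v)) (≈-sym (assoc _ _ _))

  ≃-reflexive : ∀ {u v} → u ≡ v → u ≃ v
  ≃-reflexive ≡.refl = refl

  cancel-square : ∀ i → i ∷ i ∷ [] ≃ []
  cancel-square i = relator (m-diagonal i)

  cancel-in : ∀ u i v → (u ∷ʳ i) ++ (i ∷ v) ≃ u ++ v
  cancel-in u i v = trans (≃-reflexive (List.++-assoc u [ i ] (i ∷ v))) (++-cong (refl {u = u}) (++-cong (cancel-square i) (refl {u = v})))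

  reverse-inverseʳ : ∀ u → u ++ reverse u ≃ []
  reverse-inverseʳ []      = refl
  reverse-inverseʳ (i ∷ u) = trans (≃-reflexive e) (trans (++-cong {u = [ i ]} refl (++-cong (reverse-inverseʳ u) refl)) (cancel-square i))
    where
    e : i ∷ u ++ reverse (i ∷ u) ≡ i ∷ (u ++ reverse u) ++ [ i ]
    e = ≡.cong (i ∷_) (≡.trans (≡.cong (u ++_) (List.unfold-reverse i u)) (≡.sym (List.++-assoc u (reverse u) [ i ])))

  reverse-inverseˡ : ∀ u → reverse u ++ u ≃ []
  reverse-inverseˡ u = trans (≃-reflexive (≡.cong (reverse u ++_) (≡.sym (List.reverse-involutive u)))) (reverse-inverseʳ (reverse u))

  inverse-unique : ∀ u v → u ++ v ≃ [] → v ≃ reverse u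
  inverse-unique u v e = trans (sym (++-cong (reverse-inverseˡ u) (refl {u = v})))
    (trans (≃-reflexive (List.++-assoc (reverse u) u v)) (trans (++-cong (refl {u = reverse u}) e) (≃-reflexive (List.++-identityʳ _))))

  parity : Word → Bool
  parity []      = false
  parity (_ ∷ u) = not (parity u)

  parity-++ : ∀ {u u′} v v′ → parity u ≡ parity u′ → parity v ≡ parity v′ → parity (u ++ v) ≡ parity (u′ ++ v′)
  parity-++ {u} {u′} v v′ p q = ≡.trans (hom u) (≡.trans (≡.cong₂ _xor_ p q) (≡.sym (hom u′)))
    where
    hom : ∀ u {v} → parity (u ++ v) ≡ parity u xor parity v
    hom []      = ≡.refl
    hom (i ∷ u) {v} with parity u | hom u {v}
    ... | true  | e = ≡.trans (≡.cong not e) (not-involutive _)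
    ... | false | e = ≡.cong not e

  ≃-parity : ∀ {u v} → u ≃ v → parity u ≡ parity v
  ≃-parity (relator {i} {j} {k} _) = even k
    where
    even : ∀ k → parity (concat (replicate k (i ∷ j ∷ []))) ≡ false
    even zero    = ≡.refl
    even (suc k) = ≡.trans (not-involutive _) (even k)
  ≃-parity (++-cong {u} {u′} {v} {v′} p q) = parity-++ {u} {u′} v v′ (≃-parity p) (≃-parity q)
  ≃-parity refl        = ≡.refl
  ≃-parity (sym p)     = ≡.sym (≃-parity p)
  ≃-parity (trans p q) = ≡.trans (≃-parity p) (≃-parity q)

  -- Relators have even length, so the parity of the length is an invariant of the group element.
  ≃-length : ∀ {u v} → u ≃ v → length u ≢ suc (length v)
  ≃-length {u} {v} e l = differ u v l (≃-parity e)
    where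
    same : ∀ u v → length u ≡ length v → parity u ≡ parity v
    same []      []      _ = ≡.refl
    same (_ ∷ u) (_ ∷ v) l = ≡.cong not (same u v (ℕ.suc-injective l))
    differ : ∀ u v → length u ≡ suc (length v) → parity u ≢ parity v
    differ (_ ∷ u) v l with parity v | same u v (ℕ.suc-injective l)
    ... | true  | e = λ p → contra (≡.trans (≡.sym (≡.cong not e)) p)
      where contra : false ≢ true
            contra ()
    ... | false | e = λ p → contra (≡.trans (≡.sym (≡.cong not e)) p)
      where contra : true ≢ false
            contra ()

  Reduced : Word → Set
  Reduced u = ∀ v → v ≃ u → length u ℕ.≤ length v

  shorten : ∀ u → Reduced u ⊎ (∃[ v ] v ≃ u × length v ℕ.< length u)
  shorten u with em {P = ∃[ v ] v ≃ u × length v ℕ.< length u}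
  ... | yes p = inj₂ p
  ... | no ¬p = inj₁ λ v e → ℕ.≮⇒≥ λ l → ¬p (v , e , l)

  reduce : ∀ u → ∃[ v ] v ≃ u × Reduced v
  reduce u = go (suc (length u)) u ℕ.≤-refl
    where
    go : ∀ k u → length u ℕ.< k → ∃[ v ] v ≃ u × Reduced v
    go (suc k) u (s≤s l) with shorten u
    ... | inj₁ r = u , refl , r
    ... | inj₂ (v , e , l′) with w , e′ , r ← go k v (ℕ.≤-trans l′ l) = w , trans e′ e , r

  length-∷ʳ : ∀ (u : Word) i → length (u ∷ʳ i) ≡ suc (length u)
  length-∷ʳ u i = ≡.trans (List.length-++ u) (ℕ.+-comm (length u) 1)

  Reduced-prefix : ∀ u v → Reduced (u ++ v) → Reduced u
  Reduced-prefix u v r w e = ℕ.+-cancelʳ-≤ (length v) _ _ (≡.subst₂ ℕ._≤_ (List.length-++ u) (List.length-++ w) (r (w ++ v) (++-cong e refl)))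

  Reduced-length : ∀ {u v} → u ≃ v → Reduced u → length v ℕ.≤ length u → Reduced v
  Reduced-length e r l w f = ℕ.≤-trans l (r w (trans f (sym e)))

  -- A word v shorter than u i gives the expression v i of u. Then v is at most as long as u; parity
  -- excludes equality, and reducedness of u leaves only one possible length.
  ascent-or-descent : ∀ u i → Reduced u →
    Reduced (u ∷ʳ i) ⊎ (∃[ v ] v ∷ʳ i ≃ u × suc (length v) ≡ length u)
  ascent-or-descent u i r with shorten (u ∷ʳ i)
  ... | inj₁ r′ = inj₁ r′
  ... | inj₂ (v , e , l) = inj₂ (v , v∷ʳi≃u , ℕ.≤-antisym v<u (≡.subst (length u ℕ.≤_) (length-∷ʳ v i) (r (v ∷ʳ i) v∷ʳi≃u)))
    where
    v∷ʳi≃u : v ∷ʳ i ≃ u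
    v∷ʳi≃u = trans (++-cong e refl) (trans (cancel-in u i []) (≃-reflexive (List.++-identityʳ u)))
    v<u : length v ℕ.< length u
    v<u = ℕ.≤∧≢⇒< (ℕ.≤-pred (≡.subst (length v ℕ.<_) (length-∷ʳ u i) l))
      λ eq → ≃-length (sym e) (≡.trans (length-∷ʳ u i) (≡.cong suc (≡.sym eq)))

  -- letter i j k is the first letter of alternating i j (suc k); alternating
  -- words end in j.
  letter : Fin n → Fin n → ℕ → Fin n
  letter i j zero    = j
  letter i j (suc k) = letter j i k

  alternating : Fin n → Fin n → ℕ → Word
  alternating i j zero    = []
  alternating i j (suc k) = letter i j k ∷ alternating i j k

  length-alternating : ∀ i j k → length (alternating i j k) ≡ k
  length-alternating i j zero    = ≡.refl
  length-alternating i j (suc k) = ≡.cong suc (length-alternating i j k)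

  alternating-∷ʳ : ∀ i j k → alternating i j k ∷ʳ i ≡ alternating j i (suc k)
  alternating-∷ʳ i j zero    = ≡.refl
  alternating-∷ʳ i j (suc k) = ≡.cong (letter i j k ∷_) (alternating-∷ʳ i j k)

  alternating-split : ∀ i j k l → ∃[ u ] length u ≡ k × alternating i j (k ℕ.+ l) ≡ u ++ alternating i j l
  alternating-split i j zero    l = [] , ≡.refl , ≡.refl
  alternating-split i j (suc k) l with u , e , f ← alternating-split i j k l =
    letter i j (k ℕ.+ l) ∷ u , ≡.cong suc e , ≡.cong (letter i j (k ℕ.+ l) ∷_) f

  letter-even : ∀ i j k → letter i j (k ℕ.+ k) ≡ j
  letter-even i j zero    = ≡.refl
  letter-even i j (suc k) = ≡.trans (≡.cong (letter j i) (ℕ.+-suc k k)) (letter-even i j k)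

  alternating-even : ∀ i j k → alternating i j (k ℕ.+ k) ≡ concat (replicate k (i ∷ j ∷ []))
  alternating-even i j zero    = ≡.refl
  alternating-even i j (suc k) = ≡.trans (≡.cong (λ l → alternating i j (suc l)) (ℕ.+-suc k k))
    (≡.cong₂ _∷_ (letter-even j i k) (≡.cong₂ _∷_ (letter-even i j k) (alternating-even i j k)))

  -- The relator is an alternating word of length 2k. Cutting off its first k - 1 letters leaves the
  -- alternating word of length k + 1, which is therefore equivalent to the inverse of the part cut
  -- off.
  alternating-shorten : ∀ i j {k} → m i j ≡ fin k → 1 ℕ.≤ k → ∃[ u ] alternating i j (suc k) ≃ u × length u ℕ.< k
  alternating-shorten i j {suc k} e _ with u , l , f ← alternating-split i j k (suc (suc k)) =
    reverse u , inverse-unique u _ (trans (≃-reflexive (≡.trans (≡.sym f) double)) (relator e)) ,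
    s≤s (ℕ.≤-reflexive (≡.trans (List.length-reverse u) l))
    where
    double : alternating i j (k ℕ.+ suc (suc k)) ≡ concat (replicate (suc k) (i ∷ j ∷ []))
    double = ≡.trans (≡.cong (alternating i j) (ℕ.+-suc k (suc k))) (alternating-even i j (suc k))

-- The geometric representation

module Action (em : ExcludedMiddle 0ℓ) (ℝ : RealNumbers) (trig : Trigonometry ℝ)
              {n} (W : CoxeterSystem n) (complete-graph : HasCompleteCoxeterGraph W) where
  open RealProperties ℝ public
  open Chebyshev ℝ public
  open CosineCoefficients ℝ trig using (cosine-coefficient)
  open Trigonometry trig using (cos; π; cos-cong; cos-π)
  open RootSystem ℝ trig W public
  module W = Words em W
  open W using (Word; _≃_; m) public

  coefficient : ℕ ⁺ → Carrier
  coefficient (fin k) = 2# * cos (π * fromℕ k ⁻¹)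
  coefficient ⊤⁺      = 2#

  a : Fin n → Fin n → Carrier
  a i j = coefficient (m i j)

  a-symmetric : ∀ i j → a i j ≈ a j i
  a-symmetric i j = reflexive (≡.cong coefficient (W.m-symmetric i j))

  2gram : ∀ k → 2# * gram k ≈ - coefficient k
  2gram (fin k) = solve 1 (λ c → :2 :* :- c := :- (:2 :* c)) ≈-refl _
  2gram ⊤⁺      = solve 0 (:2 :* :- :1 := :- :2) ≈-refl

  gram-diagonal : ∀ i → gram (m i i) ≈ 1#
  gram-diagonal i = ≈-trans (reflexive (≡.cong gram (W.m-diagonal i))) (begin
    - cos (π * fromℕ 1 ⁻¹) ≈⟨ -‿cong (cos-cong (*-congˡ inverse)) ⟩
    - cos (π * 1#)         ≈⟨ -‿cong (cos-cong (*-identityʳ π)) ⟩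
    - cos π                ≈⟨ -‿cong cos-π ⟩
    - - 1#                 ≈⟨ -‿involutive 1# ⟩
    1#                     ∎)
    where
    open ≈-Reasoning
    inverse : fromℕ 1 ⁻¹ ≈ 1#
    inverse = ≈-trans (solve 1 (λ x → x := (:1 :+ :0) :* x) ≈-refl _) (*-inverseʳ (>⇒≉ (fromℕ-pos {1} (s≤s z≤n))))

  data Label (i j : Fin n) : Set where
    finite   : ∀ {M} → m i j ≡ fin M → 3 ℕ.≤ M → IsFiniteCoefficient (a i j) M → Label i j
    infinite : m i j ≡ ⊤⁺ → a i j ≈ 2# → Label i j

  -- The one point where the hypothesis on the Coxeter graph is consumed: it excludes the label 2,
  -- for which `a i j` would vanish.
  label : ∀ {i j} → i ≢ j → Label i j
  label {i} {j} i≢j with m i j in e | proj₂ (complete-graph i j i≢j)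
  ... | fin M | AddSupremum.[ 3≤M ] = finite e 3≤M (≡.subst (λ k → IsFiniteCoefficient (coefficient k) M) (≡.sym e) (cosine-coefficient (ℕ.≤-trans (ℕ.n≤1+n 2) 3≤M)))
  ... | ⊤⁺    | _ = infinite e (reflexive (≡.cong coefficient e))

  1≤a : ∀ {i j} → i ≢ j → 1# ≤ a i j
  1≤a i≢j with label i≢j
  ... | finite _ 3≤M F = IsFiniteCoefficient.1≤a F 3≤M
  ... | infinite _ e   = ≤-respʳ (≈-sym e) (0≤⇒≤ 0≤1 (solve 0 (:2 := :1 :+ :1) ≈-refl))

  0≤a : ∀ {i j} → i ≢ j → 0# ≤ a i j
  0≤a i≢j = ≤-trans 0≤1 (1≤a i≢j)

  α-diagonal : ∀ i → α i i ≈ 1#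
  α-diagonal i with i Fin.≟ i
  ... | yes _ = ≈-refl
  ... | no ¬p = ⊥-elim (¬p ≡.refl)

  α-off : ∀ {i j} → i ≢ j → α i j ≈ 0#
  α-off {i} {j} i≢j with i Fin.≟ j
  ... | yes p = ⊥-elim (i≢j p)
  ... | no  _ = ≈-refl

  α-nonneg : ∀ i j → 0# ≤ α i j
  α-nonneg i j with i Fin.≟ j
  ... | yes _ = 0≤1
  ... | no  _ = ≤-refl

  lin : Carrier → V → Carrier → V → V
  lin c β d γ i = c * β i + d * γ i

  neg : V → V
  neg β i = - β i

  ≋-refl : ∀ {β} → β ≋ β
  ≋-refl i = ≈-refl

  ≋-sym : ∀ {β γ} → β ≋ γ → γ ≋ β
  ≋-sym e i = ≈-sym (e i)

  ≋-trans : ∀ {β γ δ} → β ≋ γ → γ ≋ δ → β ≋ δ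
  ≋-trans e f i = ≈-trans (e i) (f i)

  ≋-reflexive : ∀ {β γ} → β ≡ γ → β ≋ γ
  ≋-reflexive ≡.refl = ≋-refl

  neg-lin : ∀ β → neg β ≋ lin (- 1#) β 0# β
  neg-lin β i = solve 1 (λ x → :- x := :- :1 :* x :+ :0 :* x) ≈-refl (β i)

  sum-lin : ∀ {k} c (f : Fin k → Carrier) d g → sum (λ i → c * f i + d * g i) ≈ c * sum f + d * sum g
  sum-lin {k} c f d g = ≈-trans (∑-distrib-+ {k} (λ i → c * f i) (λ i → d * g i)) (≈-sym (+-cong (*-distribˡ-sum c f) (*-distribˡ-sum d g)))

  sum-zero : ∀ {k} (f : Fin k → Carrier) → (∀ i → f i ≈ 0#) → sum f ≈ 0#
  sum-zero {zero}  f e = ≈-refl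
  sum-zero {suc k} f e = ≈-trans (+-cong (e Fin.zero) (sum-zero (f ∘ Fin.suc) (e ∘ Fin.suc))) (+-identityˡ 0#)

  sum-delta : ∀ {k} (f : Fin k → Carrier) i → sum (λ j → f j * (if does (i Fin.≟ j) then 1# else 0#)) ≈ f i
  sum-delta f Fin.zero = ≈-trans (+-cong (*-identityʳ _) (sum-zero _ (λ i → zeroʳ (f (Fin.suc i))))) (+-identityʳ _)
  sum-delta f (Fin.suc i) = ≈-trans (+-cong (zeroʳ _) (sum-delta (f ∘ Fin.suc) i)) (+-identityˡ _)

  B-cong : ∀ {β β′ γ γ′} → β ≋ β′ → γ ≋ γ′ → B β γ ≈ B β′ γ′
  B-cong e f = sum-cong-≋ {n} λ i → sum-cong-≋ {n} λ j → *-cong (*-congʳ (e i)) (f j)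

  B-linˡ : ∀ c β d γ δ → B (lin c β d γ) δ ≈ c * B β δ + d * B γ δ
  B-linˡ c β d γ δ = ≈-trans (sum-cong-≋ {n} λ i → ≈-trans (sum-cong-≋ {n} λ j →
      solve 6 (λ c b d g m x → (c :* b :+ d :* g) :* m :* x := c :* (b :* m :* x) :+ d :* (g :* m :* x)) ≈-refl
        c (β i) d (γ i) (gram (m i j)) (δ j))
      (sum-lin {n} c (λ j → β i * gram (m i j) * δ j) d (λ j → γ i * gram (m i j) * δ j)))
    (sum-lin {n} c (λ i → sum {n} λ j → β i * gram (m i j) * δ j) d (λ i → sum {n} λ j → γ i * gram (m i j) * δ j))

  B-symmetric : ∀ β γ → B β γ ≈ B γ β
  B-symmetric β γ = ≈-trans (∑-comm {n} {n} λ i j → β i * gram (m i j) * γ j)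
    (sum-cong-≋ {n} λ j → sum-cong-≋ {n} λ i → ≈-trans
      (*-congʳ (*-congˡ (reflexive (≡.cong gram (W.m-symmetric i j)))))
      (solve 3 (λ b m g → b :* m :* g := g :* m :* b) ≈-refl (β i) (gram (m j i)) (γ j)))

  B-linʳ : ∀ δ c β d γ → B δ (lin c β d γ) ≈ c * B δ β + d * B δ γ
  B-linʳ δ c β d γ = ≈-trans (B-symmetric δ _) (≈-trans (B-linˡ c β d γ δ) (+-cong (*-congˡ (B-symmetric β δ)) (*-congˡ (B-symmetric γ δ))))

  B-αʳ : ∀ β k → B β (α k) ≈ sum λ i → β i * gram (m i k)
  B-αʳ β k = sum-cong-≋ {n} λ i → sum-delta {n} (λ j → β i * gram (m i j)) k

  B-α-α : ∀ i j → B (α i) (α j) ≈ gram (m i j)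
  B-α-α i j = ≈-trans (B-αʳ (α i) j) (≈-trans (sum-cong-≋ {n} λ k → *-comm (α i k) _) (sum-delta {n} (λ k → gram (m k j)) i))

  -- The pairing with the simple coroot, so that `reflect i β` is β - h β i · α i by definition.
  h : V → Fin n → Carrier
  h β i = 2# * B β (α i)

  h-cong : ∀ {β γ} i → β ≋ γ → h β i ≈ h γ i
  h-cong i e = *-congˡ (B-cong e ≋-refl)

  h-lin : ∀ c β d γ i → h (lin c β d γ) i ≈ c * h β i + d * h γ i
  h-lin c β d γ i = ≈-trans (*-congˡ (B-linˡ c β d γ (α i)))
    (solve 5 (λ t c x d y → t :* (c :* x :+ d :* y) := c :* (t :* x) :+ d :* (t :* y)) ≈-refl 2# c (B β (α i)) d (B γ (α i)))

  h-diagonal : ∀ i → h (α i) i ≈ 2#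
  h-diagonal i = ≈-trans (*-congˡ (≈-trans (B-α-α i i) (gram-diagonal i))) (*-identityʳ 2#)

  h-off : ∀ i j → h (α i) j ≈ - a i j
  h-off i j = ≈-trans (*-congˡ (B-α-α i j)) (2gram (m i j))

  reflect-lin-form : ∀ i β → reflect i β ≋ lin 1# β (- h β i) (α i)
  reflect-lin-form i β j = solve 3 (λ b h x → b :- h :* x := :1 :* b :+ (:- h) :* x) ≈-refl (β j) (h β i) (α i j)

  reflect-cong : ∀ i {β γ} → β ≋ γ → reflect i β ≋ reflect i γ
  reflect-cong i e j = +-cong (e j) (-‿cong (*-congʳ (h-cong i e)))

  reflect-lin : ∀ i c β d γ → reflect i (lin c β d γ) ≋ lin c (reflect i β) d (reflect i γ)
  reflect-lin i c β d γ j = ≈-trans (+-congˡ (-‿cong (*-congʳ (h-lin c β d γ i))))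
    (solve 7 (λ c x d y p q e → (c :* x :+ d :* y) :- (c :* p :+ d :* q) :* e := c :* (x :- p :* e) :+ d :* (y :- q :* e)) ≈-refl
      c (β j) d (γ j) (h β i) (h γ i) (α i j))

  reflect-off : ∀ {i j} β → i ≢ j → reflect i β j ≈ β j
  reflect-off {i} {j} β i≢j = ≈-trans (+-congˡ (-‿cong (*-congˡ (α-off i≢j)))) (solve 2 (λ b h → b :- h :* :0 := b) ≈-refl (β j) (h β i))

  reflect-at : ∀ i β → reflect i β i ≈ β i - h β i
  reflect-at i β = +-congˡ (-‿cong (≈-trans (*-congˡ (α-diagonal i)) (*-identityʳ _)))

  reflect-self : ∀ i → reflect i (α i) ≋ neg (α i)
  reflect-self i j = ≈-trans (+-congˡ (-‿cong (*-congʳ (h-diagonal i)))) (solve 1 (λ x → x :- :2 :* x := :- x) ≈-refl (α i j))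

  h-reflect : ∀ i β → h (reflect i β) i ≈ - h β i
  h-reflect i β = ≈-trans (h-cong i (reflect-lin-form i β)) (≈-trans (h-lin 1# β (- h β i) (α i) i)
    (≈-trans (+-congˡ (*-congˡ (h-diagonal i))) (solve 1 (λ x → :1 :* x :+ :- x :* :2 := :- x) ≈-refl (h β i))))

  h-reflect-off : ∀ i j β → h (reflect i β) j ≈ h β j + a i j * h β i
  h-reflect-off i j β = ≈-trans (h-cong j (reflect-lin-form i β)) (≈-trans (h-lin 1# β (- h β i) (α i) j)
    (≈-trans (+-congˡ (*-congˡ (h-off i j))) (solve 3 (λ x y a → :1 :* x :+ :- y :* :- a := x :+ a :* y) ≈-refl (h β j) (h β i) (a i j))))

  reflect-involutive : ∀ i β → reflect i (reflect i β) ≋ β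
  reflect-involutive i β j = ≈-trans (+-congˡ (-‿cong (*-congʳ (h-reflect i β))))
    (solve 3 (λ b h x → (b :- h :* x) :- (:- h) :* x := b) ≈-refl (β j) (h β i) (α i j))

  B-reflect : ∀ i β γ → B (reflect i β) (reflect i γ) ≈ B β γ
  B-reflect i β γ = begin
    B (reflect i β) (reflect i γ)                   ≈⟨ B-cong (reflect-lin-form i β) (reflect-lin-form i γ) ⟩
    B (lin 1# β _ (α i)) (lin 1# γ _ (α i))         ≈⟨ B-linˡ 1# β _ (α i) _ ⟩
    1# * B β (lin 1# γ _ (α i)) + (- h β i) * B (α i) (lin 1# γ _ (α i))
      ≈⟨ +-cong (*-congˡ (B-linʳ β 1# γ _ (α i))) (*-congˡ (B-linʳ (α i) 1# γ _ (α i))) ⟩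
    1# * (1# * B β γ + (- h γ i) * B β (α i)) + (- h β i) * (1# * B (α i) γ + (- h γ i) * B (α i) (α i))
      ≈⟨ +-congˡ (*-congˡ (+-cong (*-congˡ (B-symmetric (α i) γ)) (*-congˡ (≈-trans (B-α-α i i) (gram-diagonal i))))) ⟩
    1# * (1# * B β γ + (- h γ i) * B β (α i)) + (- h β i) * (1# * B γ (α i) + (- h γ i) * 1#)
      ≈⟨ solve 3 (λ z x y → :1 :* (:1 :* z :+ (:- (:2 :* y)) :* x) :+ (:- (:2 :* x)) :* (:1 :* y :+ (:- (:2 :* y)) :* :1) := z)
           ≈-refl (B β γ) (B β (α i)) (B γ (α i)) ⟩
    B β γ                                           ∎
    where open ≈-Reasoning

  act : Word → V → V
  act u β = foldr reflect β u

  act-++ : ∀ u v β → act (u ++ v) β ≡ act u (act v β)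
  act-++ u v β = List.foldr-++ reflect β u v

  act-cong : ∀ u {β γ} → β ≋ γ → act u β ≋ act u γ
  act-cong []      e = e
  act-cong (i ∷ u) e = reflect-cong i (act-cong u e)

  act-lin : ∀ u c β d γ → act u (lin c β d γ) ≋ lin c (act u β) d (act u γ)
  act-lin []      c β d γ = ≋-refl
  act-lin (i ∷ u) c β d γ = ≋-trans (reflect-cong i (act-lin u c β d γ)) (reflect-lin i c _ d _)

  act-neg : ∀ u β → act u (neg β) ≋ neg (act u β)
  act-neg u β = ≋-trans (act-cong u (neg-lin β)) (≋-trans (act-lin u _ β _ β) (≋-sym (neg-lin (act u β))))

  B-act : ∀ u β γ → B (act u β) (act u γ) ≈ B β γ
  B-act []      β γ = ≈-refl
  B-act (i ∷ u) β γ = ≈-trans (B-reflect i _ _) (B-act u β γ)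

  module _ {i j M} (F : IsFiniteCoefficient (a i j) M) (3≤M : 3 ℕ.≤ M) (β : V) where
    open IsFiniteCoefficient F hiding (1≤a)
    private
      -- The pairings of α i and α j, with signs, with the images of β under growing alternating
      -- products. They obey the Chebyshev recurrence for `a i j` and so have period 2M.
      z : ℕ → Carrier
      z zero          = - h β i
      z (suc zero)    = h β j
      z (suc (suc k)) = a i j * z (suc k) - z k

      rotation : ℕ → Word
      rotation r = concat (replicate r (i ∷ j ∷ []))

      step : ℕ → V
      step r = act (rotation r) β

      h-step : ∀ r → h (step r) i ≈ - z (r ℕ.* 2) × h (step r) j ≈ z (suc (r ℕ.* 2))
      h-step zero    = ≈-sym (-‿involutive _) , ≈-refl
      h-step (suc r) with p , q ← h-step r = p′ , q′
        where
        open ≈-Reasoning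
        γ : V
        γ = reflect j (step r)
        hγi : h γ i ≈ z (suc (suc (r ℕ.* 2)))
        hγi = begin
          h γ i                                       ≈⟨ h-reflect-off j i (step r) ⟩
          h (step r) i + a j i * h (step r) j         ≈⟨ +-cong p (*-cong (a-symmetric j i) q) ⟩
          - z (r ℕ.* 2) + a i j * z (suc (r ℕ.* 2))   ≈⟨ +-comm _ _ ⟩
          a i j * z (suc (r ℕ.* 2)) - z (r ℕ.* 2)     ∎
        p′ : h (reflect i γ) i ≈ - z (suc (suc (r ℕ.* 2)))
        p′ = ≈-trans (h-reflect i γ) (-‿cong hγi)
        q′ : h (reflect i γ) j ≈ z (suc (suc (suc (r ℕ.* 2))))
        q′ = begin
          h (reflect i γ) j                           ≈⟨ h-reflect-off i j γ ⟩
          h γ j + a i j * h γ i                       ≈⟨ +-cong (≈-trans (h-reflect j (step r)) (-‿cong q)) (*-congˡ hγi) ⟩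
          - z (suc (r ℕ.* 2)) + a i j * z (suc (suc (r ℕ.* 2))) ≈⟨ +-comm _ _ ⟩
          a i j * z (suc (suc (r ℕ.* 2))) - z (suc (r ℕ.* 2)) ∎

      displacement : ∀ r → ∃[ x ] ∃[ y ] step r ≋ lin 1# β 1# (lin x (α i) y (α j))
      displacement zero    = 0# , 0# , λ k → solve 3 (λ b p q → b := :1 :* b :+ :1 :* (:0 :* p :+ :0 :* q)) ≈-refl (β k) (α i k) (α j k)
      displacement (suc r) with x , y , e ← displacement r =
        x - h (reflect j (step r)) i , y - h (step r) j , λ k → ≈-trans (+-congʳ (+-congʳ (e k)))
          (solve 7 (λ b x p y q f g → ((:1 :* b :+ :1 :* (x :* p :+ y :* q)) :- g :* q) :- f :* p
                                    := :1 :* b :+ :1 :* ((x :- f) :* p :+ (y :- g) :* q)) ≈-refl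
            (β k) x (α i k) y (α j k) (h (reflect j (step r)) i) (h (step r) j))

      z-formula : ∀ k → z (suc k) ≈ cheb (a i j) (suc k) * z 1 - cheb (a i j) k * z 0
      z-formula = cheb-unique (a i j) z (λ _ → ≈-refl)

      cheb-period : ∀ k → cheb (a i j) (k ℕ.+ M ℕ.* 2) ≈ cheb (a i j) k
      cheb-period k = begin
        cheb (a i j) (k ℕ.+ M ℕ.* 2)     ≡⟨ ≡.cong (cheb (a i j)) index ⟩
        cheb (a i j) ((k ℕ.+ M) ℕ.+ M)   ≈⟨ cheb-shift (k ℕ.+ M) ⟩
        - cheb (a i j) (k ℕ.+ M)         ≈⟨ -‿cong (cheb-shift k) ⟩
        - - cheb (a i j) k               ≈⟨ -‿involutive _ ⟩
        cheb (a i j) k                   ∎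
        where
        open ≈-Reasoning
        index : k ℕ.+ M ℕ.* 2 ≡ (k ℕ.+ M) ℕ.+ M
        index = ≡.trans (≡.cong (k ℕ.+_) (≡.trans (ℕ.*-comm M 2) (≡.cong (M ℕ.+_) (ℕ.+-identityʳ M)))) (≡.sym (ℕ.+-assoc k M M))

      z-period : ∀ k → z (suc (k ℕ.+ M ℕ.* 2)) ≈ z (suc k)
      z-period k = ≈-trans (z-formula (k ℕ.+ M ℕ.* 2))
        (≈-trans (+-cong (*-congʳ (cheb-period (suc k))) (-‿cong (*-congʳ (cheb-period k)))) (≈-sym (z-formula k)))

      z-period₀ : z (M ℕ.* 2) ≈ z 0
      z-period₀ = begin
        z (M ℕ.* 2)                                       ≈⟨ solve 3 (λ a x y → y := a :* x :- (a :* x :- y)) ≈-refl (a i j) (z (suc (M ℕ.* 2))) _ ⟩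
        a i j * z (suc (M ℕ.* 2)) - z (suc (suc (M ℕ.* 2))) ≈⟨ +-cong (*-congˡ (z-period 0)) (-‿cong (z-period 1)) ⟩
        a i j * z 1 - z 2                                 ≈⟨ solve 3 (λ a x y → a :* x :- (a :* x :- y) := y) ≈-refl (a i j) (z 1) (z 0) ⟩
        z 0                                               ∎
        where open ≈-Reasoning

    -- The rotation moves β by a vector of the plane spanned by α i and α j that
    -- is orthogonal to α i and α j, and B is nondegenerate on that plane.
    rotation-trivial : step M ≋ β
    rotation-trivial with x , y , e ← displacement M = λ k →
      ≈-trans (e k) (≈-trans (+-congˡ (*-congˡ (+-cong (*-congʳ (x≈0 (eqᵢ x y e) (eqⱼ x y e))) (*-congʳ (y≈0 (eqᵢ x y e) (eqⱼ x y e))))))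
        (solve 3 (λ b p q → :1 :* b :+ :1 :* (:0 :* p :+ :0 :* q) := b) ≈-refl (β k) (α i k) (α j k)))
      where
      open ≈-Reasoning
      b : Carrier
      b = a i j
      h-displaced : ∀ x y → step M ≋ lin 1# β 1# (lin x (α i) y (α j)) → ∀ k → h (step M) k ≈ h β k + (x * h (α i) k + y * h (α j) k)
      h-displaced x y e k = ≈-trans (h-cong k e) (≈-trans (h-lin 1# β 1# (lin x (α i) y (α j)) k)
        (≈-trans (+-cong (*-identityˡ _) (*-identityˡ _)) (+-congˡ (h-lin x (α i) y (α j) k))))
      cancel : ∀ {p q} → p ≈ p + q → q ≈ 0#
      cancel {p} {q} e = ≈-trans (solve 2 (λ p q → q := (p :+ q) :- p) ≈-refl p q) (≈-trans (+-congʳ (≈-sym e)) (-‿inverseʳ p))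
      eqᵢ : ∀ x y → step M ≋ lin 1# β 1# (lin x (α i) y (α j)) → x * 2# + y * - b ≈ 0#
      eqᵢ x y e = cancel {h β i} (begin
        h β i                   ≈⟨ -‿involutive _ ⟨
        - z 0                   ≈⟨ -‿cong z-period₀ ⟨
        - z (M ℕ.* 2)           ≈⟨ proj₁ (h-step M) ⟨
        h (step M) i            ≈⟨ h-displaced x y e i ⟩
        h β i + (x * h (α i) i + y * h (α j) i)
          ≈⟨ +-congˡ (+-cong (*-congˡ (h-diagonal i)) (*-congˡ (≈-trans (h-off j i) (-‿cong (a-symmetric j i))))) ⟩
        h β i + (x * 2# + y * - b) ∎)
      eqⱼ : ∀ x y → step M ≋ lin 1# β 1# (lin x (α i) y (α j)) → x * - b + y * 2# ≈ 0#
      eqⱼ x y e = cancel {h β j} (begin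
        h β j                   ≈⟨ z-period 0 ⟨
        z (suc (M ℕ.* 2))       ≈⟨ proj₂ (h-step M) ⟨
        h (step M) j            ≈⟨ h-displaced x y e j ⟩
        h β j + (x * h (α i) j + y * h (α j) j) ≈⟨ +-congˡ (+-cong (*-congˡ (h-off i j)) (*-congˡ (h-diagonal j))) ⟩
        h β j + (x * - b + y * 2#) ∎)
      -- The determinant 4 - b² of the linear system `eqᵢ`, `eqⱼ` for the displacement (x , y).
      nondegenerate : ¬ (2# - b) * (2# + b) ≈ 0#
      nondegenerate = >⇒≉ (*-pos (<⇒0< a<2) (+-pos-nonneg 0<2 (≤-trans 0≤1 (IsFiniteCoefficient.1≤a F 3≤M))))
      x≈0 : ∀ {x y} → x * 2# + y * - b ≈ 0# → x * - b + y * 2# ≈ 0# → x ≈ 0#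
      x≈0 {x} {y} p q = *-nonzero nondegenerate (begin
        (2# - b) * (2# + b) * x
          ≈⟨ solve 3 (λ b x y → (:2 :- b) :* (:2 :+ b) :* x := :2 :* (x :* :2 :+ y :* :- b) :+ b :* (x :* :- b :+ y :* :2)) ≈-refl b x y ⟩
        2# * (x * 2# + y * - b) + b * (x * - b + y * 2#) ≈⟨ +-cong (*-congˡ p) (*-congˡ q) ⟩
        2# * 0# + b * 0#        ≈⟨ solve 1 (λ b → :2 :* :0 :+ b :* :0 := :0) ≈-refl b ⟩
        0#                      ∎)
      y≈0 : ∀ {x y} → x * 2# + y * - b ≈ 0# → x * - b + y * 2# ≈ 0# → y ≈ 0#
      y≈0 {x} {y} p q = x≈0 (≈-trans (+-comm _ _) q) (≈-trans (+-comm _ _) p)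

  act-≃ : ∀ {u v} → u ≃ v → ∀ β → act u β ≋ act v β
  act-≃ (relator {i} {j} {k} e) β with i Fin.≟ j
  ... | yes ≡.refl with ≡.refl ← ≡.trans (≡.sym (W.m-diagonal i)) e = reflect-involutive i β
  ... | no i≢j with label i≢j
  ...   | finite e′ 3≤M F with ≡.refl ← ≡.trans (≡.sym e) e′ = rotation-trivial F 3≤M β
  ...   | infinite e′ _ with () ← ≡.trans (≡.sym e) e′
  act-≃ (++-cong {u} {u′} {v} {v′} p q) β = ≋-trans (≋-reflexive (act-++ u v β))
    (≋-trans (act-cong u (act-≃ q β)) (≋-trans (act-≃ p (act v′ β)) (≋-sym (≋-reflexive (act-++ u′ v′ β)))))
  act-≃ refl        β = ≋-refl
  act-≃ (sym p)     β = ≋-sym (act-≃ p β)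
  act-≃ (trans p q) β = ≋-trans (act-≃ p β) (act-≃ q β)

-- Signs of roots

module Roots (em : ExcludedMiddle 0ℓ) (ℝ : RealNumbers) (trig : Trigonometry ℝ)
             {n} (W : CoxeterSystem n) (complete-graph : HasCompleteCoxeterGraph W) where
  open Action em ℝ trig W complete-graph public

  Pos Neg : V → Set
  Pos β = ∀ i → 0# ≤ β i
  Neg β = ∀ i → β i ≤ 0#

  Pos-resp : ∀ {β γ} → β ≋ γ → Pos β → Pos γ
  Pos-resp e p i = ≤-respʳ (e i) (p i)

  Neg-resp : ∀ {β γ} → β ≋ γ → Neg β → Neg γ
  Neg-resp e p i = ≤-respˡ (e i) (p i)

  Pos-neg : ∀ {β} → Pos β → Neg (neg β)
  Pos-neg p i = neg-nonpos (p i)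

  Neg-neg : ∀ {β} → Neg β → Pos (neg β)
  Neg-neg p i = neg-nonneg (p i)

  Pos-lin : ∀ {c β d γ} → 0# ≤ c → Pos β → 0# ≤ d → Pos γ → Pos (lin c β d γ)
  Pos-lin c β d γ i = +-nonneg (*-nonneg c (β i)) (*-nonneg d (γ i))

  Neg-lin : ∀ {c β d γ} → 0# ≤ c → Neg β → 0# ≤ d → Neg γ → Neg (lin c β d γ)
  Neg-lin {c} {β} {d} {γ} 0≤c p 0≤d q i =
    ≤-respˡ (solve 4 (λ c b d g → :- (c :* :- b :+ d :* :- g) := c :* b :+ d :* g) ≈-refl c (β i) d (γ i))
      (neg-nonpos (Pos-lin 0≤c (Neg-neg p) 0≤d (Neg-neg q) i))

  -- Roots presented by words, on which inductions can run; `Root⇒IsRoot` and `IsRoot⇒Root` connect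
  -- them with the orbit under the group.
  IsRoot : V → Set
  IsRoot β = ∃[ u ] ∃[ i ] β ≋ act u (α i)

  IsRoot-resp : ∀ {β γ} → β ≋ γ → IsRoot β → IsRoot γ
  IsRoot-resp e (u , i , f) = u , i , ≋-trans (≋-sym e) f

  α-root : ∀ i → IsRoot (α i)
  α-root i = [] , i , ≋-refl

  reflect-root : ∀ i {β} → IsRoot β → IsRoot (reflect i β)
  reflect-root i (u , j , e) = i ∷ u , j , reflect-cong i e

  act-root : ∀ v {β} → IsRoot β → IsRoot (act v β)
  act-root []      r = r
  act-root (i ∷ v) r = reflect-root i (act-root v r)

  act-∷ʳ : ∀ u i β → act (u ∷ʳ i) β ≡ act u (reflect i β)
  act-∷ʳ u i β = act-++ u [ i ] β

  act-∷ʳ-self : ∀ u i → act (u ∷ʳ i) (α i) ≋ neg (act u (α i))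
  act-∷ʳ-self u i = ≋-trans (≋-reflexive (act-∷ʳ u i (α i))) (≋-trans (act-cong u (reflect-self i)) (act-neg u (α i)))

  act-reflect : ∀ u i β → act u (reflect i β) ≋ lin 1# (act u β) (- h β i) (act u (α i))
  act-reflect u i β = ≋-trans (act-cong u (reflect-lin-form i β)) (act-lin u 1# β (- h β i) (α i))

  neg-root : ∀ {β} → IsRoot β → IsRoot (neg β)
  neg-root (u , i , e) = u ∷ʳ i , i , ≋-trans (λ k → -‿cong (e k)) (≋-sym (act-∷ʳ-self u i))

  B-root : ∀ {β} → IsRoot β → B β β ≈ 1#
  B-root (u , i , e) = ≈-trans (B-cong e e) (≈-trans (B-act u (α i) (α i)) (≈-trans (B-α-α i i) (gram-diagonal i)))

  root-nonzero : ∀ {β} → IsRoot β → Pos β → Neg β → ⊥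
  root-nonzero {β} r p q = >⇒≉ 0<1 (≈-trans (≈-sym (B-root r)) (≈-trans (B-cong β≈0 ≋-refl)
    (≈-trans (B-linˡ 0# β 0# β β) (solve 1 (λ x → :0 :* x :+ :0 :* x := :0) ≈-refl (B β β)))))
    where
    β≈0 : β ≋ lin 0# β 0# β
    β≈0 i = ≈-trans (≤-antisym (q i) (p i)) (solve 1 (λ x → :0 := :0 :* x :+ :0 :* x) ≈-refl (β i))

  a≡ : ∀ i j → a i j ≡ a j i
  a≡ i j = ≡.cong coefficient (W.m-symmetric i j)

  finite-coefficient : ∀ {i j M} → i ≢ j → m i j ≡ fin M → 3 ℕ.≤ M × IsFiniteCoefficient (a i j) M
  finite-coefficient i≢j e with label i≢j
  ... | finite e′ 3≤M F with ≡.refl ← ≡.trans (≡.sym e) e′ = 3≤M , F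
  ... | infinite e′ _ with () ← ≡.trans (≡.sym e) e′

  cheb-nonneg : ∀ {i j} → i ≢ j → ∀ k → (∀ M → m i j ≡ fin M → k ℕ.≤ M) → 0# ≤ cheb (a i j) k
  cheb-nonneg i≢j k b with label i≢j
  ... | finite e _ F = IsFiniteCoefficient.cheb≥0 F (b _ e)
  ... | infinite _ e = ≤-respʳ (≈-sym (cheb-at-2 e k)) (fromℕ-nonneg k)

  reflect-plane : ∀ {i j} x y → reflect j (lin x (α i) y (α j)) ≋ lin (a i j * x - y) (α j) x (α i)
  reflect-plane {i} {j} x y k = begin
    lin x (α i) y (α j) k - h (lin x (α i) y (α j)) j * α j k
      ≈⟨ +-congˡ (-‿cong (*-congʳ (≈-trans (h-lin x (α i) y (α j) j) (+-cong (*-congˡ (h-off i j)) (*-congˡ (h-diagonal j)))))) ⟩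
    (x * α i k + y * α j k) - (x * - a i j + y * 2#) * α j k
      ≈⟨ solve 5 (λ x p y q c → (x :* p :+ y :* q) :- (x :* :- c :+ y :* :2) :* q := (c :* x :- y) :* q :+ x :* p) ≈-refl x (α i k) y (α j k) (a i j) ⟩
    (a i j * x - y) * α j k + x * α i k ∎
    where open ≈-Reasoning

  -- The positive roots in the plane of α i and α j, indexed from α i at 0.
  plane : Fin n → Fin n → ℕ → V
  plane i j k = lin (cheb (a i j) (suc k)) (α i) (cheb (a i j) k) (α j)

  plane-0 : ∀ i j → plane i j 0 ≋ α i
  plane-0 i j k = solve 2 (λ x y → :1 :* x :+ :0 :* y := x) ≈-refl (α i k) (α j k)

  plane-up : ∀ i j k → reflect j (plane i j k) ≋ plane j i (suc k)
  plane-up i j k = ≋-trans (reflect-plane (cheb (a i j) (suc k)) (cheb (a i j) k))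
    (≋-reflexive (≡.cong (λ c → lin (cheb c (suc (suc k))) (α j) (cheb c (suc k)) (α i)) (a≡ i j)))

  plane-down : ∀ i j k → reflect i (plane i j (suc k)) ≋ plane j i k
  plane-down i j k = ≋-trans (reflect-cong i (≋-sym (plane-up j i k))) (reflect-involutive i (plane j i k))

  letter-cases : ∀ i j k → (W.letter i j k ≡ j × W.letter i j (suc k) ≡ i) ⊎ (W.letter i j k ≡ i × W.letter i j (suc k) ≡ j)
  letter-cases i j zero    = inj₁ (≡.refl , ≡.refl)
  letter-cases i j (suc k) with letter-cases i j k
  ... | inj₁ (p , q) = inj₂ (q , p)
  ... | inj₂ (p , q) = inj₁ (q , p)

  act-alternating : ∀ i j k → act (W.alternating i j k) (α i) ≋ plane (W.letter i j (suc k)) (W.letter i j k) k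
  act-alternating i j zero    = ≋-sym (plane-0 i j)
  act-alternating i j (suc k) = ≋-trans (reflect-cong (W.letter i j k) (act-alternating i j k))
    (plane-up (W.letter i j (suc k)) (W.letter i j k) k)

  -- Humphreys, Reflection Groups and Coxeter Groups, Theorem 5.4: write u as a
  -- product of a word v and an alternating word in i and the last letter of u,
  -- with v as short as possible.
  ascent-positive : ∀ N u i → length u ℕ.< N → W.Reduced u → W.Reduced (u ∷ʳ i) → Pos (act u (α i))
  ascent-positive (suc N) u i (s≤s l) r rᵢ with reverseView u
  ... | [] = α-nonneg i
  ... | u′ ∶ _ ∶ʳ j = shrink (suc (length u′)) u′ 1 ℕ.≤-refl (s≤s z≤n) refl (≡.sym (List.length-++ u′))
                        λ M e → ℕ.≤-trans (ℕ.n≤1+n 2) (proj₁ (finite-coefficient i≢j e))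
    where
    open ℕ.≤-Reasoning
    i≢j : i ≢ j
    i≢j ≡.refl = ℕ.<-irrefl ≡.refl (begin-strict
      length u′                  <⟨ ℕ.n<1+n _ ⟩
      suc (length u′)            ≡⟨ W.length-∷ʳ u′ i ⟨
      length (u′ ∷ʳ i)           <⟨ ℕ.n<1+n _ ⟩
      suc (length (u′ ∷ʳ i))     ≡⟨ W.length-∷ʳ (u′ ∷ʳ i) i ⟨
      length ((u′ ∷ʳ i) ∷ʳ i)    ≤⟨ rᵢ u′ (sym (trans (W.cancel-in u′ i []) (W.≃-reflexive (List.++-identityʳ u′)))) ⟩
      length u′                  ∎)

    shrink : ∀ K v k → length v ℕ.< K → 1 ℕ.≤ k → v ++ W.alternating i j k ≃ u′ ∷ʳ j →
             length v ℕ.+ k ≡ length (u′ ∷ʳ j) → (∀ M → m i j ≡ fin M → k ℕ.< M) → Pos (act (u′ ∷ʳ j) (α i))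
    shrink (suc K) v (suc k′) (s≤s lv) _ e len bound = choose (W.ascent-or-descent v p rv) (W.ascent-or-descent v q rv)
      where
      k : ℕ
      k = suc k′
      p q : Fin n
      p = W.letter i j k
      q = W.letter i j (suc k)

      length-word : ∀ v → length (v ++ W.alternating i j k) ≡ length v ℕ.+ k
      length-word v = ≡.trans (List.length-++ v) (≡.cong (length v ℕ.+_) (W.length-alternating i j k))

      rv : W.Reduced v
      rv = W.Reduced-prefix v (W.alternating i j k) (W.Reduced-length (sym e) r (ℕ.≤-reflexive (≡.trans (length-word v) len)))

      v<u : length v ℕ.< length (u′ ∷ʳ j)
      v<u = ℕ.≤-trans (ℕ.≤-trans (ℕ.≤-reflexive (ℕ.+-comm 1 (length v))) (ℕ.+-monoʳ-≤ (length v) (s≤s z≤n))) (ℕ.≤-reflexive len)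

      Descent : Fin n → Set
      Descent x = ∃[ v′ ] v′ ∷ʳ x ≃ v × suc (length v′) ≡ length v

      -- Neither letter of the pair can be split off from v any more, so induction applies to v with
      -- α p and with α q. The alternating word sends α i to a combination of these two, with
      -- nonnegative coefficients because k < M.
      positive : W.Reduced (v ∷ʳ p) → W.Reduced (v ∷ʳ q) → Pos (act (u′ ∷ʳ j) (α i))
      positive rp rq = Pos-resp (≋-trans (≋-sym (act-lin v _ (α q) _ (α p))) (≋-trans (act-cong v (≋-sym (act-alternating i j k)))
          (≋-trans (≋-sym (≋-reflexive (act-++ v (W.alternating i j k) (α i)))) (act-≃ e (α i)))))
        (Pos-lin (nonneg (suc k) λ M f → bound M f) (ascent-positive N v q (ℕ.≤-trans v<u l) rv rq)
                 (nonneg k λ M f → ℕ.<⇒≤ (bound M f)) (ascent-positive N v p (ℕ.≤-trans v<u l) rv rp))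
        where
        nonneg : ∀ x → (∀ M → m i j ≡ fin M → x ℕ.≤ M) → 0# ≤ cheb (a q p) x
        nonneg x b with letter-cases i j k
        ... | inj₁ (≡p , ≡q) = ≡.subst₂ (λ y z → 0# ≤ cheb (a y z) x) (≡.sym ≡q) (≡.sym ≡p) (cheb-nonneg i≢j x b)
        ... | inj₂ (≡p , ≡q) = ≡.subst₂ (λ y z → 0# ≤ cheb (a y z) x) (≡.sym ≡q) (≡.sym ≡p)
                                 (cheb-nonneg (i≢j ∘ ≡.sym) x λ M f → b M (≡.trans (W.m-symmetric i j) f))

      choose : W.Reduced (v ∷ʳ p) ⊎ Descent p → W.Reduced (v ∷ʳ q) ⊎ Descent q → Pos (act (u′ ∷ʳ j) (α i))
      choose (inj₂ (v′ , e′ , l′)) _ = shrink K v′ (suc k) (ℕ.≤-trans (ℕ.≤-reflexive l′) lv) (s≤s z≤n) word len′ bound′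
        where
        word : v′ ++ W.alternating i j (suc k) ≃ u′ ∷ʳ j
        word = trans (W.≃-reflexive (≡.sym (List.++-assoc v′ [ p ] (W.alternating i j k)))) (trans (++-cong e′ refl) e)
        len′ : length v′ ℕ.+ suc k ≡ length (u′ ∷ʳ j)
        len′ = ≡.trans (ℕ.+-suc (length v′) k) (≡.trans (≡.cong (ℕ._+ k) l′) len)
        -- If the alternating word reached length M, appending i would make it alternating of length
        -- M + 1, and the braid relation would shorten u i.
        bound′ : ∀ M → m i j ≡ fin M → suc k ℕ.< M
        bound′ M f = ℕ.≤∧≢⇒< (bound M f) λ { ≡.refl → too-long f }
          where
          too-long : m i j ≡ fin (suc k) → ⊥
          too-long f with z , e″ , lz ← W.alternating-shorten j i (≡.trans (W.m-symmetric j i) f) (s≤s z≤n) = ℕ.<-irrefl ≡.refl (begin-strict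
            length (u′ ∷ʳ j)           <⟨ ℕ.n<1+n _ ⟩
            suc (length (u′ ∷ʳ j))     ≡⟨ W.length-∷ʳ (u′ ∷ʳ j) i ⟨
            length ((u′ ∷ʳ j) ∷ʳ i)    ≤⟨ rᵢ (v′ ++ z) (trans (++-cong (refl {u = v′}) (sym e″))
                (trans (W.≃-reflexive (≡.trans (≡.cong (v′ ++_) (≡.sym (W.alternating-∷ʳ i j (suc k)))) (≡.sym (List.++-assoc v′ _ [ i ])))) (++-cong word refl))) ⟩
            length (v′ ++ z)           ≡⟨ List.length-++ v′ ⟩
            length v′ ℕ.+ length z     <⟨ ℕ.+-monoʳ-< (length v′) lz ⟩
            length v′ ℕ.+ suc k        ≡⟨ len′ ⟩
            length (u′ ∷ʳ j)           ∎)
      -- `letter` has period 2 in its last argument, so q is the first letter of the alternating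
      -- word and would cancel against the end of v.
      choose (inj₁ _) (inj₂ (v′ , e′ , l′)) = ⊥-elim (ℕ.<-irrefl ≡.refl (begin-strict
        length (u′ ∷ʳ j)                       ≤⟨ r (v′ ++ W.alternating i j k′) shorter ⟩
        length (v′ ++ W.alternating i j k′)    ≡⟨ ≡.trans (List.length-++ v′) (≡.cong (length v′ ℕ.+_) (W.length-alternating i j k′)) ⟩
        length v′ ℕ.+ k′                       <⟨ ℕ.+-mono-< (ℕ.≤-reflexive l′) (ℕ.n<1+n k′) ⟩
        length v ℕ.+ k                         ≡⟨ len ⟩
        length (u′ ∷ʳ j)                       ∎))
        where
        shorter : v′ ++ W.alternating i j k′ ≃ u′ ∷ʳ j
        shorter = trans (sym (W.cancel-in v′ q (W.alternating i j k′))) (trans (++-cong e′ refl) e)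
      choose (inj₁ rp) (inj₁ rq) = positive rp rq

  root-sign : ∀ {β} → IsRoot β → Pos β ⊎ Neg β
  root-sign (u , i , e) with v , f , r ← W.reduce u with W.ascent-or-descent v i r
  ... | inj₁ rᵢ = inj₁ (Pos-resp (≋-trans (act-≃ f (α i)) (≋-sym e)) (ascent-positive _ v i ℕ.≤-refl r rᵢ))
  ... | inj₂ (w , g , l) = inj₂ (Neg-resp (≋-trans (≋-sym (act-∷ʳ-self w i)) (≋-trans (act-≃ (trans g f) (α i)) (≋-sym e)))
          (Pos-neg (ascent-positive _ w i ℕ.≤-refl (W.Reduced-prefix w [ i ] rw) rw)))
    where
    rw : W.Reduced (w ∷ʳ i)
    rw = W.Reduced-length (sym g) r (ℕ.≤-reflexive (≡.trans (W.length-∷ʳ w i) l))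

  reduced-descent : ∀ w i → W.Reduced (w ∷ʳ i) → Neg (act (w ∷ʳ i) (α i))
  reduced-descent w i r = Neg-resp (≋-sym (act-∷ʳ-self w i)) (Pos-neg (ascent-positive _ w i ℕ.≤-refl (W.Reduced-prefix w [ i ] r) r))

  -- The reflection changes only coordinate i. If the sign flips, all other coordinates of β are
  -- both nonnegative and nonpositive, so β is a multiple of α i, and B(β, β) = 1 fixes the
  -- multiple.
  simple-or-reflect-positive : ∀ i {β} → IsRoot β → Pos β → β ≋ α i ⊎ Pos (reflect i β)
  simple-or-reflect-positive i {β} r p with root-sign (reflect-root i r)
  ... | inj₁ q = inj₂ q
  ... | inj₂ q = inj₁ (≋-trans multiple (λ k → ≈-trans (+-cong (*-congʳ c≈1) (zeroˡ _)) (≈-trans (+-identityʳ _) (*-identityˡ _))))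
    where
    open ≈-Reasoning
    c : Carrier
    c = β i
    multiple : β ≋ lin c (α i) 0# (α i)
    multiple j with i Fin.≟ j
    ... | yes ≡.refl = solve 1 (λ c → c := c :* :1 :+ :0 :* :1) ≈-refl c
    ... | no i≢j = ≈-trans (≤-antisym (≤-respˡ (reflect-off β i≢j) (q j)) (p j)) (solve 1 (λ c → :0 := c :* :0 :+ :0 :* :0) ≈-refl c)
    c*c≈1 : c * c ≈ 1#
    c*c≈1 = begin
      c * c                       ≈⟨ solve 1 (λ c → c :* c := c :* (c :* :1 :+ :0 :* :1) :+ :0 :* (c :* :1 :+ :0 :* :1)) ≈-refl c ⟩
      c * (c * 1# + 0# * 1#) + 0# * (c * 1# + 0# * 1#)
        ≈⟨ +-cong (*-congˡ (+-cong (*-congˡ one) (*-congˡ one))) (*-congˡ (+-cong (*-congˡ one) (*-congˡ one))) ⟨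
      c * (c * B (α i) (α i) + 0# * B (α i) (α i)) + 0# * (c * B (α i) (α i) + 0# * B (α i) (α i))
        ≈⟨ +-cong (*-congˡ (B-linʳ (α i) c (α i) 0# (α i))) (*-congˡ (B-linʳ (α i) c (α i) 0# (α i))) ⟨
      c * B (α i) (lin c (α i) 0# (α i)) + 0# * B (α i) (lin c (α i) 0# (α i)) ≈⟨ B-linˡ c (α i) 0# (α i) _ ⟨
      B (lin c (α i) 0# (α i)) (lin c (α i) 0# (α i)) ≈⟨ B-cong multiple multiple ⟨
      B β β                       ≈⟨ B-root r ⟩
      1#                          ∎
      where
      one : B (α i) (α i) ≈ 1#
      one = B-root (α-root i)
    c≈1 : c ≈ 1#
    c≈1 = begin
      c                ≈⟨ solve 1 (λ c → c := (c :- :1) :+ :1) ≈-refl c ⟩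
      (c - 1#) + 1#    ≈⟨ +-congʳ (*-nonzero (>⇒≉ (+-pos-nonneg 0<1 (p i))) (≈-trans
                            (solve 1 (λ c → (:1 :+ c) :* (c :- :1) := c :* c :- :1) ≈-refl c) (≈-trans (+-congʳ c*c≈1) (-‿inverseʳ 1#)))) ⟩
      0# + 1#          ≈⟨ +-identityˡ 1# ⟩
      1#               ∎

  -- If γ is the simple root that w turns negative first, the pair (γ , δ) is
  -- replaced by (δ , s δ) with s the reflection in γ.
  no-common-inversion : ∀ {w} → Reverse w → ∀ {γ δ} → IsRoot γ → Pos γ → IsRoot δ → Pos δ → B γ δ ≤ - 1# →
                        Neg (act w γ) → Neg (act w δ) → ⊥
  no-common-inversion-α : ∀ {w} → Reverse w → ∀ i {δ} → IsRoot δ → Pos δ → Pos (reflect i δ) → B δ (α i) ≤ - 1# →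
                          Neg (act (w ∷ʳ i) (α i)) → Neg (act (w ∷ʳ i) δ) → ⊥

  no-common-inversion [] rγ pγ _ _ _ nγ _ = root-nonzero rγ pγ nγ
  no-common-inversion (w ∶ v ∶ʳ i) {γ} {δ} rγ pγ rδ pδ b nγ nδ
    with simple-or-reflect-positive i rγ pγ | simple-or-reflect-positive i rδ pδ
  ... | inj₂ pγ′ | inj₂ pδ′ = no-common-inversion v (reflect-root i rγ) pγ′ (reflect-root i rδ) pδ′
          (≤-respˡ (≈-sym (B-reflect i γ δ)) b) (Neg-resp (≋-reflexive (act-∷ʳ w i γ)) nγ) (Neg-resp (≋-reflexive (act-∷ʳ w i δ)) nδ)
  ... | inj₁ e | inj₁ f = <⇒≱ (0<⇒< (+-pos-pos 0<1 0<1) (solve 0 (:1 := :- :1 :+ (:1 :+ :1)) ≈-refl))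
          (≤-respˡ (≈-trans (B-cong e f) (B-root (α-root i))) b)
  ... | inj₁ e | inj₂ pδ′ = no-common-inversion-α v i rδ pδ pδ′ (≤-respˡ (≈-trans (B-symmetric γ δ) (B-cong ≋-refl e)) b)
          (Neg-resp (act-cong (w ∷ʳ i) e) nγ) nδ
  ... | inj₂ pγ′ | inj₁ f = no-common-inversion-α v i rγ pγ pγ′ (≤-respˡ (B-cong ≋-refl f) b) (Neg-resp (act-cong (w ∷ʳ i) f) nδ) nγ

  no-common-inversion-α {w} v i {δ} rδ pδ pδ′ b nα nδ =
    no-common-inversion v rδ pδ (reflect-root i rδ) pδ′ b′ nδ′ (Neg-resp (≋-reflexive (act-∷ʳ w i δ)) nδ)
    where
    x : Carrier
    x = B δ (α i)
    0≤-1-x : 0# ≤ - 1# - x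
    0≤-1-x = ≤⇒0≤ b
    -- B(δ, s δ) = 1 - 2x², and x ≤ -1.
    b′ : B δ (reflect i δ) ≤ - 1#
    b′ = ≤-respˡ (≈-sym (≈-trans (B-cong ≋-refl (reflect-lin-form i δ)) (≈-trans (B-linʳ δ 1# δ _ (α i)) (+-congʳ (*-congˡ (B-root rδ))))))
      (0≤⇒≤ (+-nonneg (*-nonneg (<⇒≤ 0<2) (*-nonneg 0≤-1-x 0≤-1-x)) (*-nonneg (+-nonneg (<⇒≤ 0<2) (<⇒≤ 0<2)) 0≤-1-x))
        (solve 1 (λ x → :- :1 := (:1 :* :1 :+ (:- (:2 :* x)) :* x) :+ (:2 :* ((:- :1 :- x) :* (:- :1 :- x)) :+ (:2 :+ :2) :* (:- :1 :- x))) ≈-refl x))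
    -- Here w δ = (w s)(s δ), and s δ = δ - 2x α i has nonnegative coefficients in δ and α i, both
    -- made negative by w s.
    nδ′ : Neg (act w δ)
    nδ′ = Neg-resp (≋-trans (≋-sym (act-reflect (w ∷ʳ i) i δ)) (≋-trans (≋-reflexive (act-∷ʳ w i (reflect i δ))) (act-cong w (reflect-involutive i δ))))
      (Neg-lin 0≤1 nδ (≤-respʳ (solve 1 (λ x → :2 :* (:1 :+ (:- :1 :- x)) := :- (:2 :* x)) ≈-refl x)
                         (*-nonneg (<⇒≤ 0<2) (+-nonneg 0≤1 0≤-1-x))) nα)

  h≤-2⇒B≤-1 : ∀ {β} i → h β i ≤ - 2# → B β (α i) ≤ - 1#
  h≤-2⇒B≤-1 {β} i p = 0≤⇒≤ (*-cancel-nonneg 0<2 (≤-respʳ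
      (solve 1 (λ b → :- :2 :- :2 :* b := :2 :* (:- :1 :- b)) ≈-refl (B β (α i))) (≤⇒0≤ p)))
    (solve 1 (λ b → :- :1 := b :+ (:- :1 :- b)) ≈-refl (B β (α i)))

  -- Small roots and dominance

  plane-nonneg : ∀ {i j M} → i ≢ j → m i j ≡ fin M → ∀ k → suc k ℕ.≤ M → Pos (plane i j k)
  plane-nonneg {i} {j} i≢j e k b = Pos-lin (nonneg b) (α-nonneg i) (nonneg (ℕ.≤-trans (ℕ.n≤1+n k) b)) (α-nonneg j)
    where
    nonneg : ∀ {l} → l ℕ.≤ _ → 0# ≤ cheb (a i j) l
    nonneg = IsFiniteCoefficient.cheb≥0 (proj₂ (finite-coefficient i≢j e))

  plane-last : ∀ {i j M} → i ≢ j → m i j ≡ fin M → ∀ k → suc (suc k) ≡ M → plane j i (suc k) ≋ α i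
  plane-last {i} {j} {M} i≢j e k ≡.refl l = ≈-trans (+-cong (*-congʳ (≈-trans (flip (suc (suc k))) cheb-end)) (*-congʳ (≈-trans (flip (suc k)) cheb-last)))
    (solve 2 (λ x y → :0 :* x :+ :1 :* y := y) ≈-refl (α j l) (α i l))
    where
    open IsFiniteCoefficient (proj₂ (finite-coefficient i≢j e))
    flip : ∀ l → cheb (a j i) l ≈ cheb (a i j) l
    flip = cheb-cong (a-symmetric j i)

  -- Both coordinates of a nonsimple root of the plane are at least 1 by `cheb≥1`, and so are
  -- `a i l` and `a j l`: each of the two products contributes at most -1.
  h-plane-far : ∀ {i j l M} → i ≢ j → m i j ≡ fin M → l ≢ i → l ≢ j → ∀ k → 1 ℕ.≤ k → suc k ℕ.< M → h (plane i j k) l ≤ - 2#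
  h-plane-far {i} {j} {l} i≢j e l≢i l≢j k 1≤k k<M = ≤-respˡ
    (≈-sym (≈-trans (h-lin (cheb (a i j) (suc k)) (α i) (cheb (a i j) k) (α j) l) (+-cong (*-congˡ (h-off i l)) (*-congˡ (h-off j l)))))
    (0≤⇒≤ (+-nonneg (product (1≤a (l≢i ∘ ≡.sym)) (cheb≥1 (s≤s z≤n) k<M)) (product (1≤a (l≢j ∘ ≡.sym)) (cheb≥1 1≤k (ℕ.<-trans (ℕ.n<1+n k) k<M))))
      (solve 4 (λ x y a b → :- :2 := (x :* :- a :+ y :* :- b) :+ ((a :* x :- :1) :+ (b :* y :- :1))) ≈-refl _ _ _ _))
    where
    open IsFiniteCoefficient (proj₂ (finite-coefficient i≢j e)) using (cheb≥1)
    product : ∀ {x y} → 1# ≤ x → 1# ≤ y → 0# ≤ x * y - 1#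
    product {x} {y} p q = ≤-respʳ (solve 2 (λ x y → (x :- :1) :* (y :- :1) :+ ((x :- :1) :+ (y :- :1)) := x :* y :- :1) ≈-refl x y)
      (+-nonneg (*-nonneg (≤⇒0≤ p) (≤⇒0≤ q)) (+-nonneg (≤⇒0≤ p) (≤⇒0≤ q)))

  -- The small roots of a Coxeter group with complete graph.
  data Small (δ : V) : Set where
    simple   : ∀ i → δ ≋ α i → Small δ
    dihedral : ∀ {i j M} k → i ≢ j → m i j ≡ fin M → 1 ℕ.≤ k → suc k ℕ.< M → δ ≋ plane i j k → Small δ

  Small-resp : ∀ {γ δ} → γ ≋ δ → Small γ → Small δ
  Small-resp e (simple i f) = simple i (≋-trans (≋-sym e) f)
  Small-resp e (dihedral k i≢j f 1≤k b g) = dihedral k i≢j f 1≤k b (≋-trans (≋-sym e) g)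

  plane-up-small : ∀ {i j M} → i ≢ j → m i j ≡ fin M → ∀ k → suc k ℕ.< M → Small (plane j i (suc k))
  plane-up-small {i} {j} i≢j e k b with ℕ.m≤n⇒m<n∨m≡n b
  ... | inj₁ lt = dihedral (suc k) (i≢j ∘ ≡.sym) (≡.trans (W.m-symmetric j i) e) (s≤s z≤n) lt ≋-refl
  ... | inj₂ eq = simple i (plane-last i≢j e k eq)

  reflect-simple : ∀ i j → reflect i (α j) ≋ plane i j 1
  reflect-simple i j = ≋-trans (reflect-cong i (≋-sym (plane-0 j i))) (plane-up j i 0)

  -- The closure property behind the Brink-Howlett theory of small roots: apart from δ = α l, a
  -- simple reflection can leave the set only where B(δ, α l) ≤ -1.
  reflect-small : ∀ l {δ} → Small δ → δ ≋ α l ⊎ (Small (reflect l δ) ⊎ h δ l ≤ - 2#)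
  reflect-small l (simple i e) with l Fin.≟ i
  ... | yes ≡.refl = inj₁ e
  ... | no l≢i with label l≢i
  ...   | finite f 3≤M F = inj₂ (inj₁ (dihedral 1 l≢i f (s≤s z≤n) 3≤M (≋-trans (reflect-cong l e) (reflect-simple l i))))
  ...   | infinite _ f = inj₂ (inj₂ (≤-reflexive (≈-trans (h-cong l e) (≈-trans (h-off i l) (-‿cong (≈-trans (a-symmetric i l) f))))))
  reflect-small l (dihedral {i} {j} k i≢j f 1≤k b e) with l Fin.≟ i | l Fin.≟ j
  ... | _ | yes ≡.refl = inj₂ (inj₁ (Small-resp (≋-sym (≋-trans (reflect-cong l e) (plane-up i l k))) (plane-up-small i≢j f k b)))
  ... | no l≢i | no l≢j = inj₂ (inj₂ (≤-respˡ (≈-sym (h-cong l e)) (h-plane-far i≢j f l≢i l≢j k 1≤k b)))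
  ... | yes ≡.refl | no _ = inj₂ (inj₁ (down k 1≤k b e))
    where
    down : ∀ k → 1 ℕ.≤ k → suc k ℕ.< _ → _ ≋ plane l j k → Small (reflect l _)
    down (suc zero)    _ _ e = simple j (≋-trans (reflect-cong l e) (≋-trans (plane-down l j 0) (plane-0 j l)))
    down (suc (suc k)) _ b e = dihedral (suc k) (i≢j ∘ ≡.sym) (≡.trans (W.m-symmetric j l) f) (s≤s z≤n) (ℕ.<-trans (ℕ.n<1+n _) b)
                                 (≋-trans (reflect-cong l e) (plane-down l j (suc k)))

  -- The condition on B strengthens the induction in `dominates-small`: it excludes that the small
  -- root found for `reflect l β` is α l itself, whose reflection is negative.
  Dominates : V → V → Set
  Dominates β δ = (∀ w → Neg (act w β) → Neg (act w δ)) × 0# < B β δ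

  not-simple-below-descent : ∀ l {β δ} → 0# < h β l → 0# < B (reflect l β) δ → ¬ δ ≋ α l
  not-simple-below-descent l {β} 0<hβ 0<B e = <⇒≱ (*-pos 0<2 0<B)
    (≤-respˡ (≈-sym (≈-trans (*-congˡ (B-cong ≋-refl e)) (h-reflect l β))) (neg-nonpos (<⇒≤ 0<hβ)))

  -- Induction on depth, with a reduced word inverting β as the measure. A small root dominated by
  -- the shallower root s β is reflected back; if that leaves the small roots, the simple root α l
  -- of the reflection is itself dominated.
  dominates-small : ∀ {w} → Reverse w → W.Reduced w → ∀ {β} → IsRoot β → Pos β → Neg (act w β) →
                    ∃[ δ ] IsRoot δ × Pos δ × Small δ × Dominates β δ
  dominates-small [] _ rβ pβ nβ = ⊥-elim (root-nonzero rβ pβ nβ)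
  dominates-small (w ∶ v ∶ʳ l) red {β} rβ pβ nβ with <-or-≥ 0# (h β l)
  ... | inj₂ hβ≤0 = dominates-small v (W.Reduced-prefix w [ l ] red) rβ pβ
          (Neg-resp (≋-trans (≋-sym (act-reflect (w ∷ʳ l) l β)) (≋-trans (≋-reflexive (act-∷ʳ w l (reflect l β))) (act-cong w (reflect-involutive l β))))
            (Neg-lin 0≤1 nβ (neg-nonneg hβ≤0) (reduced-descent w l red)))
  ... | inj₁ 0<hβ with simple-or-reflect-positive l rβ pβ
  ...   | inj₁ e = α l , α-root l , α-nonneg l , simple l ≋-refl ,
            (λ w → Neg-resp (act-cong w e)) , <-respʳ (≈-sym (≈-trans (B-cong e ≋-refl) (B-root (α-root l)))) 0<1
  ...   | inj₂ pβ′ with dominates-small v (W.Reduced-prefix w [ l ] red) (reflect-root l rβ) pβ′ (Neg-resp (≋-reflexive (act-∷ʳ w l β)) nβ)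
  ...     | δ , rδ , pδ , sδ , dom , 0<B with simple-or-reflect-positive l rδ pδ | reflect-small l sδ
  ...       | inj₁ e   | _      = ⊥-elim (not-simple-below-descent l 0<hβ 0<B e)
  ...       | inj₂ _   | inj₁ e = ⊥-elim (not-simple-below-descent l 0<hβ 0<B e)
  ...       | inj₂ pδ′ | inj₂ c = close c
    where
    through : ∀ w → Neg (act w β) → Neg (act (w ∷ʳ l) δ)
    through w nβ = dom (w ∷ʳ l) (Neg-resp (≋-sym (≋-trans (≋-reflexive (act-∷ʳ w l (reflect l β))) (act-cong w (reflect-involutive l β)))) nβ)

    close : Small (reflect l δ) ⊎ h δ l ≤ - 2# → ∃[ δ ] IsRoot δ × Pos δ × Small δ × Dominates β δ
    close (inj₁ s) = reflect l δ , reflect-root l rδ , pδ′ , s ,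
      (λ w nβ → Neg-resp (≋-reflexive (act-∷ʳ w l δ)) (through w nβ)) ,
      <-respʳ (≈-trans (≈-sym (B-reflect l (reflect l β) δ)) (B-cong (reflect-involutive l β) ≋-refl)) 0<B
    close (inj₂ far) = α l , α-root l , α-nonneg l , simple l ≋-refl , dom′ , positive
      where
      positive : 0# < B β (α l)
      positive with <-or-≥ 0# (B β (α l))
      ... | inj₁ p = p
      ... | inj₂ p = ⊥-elim (<⇒≱ 0<hβ (≤-respˡ (solve 1 (λ b → :- (:2 :* :- b) := :2 :* b) ≈-refl _)
                       (neg-nonpos (*-nonneg (<⇒≤ 0<2) (neg-nonneg p)))))
      -- If w inverts β, then w l inverts δ. Were w α l positive, w l would invert α l as well,
      -- although B(δ, α l) ≤ -1.
      dom′ : ∀ w → Neg (act w β) → Neg (act w (α l))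
      dom′ w nβ with root-sign (act-root w (α-root l))
      ... | inj₂ n = n
      ... | inj₁ p = ⊥-elim (no-common-inversion (reverseView (w ∷ʳ l)) rδ pδ (α-root l) (α-nonneg l) (h≤-2⇒B≤-1 l far)
                       (through w nβ) (Neg-resp (≋-sym (act-∷ʳ-self w l)) (Pos-neg p)))

-- Toggles, separating roots and facing roots

module Trajectories (em : ExcludedMiddle 0ℓ) (ℝ : RealNumbers) (trig : Trigonometry ℝ)
                    {n} (W : CoxeterSystem n) (complete-graph : HasCompleteCoxeterGraph W)
                    (L : Pred (CoxeterSystem.Carrier W) 0ℓ) (x₀ : CoxeterSystem.Carrier W) (x₀∈L : L x₀) where
  open Roots em ℝ trig W complete-graph public
  open Billiards em ℝ trig W using (toggle) public
  open W using (_∙_; ε; s) renaming (_⁻¹ to inv; Carrier to ∣W∣; _≈_ to _≈ᵂ_) public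

  word : ∣W∣ → Word
  word w = proj₁ (W.generates w)

  eval-word : ∀ w → W.eval (word w) ≈ᵂ w
  eval-word w = proj₂ (W.generates w)

  act-word : ∀ {u w} → W.eval u ≈ᵂ w → ∀ β → act u β ≋ w · β
  act-word {u} {w} e = act-≃ (W.presents u (word w) (W.≈-trans e (W.≈-sym (eval-word w))))

  ·-congˡ : ∀ {x y} → x ≈ᵂ y → ∀ β → x · β ≋ y · β
  ·-congˡ {x} e = act-word {word x} (W.≈-trans (eval-word x) e)

  ·-congʳ : ∀ x {β γ} → β ≋ γ → x · β ≋ x · γ
  ·-congʳ x = act-cong (word x)

  ·-∙ : ∀ x y β → (x ∙ y) · β ≋ x · (y · β)
  ·-∙ x y β = ≋-trans (≋-sym (act-word {word x ++ word y} (W.≈-trans (W.eval-++ (word x) (word y)) (W.∙-cong (eval-word x) (eval-word y))) β))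
    (≋-reflexive (act-++ (word x) (word y) β))

  ·-ε : ∀ β → ε · β ≋ β
  ·-ε β = ≋-sym (act-word {u = []} W.≈-refl β)

  ·-s : ∀ i β → s i · β ≋ reflect i β
  ·-s i β = ≋-sym (act-word {u = [ i ]} (W.identityʳ (s i)) β)

  ·-inverseˡ : ∀ x β → inv x · (x · β) ≋ β
  ·-inverseˡ x β = ≋-trans (≋-sym (·-∙ (inv x) x β)) (≋-trans (·-congˡ (W.inverseˡ x) β) (·-ε β))

  ·-inverseʳ : ∀ x β → x · (inv x · β) ≋ β
  ·-inverseʳ x β = ≋-trans (≋-sym (·-∙ x (inv x) β)) (≋-trans (·-congˡ (W.inverseʳ x) β) (·-ε β))

  ·-s∙ : ∀ i u β → (s i ∙ u) · β ≋ reflect i (u · β)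
  ·-s∙ i u β = ≋-trans (·-∙ (s i) u β) (·-s i (u · β))

  ·-inv-s∙ : ∀ i u β → inv (s i ∙ u) · β ≋ inv u · reflect i β
  ·-inv-s∙ i u β = ≋-trans (·-congʳ (inv (s i ∙ u)) (≋-sym recover)) (·-inverseˡ (s i ∙ u) (inv u · reflect i β))
    where
    recover : (s i ∙ u) · (inv u · reflect i β) ≋ β
    recover = ≋-trans (·-s∙ i u _) (≋-trans (reflect-cong i (·-inverseʳ u _)) (reflect-involutive i β))

  ·-neg : ∀ x β → x · neg β ≋ neg (x · β)
  ·-neg x = act-neg (word x)

  ·-lin : ∀ x c β d γ → x · lin c β d γ ≋ lin c (x · β) d (x · γ)
  ·-lin x = act-lin (word x)

  ·-root : ∀ x {β} → IsRoot β → IsRoot (x · β)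
  ·-root x = act-root (word x)

  Root⇒IsRoot : ∀ {β} → Root β → IsRoot β
  Root⇒IsRoot (w , i , e) = word w , i , e

  IsRoot⇒Root : ∀ {β} → IsRoot β → Root β
  IsRoot⇒Root (u , i , e) = W.eval u , i , ≋-trans e (act-word {u} W.≈-refl (α i))

  Stuck : ∣W∣ → Fin n → Set
  Stuck u i = ∀ x → L x → Pos (x · (inv u · α i))

  toggle-cases : ∀ i u → (Stuck u i × toggle L i u ≡ u) ⊎ (¬ Stuck u i × toggle L i u ≡ s i ∙ u)
  toggle-cases i u with em {P = Rts L (inv u · α i)}
  ... | yes (_ , p) = inj₁ ((λ x x∈L → proj₂ (p x∈L)) , ≡.refl)
  ... | no ¬p = inj₂ ((λ p → ¬p (IsRoot⇒Root (·-root (inv u) (α-root i)) ,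
                  λ {x} x∈L → IsRoot⇒Root (·-root x (·-root (inv u) (α-root i))) , p x x∈L)) , ≡.refl)

  Separating : ∣W∣ → V → Set
  Separating u β = IsRoot β × (∀ x → L x → Pos (x · β)) × Neg (u · β)

  -- The image of Separating u under -u.
  Facing : ∣W∣ → V → Set
  Facing u γ = IsRoot γ × Pos γ × (∀ x → L x → Neg (x · (inv u · γ)))

  Facing-resp : ∀ {u γ δ} → γ ≋ δ → Facing u γ → Facing u δ
  Facing-resp {u} e (r , p , f) = IsRoot-resp e r , Pos-resp e p , λ x x∈L → Neg-resp (·-congʳ x (·-congʳ (inv u) e)) (f x x∈L)

  Facing⇒Separating : ∀ {u γ} → Facing u γ → Separating u (neg (inv u · γ))
  Facing⇒Separating {u} {γ} (r , p , f) = neg-root (·-root (inv u) r) ,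
    (λ x x∈L → Pos-resp (≋-sym (·-neg x _)) (Neg-neg (f x x∈L))) ,
    Neg-resp (≋-sym (≋-trans (·-neg u _) λ k → -‿cong (·-inverseʳ u γ k))) (Pos-neg p)

  Separating⇒Facing : ∀ {u β} → Separating u β → Facing u (neg (u · β))
  Separating⇒Facing {u} {β} (r , p , f) = neg-root (·-root u r) , Neg-neg f ,
    λ x x∈L → Neg-resp (≋-sym (≋-trans (·-congʳ x (≋-trans (·-neg (inv u) _) λ k → -‿cong (·-inverseˡ u β k))) (·-neg x β))) (Pos-neg (p x x∈L))

  facing-inverted : ∀ u {γ} x → Neg (x · (inv u · γ)) → Neg (act (word x ++ word (inv u)) γ)
  facing-inverted u {γ} x = Neg-resp (≋-sym (≋-reflexive (act-++ (word x) (word (inv u)) γ)))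

  -- For x in L the element x u⁻¹ inverts γ, so by `no-common-inversion` it keeps α i positive; this
  -- puts u⁻¹ α i into R(L).
  stuck-if-far : ∀ {u γ i} → Facing u γ → h γ i ≤ - 2# → Stuck u i
  stuck-if-far {u} {γ} {i} (r , p , f) far x x∈L with root-sign (·-root x (·-root (inv u) (α-root i)))
  ... | inj₁ q = q
  ... | inj₂ q = ⊥-elim (no-common-inversion (reverseView (word x ++ word (inv u))) r p (α-root i) (α-nonneg i) (h≤-2⇒B≤-1 i far)
                   (facing-inverted u x (f x x∈L)) (facing-inverted u x q))

  facing-stuck-disjoint : ∀ {u i} → Facing u (α i) → ¬ Stuck u i
  facing-stuck-disjoint {u} {i} (r , _ , f) st = root-nonzero (·-root x₀ (·-root (inv u) r)) (st x₀ x₀∈L) (f x₀ x₀∈L)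

  -- The underlying root of -R(L) does not change: (s i u)⁻¹ (s i γ) = u⁻¹ γ.
  facing-move : ∀ {u γ i} → Facing u γ → Pos (reflect i γ) → Facing (s i ∙ u) (reflect i γ)
  facing-move {u} {γ} {i} (r , _ , f) p = reflect-root i r , p ,
    λ x x∈L → Neg-resp (·-congʳ x (≋-sym (≋-trans (·-inv-s∙ i u _) (·-congʳ (inv u) (reflect-involutive i γ))))) (f x x∈L)

  -- Since (s i u)⁻¹ α i = - u⁻¹ α i, facing would mean that τ i had been stuck. Recorded after each
  -- move, this fact forces the partner letter to move next, through `unstuck-beside`.
  not-facing-after-move : ∀ {u i} → ¬ Stuck u i → ¬ Facing (s i ∙ u) (α i)
  not-facing-after-move {u} {i} ¬st (_ , _ , f) = ¬st λ x x∈L → Pos-resp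
    (≋-trans (λ k → -‿cong (flipped x k)) (λ k → -‿involutive _)) (Neg-neg (f x x∈L))
    where
    flipped : ∀ x → x · (inv (s i ∙ u) · α i) ≋ neg (x · (inv u · α i))
    flipped x = ≋-trans (·-congʳ x (≋-trans (·-inv-s∙ i u (α i)) (≋-trans (·-congʳ (inv u) (reflect-self i)) (·-neg (inv u) (α i))))) (·-neg x _)

  facing-small : ∀ {u γ} → Facing u γ → ∃[ δ ] Facing u δ × Small δ
  facing-small {u} {γ} (r , p , f) with v , e , red ← W.reduce (word x₀ ++ word (inv u))
    with δ , rδ , pδ , sδ , dom , _ ← dominates-small (reverseView v) red r p (Neg-resp (≋-sym (act-≃ e γ)) (facing-inverted u x₀ (f x₀ x₀∈L)))
    = δ , (rδ , pδ , λ x x∈L → Neg-resp (≋-reflexive (act-++ (word x) (word (inv u)) δ))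
                                 (dom (word x ++ word (inv u)) (facing-inverted u x (f x x∈L)))) , sδ

  -- A move at i changes the sign of u β only for β = ± u⁻¹ α i. The root that would become
  -- separating is u⁻¹ α i, and if it lay in R(L) the toggle would be stuck.
  separating-toggle : ∀ i u {β} → Separating (toggle L i u) β → Separating u β
  separating-toggle i u {β} sep with toggle-cases i u
  ... | inj₁ (_ , e) = ≡.subst (λ v → Separating v β) e sep
  ... | inj₂ (¬st , e) with r , p , f ← ≡.subst (λ v → Separating v β) e sep with root-sign (·-root u r)
  ...   | inj₂ q = r , p , q
  ...   | inj₁ q with simple-or-reflect-positive i (·-root u r) q
  ...     | inj₁ uβ≋α = ⊥-elim (¬st λ x x∈L → Pos-resp (·-congʳ x (≋-trans (≋-sym (·-inverseˡ u β)) (·-congʳ (inv u) uβ≋α))) (p x x∈L))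
  ...     | inj₂ q′ = ⊥-elim (root-nonzero (reflect-root i (·-root u r)) q′ (Neg-resp (·-s∙ i u β) f))

  -- Time is counted in single toggles and the ordering becomes a rotating queue, so that invariants
  -- can be maintained at every toggle; `play-iterate` translates back to sweeps.
  play : List (Fin n) → ∣W∣ → ℕ → ∣W∣
  play []      u _       = u
  play (i ∷ q) u zero    = u
  play (i ∷ q) u (suc t) = play (q ∷ʳ i) (toggle L i u) t

  separating-play : ∀ q u t {β} → Separating (play q u t) β → Separating u β
  separating-play []      u t       sep = sep
  separating-play (i ∷ q) u zero    sep = sep
  separating-play (i ∷ q) u (suc t) sep = separating-toggle i u (separating-play (q ∷ʳ i) (toggle L i u) t sep)

  -- The converse of `separating-play`; it holds when the trajectory ends where it began.
  Steady : List (Fin n) → ∣W∣ → ℕ → Set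
  Steady q u t = ∀ β → Separating u β → Separating (play q u t) β

  steady-step : ∀ {i q u t} → Steady (i ∷ q) u (suc t) → Steady (q ∷ʳ i) (toggle L i u) t
  steady-step {i} {q} {u} st β sep = st β (separating-toggle i u sep)

  -- If α i faces u, then τ i is not stuck and crosses the separating root - u⁻¹ α i, which is then
  -- lost for good.
  steady-not-facing : ∀ {i q u t} → Steady (i ∷ q) u (suc t) → ¬ Facing u (α i)
  steady-not-facing {i} {q} {u} {t} st F with toggle-cases i u
  ... | inj₁ (stuck , _) = facing-stuck-disjoint {u} {i} F stuck
  ... | inj₂ (_ , e) = root-nonzero (α-root i) (α-nonneg i) (Neg-resp crossed (proj₂ (proj₂ sep′)))
    where
    β : V
    β = neg (inv u · α i)
    sep′ : Separating (s i ∙ u) β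
    sep′ = ≡.subst (λ v → Separating v β) e (separating-play (q ∷ʳ i) (toggle L i u) t (st β (Facing⇒Separating {u} F)))
    crossed : (s i ∙ u) · β ≋ α i
    crossed = ≋-trans (·-s∙ i u β) (≋-trans (reflect-cong i (≋-trans (·-neg u _) (λ k → -‿cong (·-inverseʳ u (α i) k))))
      (≋-trans (reflect-cong i (≋-sym (reflect-self i))) (reflect-involutive i (α i))))

  -- -α j is a nonnegative combination of -plane j k l and α k, and u⁻¹ sends
  -- both of these into R(L).
  unstuck-beside : ∀ {u j k l M} → j ≢ k → m j k ≡ fin M → suc l ℕ.< M → Facing u (plane j k l) → Stuck u k → Facing u (α j)
  unstuck-beside {u} {j} {k} {l} j≢k e l<M (_ , _ , f) st = α-root j , α-nonneg j , λ x x∈L z →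
    ≮⇒≥ λ 0<y → <⇒≱ (*-pos (<-≤-trans 0<1 (cheb≥1 (s≤s z≤n) l<M)) 0<y)
      (≤-trans (0≤⇒≤ (*-nonneg (cheb≥0 (ℕ.≤-trans (ℕ.n≤1+n l) (ℕ.<⇒≤ l<M))) (st x x∈L z)) ≈-refl)
        (≤-respˡ (≋-trans (·-congʳ x (·-lin (inv u) _ (α j) _ (α k))) (·-lin x _ _ _ _) z) (f x x∈L z)))
    where open IsFiniteCoefficient (proj₂ (finite-coefficient j≢k e))

  -- Guarantees that the first sweep contains a move: in the dihedral case, being stuck at one
  -- letter of the pair would make the other simple root face u.
  small-not-stuck : ∀ {u γ} → Facing u γ → Small γ → ¬ (∀ i → Stuck u i)
  small-not-stuck {u} F (simple i e) st = facing-stuck-disjoint {u} {i} (Facing-resp {u} e F) (st i)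
  small-not-stuck {u} F (dihedral {i} {j} k i≢j f 1≤k b e) st = facing-stuck-disjoint {u} {i} (unstuck-beside {u} i≢j f b (Facing-resp {u} e F) (st j)) (st i)

-- Growth of coordinates along an alternating run

module Growth (em : ExcludedMiddle 0ℓ) (ℝ : RealNumbers) (trig : Trigonometry ℝ)
              {n} (W : CoxeterSystem n) (complete-graph : HasCompleteCoxeterGraph W) where
  open Roots em ℝ trig W complete-graph

  -- Off-diagonal entries of the Gram matrix are nonpositive. The summand with coefficient 0 only
  -- brings the negated sum into the shape of `sum-lin`.
  h-nonpos : ∀ {ρ} k → Pos ρ → ρ k ≈ 0# → h ρ k ≤ 0#
  h-nonpos {ρ} k p e = ≤-respˡ (≈-trans (solve 1 (λ b → :- (:2 :* (:- :1 :* b :+ :0 :* b)) := :2 :* b) ≈-refl (sum term)) (*-congˡ (≈-sym (B-αʳ ρ k))))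
    (neg-nonpos (*-nonneg (<⇒≤ 0<2) (≤-respʳ (sum-lin {n} (- 1#) term 0# term) (sum-nonneg {n} _ nonneg))))
    where
    term : Fin n → Carrier
    term i = ρ i * gram (m i k)
    nonneg : ∀ i → 0# ≤ - 1# * term i + 0# * term i
    nonneg i with i Fin.≟ k
    ... | yes ≡.refl = ≤-reflexive (≈-sym (≈-trans (+-cong (*-congˡ (*-congʳ e)) (*-congˡ (*-congʳ e)))
            (solve 1 (λ g → :- :1 :* (:0 :* g) :+ :0 :* (:0 :* g) := :0) ≈-refl _)))
    ... | no i≢k = ≤-respʳ (solve 2 (λ r g → r :* :- g := :- :1 :* (r :* g) :+ :0 :* (r :* g)) ≈-refl (ρ i) _)
            (*-nonneg (p i) (*-cancel-nonneg 0<2 (≤-respʳ (≈-trans (≈-sym (-‿involutive _)) (≈-trans (-‿cong (≈-sym (2gram (m i k))))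
              (solve 1 (λ g → :- (:2 :* g) := :2 :* :- g) ≈-refl _))) (0≤a i≢k))))

  -- Coordinates j and k and an amount d at x are split off from η; what remains can only increase
  -- the reflected coordinate, and d enters with the factor `a x k` ≥ 1. The form of the condition
  -- at x covers both a third index with d = η x and the degenerate choice x = j, d = 0.
  reflect-lower-bound : ∀ {j k x} η d → j ≢ k → x ≢ k → 0# ≤ d → 0# ≤ η x - d * α x x - η j * α j x →
                        (∀ z → z ≢ j → z ≢ k → z ≢ x → 0# ≤ η z) → d * α x j ≈ 0# →
                        a j k * η j - η k + d ≤ reflect k η k
  reflect-lower-bound {j} {k} {x} η d j≢k x≢k 0≤d at-x elsewhere at-j =
    0≤⇒≤ (+-nonneg (neg-nonneg (h-nonpos k ρ-nonneg ρk≈0)) (*-nonneg 0≤d (≤⇒0≤ (1≤a x≢k)))) (begin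
      reflect k η k           ≈⟨ reflect-at k η ⟩
      η k - h η k             ≈⟨ solve 6 (λ e f c g d b → e :- f := (c :* g :- e :+ d) :+ (:- (:1 :* (:1 :* (:1 :* f :+ (:- e) :* :2) :+ (:- g) :* (:- c)) :+ (:- d) :* (:- b)) :+ d :* (b :- :1)))
                                   ≈-refl (η k) (h η k) (a j k) (η j) d (a x k) ⟩
      (a j k * η j - η k + d) + (- (1# * (1# * (1# * h η k + (- η k) * 2#) + (- η j) * (- a j k)) + (- d) * (- a x k)) + d * (a x k - 1#))
        ≈⟨ +-congˡ (+-congʳ (-‿cong h-ρ)) ⟨
      (a j k * η j - η k + d) + (- h ρ k + d * (a x k - 1#)) ∎)
    where
    open ≈-Reasoning
    -- ρ vanishes at k and is nonnegative elsewhere, so h ρ k ≤ 0.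
    ρ : V
    ρ = lin 1# (lin 1# (lin 1# η (- η k) (α k)) (- η j) (α j)) (- d) (α x)
    h-ρ : h ρ k ≈ 1# * (1# * (1# * h η k + (- η k) * 2#) + (- η j) * (- a j k)) + (- d) * (- a x k)
    h-ρ = ≈-trans (h-lin 1# _ (- d) (α x) k) (+-cong (*-congˡ (≈-trans (h-lin 1# _ (- η j) (α j) k)
            (+-cong (*-congˡ (≈-trans (h-lin 1# η (- η k) (α k) k) (+-congˡ (*-congˡ (h-diagonal k))))) (*-congˡ (h-off j k))))) (*-congˡ (h-off x k)))
    coordinate : ∀ z {p q r} → α k z ≈ p → α j z ≈ q → d * α x z ≈ r → ρ z ≈ ((η z - η k * p) - η j * q) - r
    coordinate z {p} {q} {r} e f g = ≈-trans
      (solve 7 (λ n k j d p q r → :1 :* (:1 :* (:1 :* n :+ (:- k) :* p) :+ (:- j) :* q) :+ (:- d) :* r := ((n :- k :* p) :- j :* q) :- d :* r) ≈-refl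
        (η z) (η k) (η j) d (α k z) (α j z) (α x z))
      (+-cong (+-cong (+-congˡ (-‿cong (*-congˡ e))) (-‿cong (*-congˡ f))) (-‿cong g))
    ρk≈0 : ρ k ≈ 0#
    ρk≈0 = ≈-trans (coordinate k (α-diagonal k) (α-off j≢k) (≈-trans (*-congˡ (α-off x≢k)) (zeroʳ d)))
             (solve 2 (λ k j → ((k :- k :* :1) :- j :* :0) :- :0 := :0) ≈-refl (η k) (η j))
    ρ-nonneg : Pos ρ
    ρ-nonneg z with z Fin.≟ k | z Fin.≟ x | z Fin.≟ j
    ... | yes ≡.refl | _ | _ = ≤-reflexive (≈-sym ρk≈0)
    ... | no z≢k | yes ≡.refl | _ = ≤-respʳ (≈-sym (≈-trans (coordinate x (α-off (z≢k ∘ ≡.sym)) ≈-refl ≈-refl)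
            (solve 5 (λ n k j q r → ((n :- k :* :0) :- j :* q) :- r := n :- r :- j :* q) ≈-refl (η x) (η k) (η j) (α j x) (d * α x x)))) at-x
    ... | no z≢k | no z≢x | yes ≡.refl = ≤-reflexive (≈-sym (≈-trans (coordinate j (α-off (z≢k ∘ ≡.sym)) (α-diagonal j) at-j)
            (solve 2 (λ k j → ((j :- k :* :0) :- j :* :1) :- :0 := :0) ≈-refl (η k) (η j))))
    ... | no z≢k | no z≢x | no z≢j = ≤-respʳ (≈-sym (≈-trans (coordinate z (α-off (z≢k ∘ ≡.sym)) (α-off (z≢j ∘ ≡.sym)) (≈-trans (*-congˡ (α-off (z≢x ∘ ≡.sym))) (zeroʳ d)))
            (solve 3 (λ n k j → ((n :- k :* :0) :- j :* :0) :- :0 := n) ≈-refl (η z) (η k) (η j)))) (elsewhere z z≢j z≢k z≢x)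

  reflect-lower-bound-third : ∀ {i j k} η → j ≢ k → i ≢ k → i ≢ j → (∀ z → z ≢ j → z ≢ k → 0# ≤ η z) →
                              a j k * η j - η k + η i ≤ reflect k η k
  reflect-lower-bound-third {i} {j} η j≢k i≢k i≢j nonneg =
    reflect-lower-bound η (η i) j≢k i≢k (nonneg i i≢j i≢k)
      (≤-reflexive (≈-sym (≈-trans (+-cong (+-congˡ (-‿cong (*-congˡ (α-diagonal i)))) (-‿cong (*-congˡ (α-off (i≢j ∘ ≡.sym)))))
        (solve 2 (λ i j → i :- i :* :1 :- j :* :0 := :0) ≈-refl (η i) (η j)))))
      (λ z z≢j z≢k _ → nonneg z z≢j z≢k) (≈-trans (*-congˡ (α-off i≢j)) (zeroʳ _))

  reflect-lower-bound-pair : ∀ {j k} η → j ≢ k → (∀ z → z ≢ j → z ≢ k → 0# ≤ η z) → a j k * η j - η k ≤ reflect k η k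
  reflect-lower-bound-pair {j} η j≢k nonneg = ≤-respˡ (+-identityʳ _)
    (reflect-lower-bound η 0# j≢k j≢k ≤-refl
      (≤-reflexive (≈-sym (≈-trans (+-cong (+-congˡ (-‿cong (zeroˡ _))) (-‿cong (*-congˡ (α-diagonal j))))
        (solve 1 (λ j → j :- :0 :- j :* :1 := :0) ≈-refl (η j)))))
      (λ z z≢j z≢k _ → nonneg z z≢j z≢k) (zeroˡ _))

  -- The invariant between runs, for the pair {i , j} of the run just finished. The next run keeps j
  -- and replaces i by a third letter, so both coordinates have to bound all the others.
  record Balanced (i j : Fin n) (η : V) : Set where
    field
      nonnegᵢ : 0# ≤ η i
      nonnegⱼ : 0# ≤ η j
      nonneg  : ∀ z → z ≢ i → z ≢ j → 0# ≤ η z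
      belowᵢ  : ∀ z → z ≢ i → z ≢ j → η z ≤ η i
      belowⱼ  : ∀ z → z ≢ i → z ≢ j → η z ≤ η j

  -- c is the largest coordinate of η outside {j , k}, or 0 if there is none.
  -- The last inequality makes the ratio of η_j to η_k at least that of the
  -- coordinates of plane j k l.
  record Growing (j k : Fin n) (l : ℕ) (η : V) : Set where
    field
      c       : Carrier
      nonneg  : ∀ z → z ≢ j → z ≢ k → 0# ≤ η z
      below   : ∀ z → z ≢ j → z ≢ k → η z ≤ c
      attain  : c ≈ 0# ⊎ (∃[ i ] i ≢ j × i ≢ k × η i ≈ c)
      0≤c     : 0# ≤ c
      c≤ηⱼ    : c ≤ η j
      0≤ηₖ    : 0# ≤ η k
      slope   : 0# ≤ cheb (a j k) l * η j - cheb (a j k) (suc l) * η k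

  Balanced⇒Pos : ∀ {i j η} → Balanced i j η → Pos η
  Balanced⇒Pos {i} {j} b z with z Fin.≟ i | z Fin.≟ j
  ... | yes ≡.refl | _          = Balanced.nonnegᵢ b
  ... | no _       | yes ≡.refl = Balanced.nonnegⱼ b
  ... | no z≢i     | no z≢j     = Balanced.nonneg b z z≢i z≢j

  Growing⇒Pos : ∀ {j k l η} → Growing j k l η → Pos η
  Growing⇒Pos {j} {k} g z with z Fin.≟ j | z Fin.≟ k
  ... | yes ≡.refl | _          = ≤-trans (Growing.0≤c g) (Growing.c≤ηⱼ g)
  ... | no _       | yes ≡.refl = Growing.0≤ηₖ g
  ... | no z≢j     | no z≢k     = Growing.nonneg g z z≢j z≢k

  -- The slope is a Casoratian: it grows by at least c · cheb a (suc l) per step.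
  module _ {j k M} (j≢k : j ≢ k) (e : m j k ≡ fin M) (l : ℕ) (l<M : suc l ℕ.< M) {η} (g : Growing j k l η) where
    open IsFiniteCoefficient (proj₂ (finite-coefficient j≢k e)) using (cheb≥1; cheb≥0; cheb-decay)
    open Growing g
    private
      p₀ p₁ p₂ y : Carrier
      p₀ = cheb (a j k) l
      p₁ = cheb (a j k) (suc l)
      p₂ = cheb (a j k) (suc (suc l))
      y = reflect k η k

      1≤p₁ : 1# ≤ p₁
      1≤p₁ = cheb≥1 (s≤s z≤n) l<M

      bound : a j k * η j - η k + c ≤ y
      bound with attain
      ... | inj₁ c≈0 = ≤-respˡ (≈-trans (≈-sym (+-identityʳ _)) (+-congˡ (≈-sym c≈0))) (reflect-lower-bound-pair η j≢k nonneg)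
      ... | inj₂ (i , i≢j , i≢k , ηi≈c) = ≤-respˡ (+-congˡ ηi≈c) (reflect-lower-bound-third η j≢k i≢k i≢j nonneg)

      slope′ : c ≤ p₁ * y - p₂ * η j
      slope′ = 0≤⇒≤ (+-nonneg slope (+-nonneg (*-nonneg (≤-trans 0≤1 1≤p₁) (≤⇒0≤ bound)) (*-nonneg 0≤c (≤⇒0≤ 1≤p₁))))
        (solve 7 (λ c p q y j k a → p :* y :- (a :* p :- q) :* j := c :+ ((q :* j :- p :* k) :+ (p :* (y :- (a :* j :- k :+ c)) :+ c :* (p :- :1))))
          ≈-refl c p₁ p₀ y (η j) (η k) (a j k))

      -- p₁ (y - c) is the sum of the surplus in `slope′`, of p₂ (ηⱼ - c), and of c (1 - (p₁ - p₂)).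
      -- The second term needs p₂ ≥ 0, hence a run below the braid length; the third is
      -- `cheb-decay`.
      c≤y : c ≤ y
      c≤y = 0≤⇒≤ (*-cancel-nonneg (<-≤-trans 0<1 1≤p₁) (≤-respʳ
          (solve 5 (λ c p q y j → ((p :* y :- q :* j) :- c) :+ (q :* (j :- c) :+ c :* (:1 :- (p :- q))) := p :* (y :- c))
            ≈-refl c p₁ p₂ y (η j))
          (+-nonneg (≤⇒0≤ slope′) (+-nonneg (*-nonneg (cheb≥0 l<M) (≤⇒0≤ c≤ηⱼ)) (*-nonneg 0≤c (≤⇒0≤ (cheb-decay (suc l) l<M)))))))
        (solve 2 (λ c y → y := c :+ (y :- c)) ≈-refl c y)

      fixed : ∀ z → z ≢ k → reflect k η z ≈ η z
      fixed z z≢k = reflect-off η (z≢k ∘ ≡.sym)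

    growing-step : Growing k j (suc l) (reflect k η)
    growing-step = record
      { c = c
      ; nonneg = λ z z≢k z≢j → ≤-respʳ (≈-sym (fixed z z≢k)) (nonneg z z≢j z≢k)
      ; below = λ z z≢k z≢j → ≤-respˡ (≈-sym (fixed z z≢k)) (below z z≢j z≢k)
      ; attain = attain′ attain
      ; 0≤c = 0≤c
      ; c≤ηⱼ = c≤y
      ; 0≤ηₖ = ≤-respʳ (≈-sym (fixed j j≢k)) (≤-trans 0≤c c≤ηⱼ)
      ; slope = ≤-respʳ (+-cong (*-congʳ (flip (suc l))) (-‿cong (*-cong (flip (suc (suc l))) (≈-sym (fixed j j≢k))))) (≤-trans 0≤c slope′)
      }
      where
      flip : ∀ l → cheb (a j k) l ≈ cheb (a k j) l
      flip = cheb-cong (a-symmetric j k)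
      attain′ : c ≈ 0# ⊎ (∃[ i ] i ≢ j × i ≢ k × η i ≈ c) → c ≈ 0# ⊎ (∃[ i ] i ≢ k × i ≢ j × reflect k η i ≈ c)
      attain′ (inj₁ c≈0) = inj₁ c≈0
      attain′ (inj₂ (i , i≢j , i≢k , f)) = inj₂ (i , i≢k , i≢j , ≈-trans (fixed i i≢k) f)

    growing-end : Balanced k j (reflect k η)
    growing-end = record
      { nonnegᵢ = ≤-trans 0≤c c≤y
      ; nonnegⱼ = ≤-respʳ (≈-sym (fixed j j≢k)) (≤-trans 0≤c c≤ηⱼ)
      ; nonneg = λ z z≢k z≢j → ≤-respʳ (≈-sym (fixed z z≢k)) (nonneg z z≢j z≢k)
      ; belowᵢ = λ z z≢k z≢j → ≤-respˡ (≈-sym (fixed z z≢k)) (≤-trans (below z z≢j z≢k) c≤y)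
      ; belowⱼ = λ z z≢k z≢j → ≤-respˡ (≈-sym (fixed z z≢k)) (≤-respʳ (≈-sym (fixed j j≢k)) (≤-trans (below z z≢j z≢k) c≤ηⱼ))
      }

  -- The abandoned letter i supplies the largest outside coordinate c = η i. The new coordinate at l
  -- is at least a ηⱼ - ηₗ + ηᵢ: since ηₗ ≤ ηᵢ this gives the slope of `plane l j 1`, and since ηₗ ≤
  -- ηⱼ ≤ a ηⱼ it gives the bound c.
  balanced-move : ∀ {i j l η} → i ≢ j → l ≢ i → l ≢ j → Balanced i j η → Growing l j 1 (reflect l η)
  balanced-move {i} {j} {l} {η} i≢j l≢i l≢j b = record
    { c = η i
    ; nonneg = λ z z≢l z≢j → ≤-respʳ (≈-sym (fixed z z≢l)) (nonneg′ z z≢j z≢l)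
    ; below = below′
    ; attain = inj₂ (i , l≢i ∘ ≡.sym , i≢j , fixed i (l≢i ∘ ≡.sym))
    ; 0≤c = nonnegᵢ
    ; c≤ηⱼ = ≤-trans (0≤⇒≤ (+-nonneg (*-nonneg nonnegⱼ (≤⇒0≤ (1≤a (l≢j ∘ ≡.sym)))) (≤⇒0≤ (belowⱼ l l≢i l≢j)))
        (solve 4 (λ a j l i → a :* j :- l :+ i := i :+ (j :* (a :- :1) :+ (j :- l))) ≈-refl (a j l) (η j) (η l) (η i))) bound
    ; 0≤ηₖ = ≤-respʳ (≈-sym (fixed j (l≢j ∘ ≡.sym))) nonnegⱼ
    ; slope = ≤-respʳ (+-congˡ (-‿cong (*-cong (≈-trans (a-symmetric j l) (≈-sym (cheb-2 (a l j)))) (≈-sym (fixed j (l≢j ∘ ≡.sym))))))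
        (≤-trans (≤⇒0≤ (belowᵢ l l≢i l≢j)) (0≤⇒≤ (≤⇒0≤ bound)
          (solve 5 (λ a j l i y → :1 :* y :- a :* j := (i :- l) :+ (y :- (a :* j :- l :+ i))) ≈-refl (a j l) (η j) (η l) (η i) (reflect l η l))))
    }
    where
    open Balanced b
    nonneg′ : ∀ z → z ≢ j → z ≢ l → 0# ≤ η z
    nonneg′ z _ _ = Balanced⇒Pos b z
    fixed : ∀ z → z ≢ l → reflect l η z ≈ η z
    fixed z z≢l = reflect-off η (z≢l ∘ ≡.sym)
    bound : a j l * η j - η l + η i ≤ reflect l η l
    bound = reflect-lower-bound-third η (l≢j ∘ ≡.sym) (l≢i ∘ ≡.sym) i≢j nonneg′
    below′ : ∀ z → z ≢ l → z ≢ j → reflect l η z ≤ η i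
    below′ z z≢l z≢j with z Fin.≟ i
    ... | yes ≡.refl = ≤-reflexive (fixed z z≢l)
    ... | no z≢i     = ≤-respˡ (≈-sym (fixed z z≢l)) (belowᵢ z z≢i z≢j)

  -- The trajectory may enter a plane at any index l; for η = α j the slope is just the Chebyshev
  -- number at l.
  simple-growing : ∀ {j k} l → j ≢ k → 0# ≤ cheb (a j k) l → Growing j k l (α j)
  simple-growing {j} {k} l j≢k 0≤p = record
    { c = 0#
    ; nonneg = λ z _ _ → α-nonneg j z
    ; below = λ z z≢j _ → ≤-reflexive (α-off (z≢j ∘ ≡.sym))
    ; attain = inj₁ ≈-refl
    ; 0≤c = ≤-refl
    ; c≤ηⱼ = α-nonneg j j
    ; 0≤ηₖ = α-nonneg j k
    ; slope = ≤-respʳ (≈-sym (≈-trans (+-cong (*-congˡ (α-diagonal j)) (-‿cong (*-congˡ (α-off j≢k))))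
        (solve 2 (λ p q → p :* :1 :- q :* :0 := p) ≈-refl _ _))) 0≤p
    }

  simple-balanced : ∀ {i j} → i ≢ j → Balanced i j (α i)
  simple-balanced {i} {j} i≢j = record
    { nonnegᵢ = α-nonneg i i
    ; nonnegⱼ = α-nonneg i j
    ; nonneg = λ z _ _ → α-nonneg i z
    ; belowᵢ = λ z z≢i _ → ≤-respˡ (≈-sym (α-off (z≢i ∘ ≡.sym))) (α-nonneg i i)
    ; belowⱼ = λ z z≢i _ → ≤-respˡ (≈-sym (α-off (z≢i ∘ ≡.sym))) (α-nonneg i j)
    }

-- The invariant along a periodic trajectory

module Play (em : ExcludedMiddle 0ℓ) (ℝ : RealNumbers) (trig : Trigonometry ℝ)
            {n} (W : CoxeterSystem n) (complete-graph : HasCompleteCoxeterGraph W)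
            (L : Pred (CoxeterSystem.Carrier W) 0ℓ) (x₀ : CoxeterSystem.Carrier W) (x₀∈L : L x₀) where
  open Trajectories em ℝ trig W complete-graph L x₀ x₀∈L public
  open Growth em ℝ trig W complete-graph
  open Billiards em ℝ trig W using (Pro; Periodic)

  -- k is the first of j and k to occur in the queue.
  data First (k j : Fin n) : List (Fin n) → Set where
    here  : ∀ {q} → First k j (k ∷ q)
    there : ∀ {i q} → i ≢ j → i ≢ k → First k j q → First k j (i ∷ q)

  First-++ : ∀ {k j q} r → First k j q → First k j (q ++ r)
  First-++ r here          = here
  First-++ r (there p q f) = there p q (First-++ r f)

  Queue : List (Fin n) → Set
  Queue q = q ↭ allFin n

  rotate : ∀ {i q} → Queue (i ∷ q) → Queue (q ∷ʳ i)
  rotate {i} {q} p = ↭-trans (↭-sym (∷↭∷ʳ i q)) p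

  -- A letter just sent to the back comes after all others, since the queue has no repetitions.
  -- Hence the partner of a moved letter has its turn first, which makes the moves alternate.
  First-rotate : ∀ {l j q} → Queue (l ∷ q) → l ≢ j → First j l (q ∷ʳ l)
  First-rotate {l} {j} {q} p l≢j with ∈-resp-↭ (↭-sym p) (∈-allFin j) | Permutationₛ.Unique-resp-↭ (≡.setoid (Fin n)) (↭⇒↭ₛ (↭-sym p)) (allFin⁺ n)
  ... | here j≡l  | _        = ⊥-elim (l≢j (≡.sym j≡l))
  ... | there j∈q | l∉q ∷ _ = First-++ [ l ] (find j∈q l∉q)
    where
    find : ∀ {q} → j ∈ q → All (l ≢_) q → First j l q
    find (here ≡.refl) _          = here
    find {i ∷ _} (there j∈q) (l≢i ∷ l∉q) with i Fin.≟ j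
    ... | yes ≡.refl = here
    ... | no i≢j     = there (l≢i ∘ ≡.sym) i≢j (find j∈q l∉q)

  -- ζ is minus the root crossed by the first move of the trajectory.
  data State (ζ : V) (q : List (Fin n)) (u : ∣W∣) : Set where
    at-simple : ∀ {i j η} → i ≢ j → Facing u (α j) → First j i q → u · ζ ≋ η → Balanced i j η → State ζ q u
    in-plane  : ∀ {j k M η} l → j ≢ k → m j k ≡ fin M → 1 ℕ.≤ l → suc l ℕ.< M → Facing u (plane j k l) →
                First k j q → ¬ Facing u (α j) → u · ζ ≋ η → Growing j k l η → State ζ q u

  State⇒Pos : ∀ {ζ q u} → State ζ q u → Pos (u · ζ)
  State⇒Pos (at-simple _ _ _ e b)          = Pos-resp (≋-sym e) (Balanced⇒Pos b)
  State⇒Pos (in-plane _ _ _ _ _ _ _ _ e g) = Pos-resp (≋-sym e) (Growing⇒Pos g)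

  -- The root of index `suc l` is still nonsimple unless `suc l` is M - 1; there it equals α j, and
  -- the run is over.
  land : ∀ {ζ q u j k M η} l → j ≢ k → m j k ≡ fin M → suc l ℕ.< M → Facing u (plane k j (suc l)) →
         First j k q → ¬ Facing u (α k) → u · ζ ≋ η → Growing k j (suc l) η → Balanced k j η → State ζ q u
  land {u = u} l j≢k e b F first ¬F eη g bal with ℕ.m≤n⇒m<n∨m≡n b
  ... | inj₁ lt = in-plane (suc l) (j≢k ∘ ≡.sym) (≡.trans (W.m-symmetric _ _) e) (s≤s z≤n) lt F first ¬F eη g
  ... | inj₂ eq = at-simple (j≢k ∘ ≡.sym) (Facing-resp {u} (plane-last j≢k e l eq) F) first eη bal

  plane-up-facing : ∀ {u j k M} l → j ≢ k → m j k ≡ fin M → suc l ℕ.< M → Facing u (plane j k l) → Facing (s k ∙ u) (plane k j (suc l))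
  plane-up-facing {u} {j} {k} l j≢k e b F = Facing-resp {s k ∙ u} (plane-up j k l)
    (facing-move {u} F (Pos-resp (≋-sym (plane-up j k l)) (plane-nonneg (j≢k ∘ ≡.sym) (≡.trans (W.m-symmetric k j) e) (suc l) b)))

  simple-up-facing : ∀ {u i l M} → l ≢ i → m l i ≡ fin M → 3 ℕ.≤ M → Facing u (α i) → Facing (s l ∙ u) (plane l i 1)
  simple-up-facing {u} {i} {l} l≢i e 3≤M F = Facing-resp {s l ∙ u} (reflect-simple l i)
    (facing-move {u} F (Pos-resp (≋-sym (reflect-simple l i)) (plane-nonneg l≢i e 1 (ℕ.<⇒≤ 3≤M))))

  moved : ∀ {ζ u η} i → u · ζ ≋ η → (s i ∙ u) · ζ ≋ reflect i η
  moved {ζ} {u} i e = ≋-trans (·-s∙ i u ζ) (reflect-cong i e)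

  -- An infinite label means B(α i, α l) = -1, which is already far enough to block the toggle at l.
  finite-if-not-stuck : ∀ {u i l} → l ≢ i → Facing u (α i) → ¬ Stuck u l → ∃[ M ] m l i ≡ fin M × 3 ℕ.≤ M
  finite-if-not-stuck {u} {i} {l} l≢i F ¬st with label l≢i
  ... | finite {M} e 3≤M _ = M , e , 3≤M
  ... | infinite _ e = ⊥-elim (¬st (stuck-if-far {u} {i = l} F (≤-reflexive (≈-trans (h-off i l) (-‿cong (≈-trans (a-symmetric i l) e))))))

  -- While α j faces, a turn of j would cross a root of R(L), so a third letter has to move before
  -- that turn. In a plane, third letters are stuck by `h-plane-far`, and k cannot be stuck on its
  -- turn, since then α j would face u.
  step : ∀ {ζ l q u t} → Queue (l ∷ q) → Steady (l ∷ q) u (suc t) → State ζ (l ∷ q) u → State ζ (q ∷ʳ l) (toggle L l u)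
  step {ζ} {l} {q} {u} Q st S with toggle-cases l u
  step {ζ} {l} {q} {u} {t} Q st (at-simple i≢j F here e b) | _ = ⊥-elim (steady-not-facing {l} {q} {u} {t} st F)
  step {ζ} {l} {q} {u} Q st (at-simple i≢j F (there l≢i l≢j first) e b) | inj₁ (_ , eq) =
    ≡.subst (State ζ (q ∷ʳ l)) (≡.sym eq) (at-simple i≢j F (First-++ [ l ] first) e b)
  step {ζ} {l} {q} {u} Q st (at-simple i≢j F (there l≢i l≢j first) e b) | inj₂ (¬st , eq)
    with M , f , 3≤M ← finite-if-not-stuck {u} l≢j F ¬st =
    ≡.subst (State ζ (q ∷ʳ l)) (≡.sym eq) (in-plane 1 l≢j f (s≤s z≤n) 3≤M (simple-up-facing {u} l≢j f 3≤M F)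
      (First-rotate Q l≢j) (not-facing-after-move {u} ¬st) (moved {ζ} {u} l e) (balanced-move i≢j l≢i l≢j b))
  step {ζ} {l} {q} {u} Q st (in-plane x j≢k f 1≤x b F here ¬F e g) | inj₁ (stuck , _) =
    ⊥-elim (¬F (unstuck-beside {u} j≢k f b F stuck))
  step {ζ} {l} {q} {u} Q st (in-plane x j≢k f 1≤x b F here ¬F e g) | inj₂ (¬st , eq) =
    ≡.subst (State ζ (q ∷ʳ l)) (≡.sym eq) (land x j≢k f b (plane-up-facing {u} x j≢k f b F) (First-rotate Q (j≢k ∘ ≡.sym))
      (not-facing-after-move {u} ¬st) (moved {ζ} {u} l e) (growing-step j≢k f x b g) (growing-end j≢k f x b g))
  step {ζ} {l} {q} {u} Q st (in-plane x j≢k f 1≤x b F (there l≢j l≢k first) ¬F e g) | inj₁ (_ , eq) =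
    ≡.subst (State ζ (q ∷ʳ l)) (≡.sym eq) (in-plane x j≢k f 1≤x b F (First-++ [ l ] first) ¬F e g)
  step {ζ} {l} {q} {u} Q st (in-plane x j≢k f 1≤x b F (there l≢j l≢k first) ¬F e g) | inj₂ (¬st , _) =
    ⊥-elim (¬st (stuck-if-far {u} {i = l} F (h-plane-far j≢k f l≢j l≢k x 1≤x b)))

  run : ∀ {ζ} t q u → Queue q → Steady q u t → State ζ q u → Pos (play q u t · ζ)
  run t       []      u _ _  S = State⇒Pos S
  run zero    (l ∷ q) u _ _  S = State⇒Pos S
  run (suc t) (l ∷ q) u Q st S = run t (q ∷ʳ l) (toggle L l u) (rotate Q) (steady-step {l} {q} {u} {t} st) (step {t = t} Q st S)

  -- The roots of the plane counted from the opposite end. The first move may be at either letter of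
  -- the pair, whereas `land` expects it at the second.
  plane-flip : ∀ {i j M} → i ≢ j → m i j ≡ fin M → ∀ k l → suc (k ℕ.+ l) ≡ M → plane i j k ≋ plane j i l
  plane-flip {i} {j} i≢j e k l eq z = ≈-trans (+-comm _ _) (+-cong (*-congʳ (≈-trans (cheb-reflect k (suc l) (≡.trans (ℕ.+-suc k l) eq)) (flip (suc l))))
    (*-congʳ (≈-trans (cheb-reflect (suc k) l eq) (flip l))))
    where
    open IsFiniteCoefficient (proj₂ (finite-coefficient i≢j e))
    flip : ∀ l → cheb (a i j) l ≈ cheb (a j i) l
    flip = cheb-cong (a-symmetric i j)

  first-move-plane : ∀ {q u i l M} k → l ≢ i → m i l ≡ fin M → suc k ℕ.< M → Queue (l ∷ q) → ¬ Stuck u l →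
                     Facing u (plane i l k) → ∀ {ζ} → (s l ∙ u) · ζ ≋ α l → State ζ (q ∷ʳ l) (s l ∙ u)
  first-move-plane {u = u} {i} {l} k l≢i e b Q ¬st F eζ = land k (l≢i ∘ ≡.sym) e b (plane-up-facing {u} k (l≢i ∘ ≡.sym) e b F)
    (First-rotate Q l≢i) (not-facing-after-move {u} ¬st) eζ
    (simple-growing (suc k) l≢i (IsFiniteCoefficient.cheb≥0 (proj₂ (finite-coefficient l≢i (≡.trans (W.m-symmetric l i) e))) (ℕ.<⇒≤ b)))
    (simple-balanced l≢i)

  first-move : ∀ {l q u t γ ζ} → Queue (l ∷ q) → Steady (l ∷ q) u (suc t) → ¬ Stuck u l → Facing u γ → Small γ →
               (s l ∙ u) · ζ ≋ α l → State ζ (q ∷ʳ l) (s l ∙ u)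
  first-move {l} {q} {u} {t} Q st ¬st F (simple i e) eζ with l Fin.≟ i
  ... | yes ≡.refl = ⊥-elim (steady-not-facing {l} {q} {u} {t} st (Facing-resp {u} e F))
  ... | no l≢i with M , f , 3≤M ← finite-if-not-stuck {u} l≢i (Facing-resp {u} e F) ¬st =
    in-plane 1 l≢i f (s≤s z≤n) 3≤M (simple-up-facing {u} l≢i f 3≤M (Facing-resp {u} e F)) (First-rotate Q l≢i)
      (not-facing-after-move {u} ¬st) eζ (simple-growing 1 l≢i 0≤1)
  first-move {l} {q} {u} Q st ¬st F (dihedral {i} {j} {M} k i≢j f 1≤k b e) eζ with l Fin.≟ i | l Fin.≟ j
  ... | no l≢i | no l≢j = ⊥-elim (¬st (stuck-if-far {u} {i = l} (Facing-resp {u} e F) (h-plane-far i≢j f l≢i l≢j k 1≤k b)))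
  ... | no l≢i | yes ≡.refl = first-move-plane k l≢i f b Q ¬st (Facing-resp {u} e F) eζ
  ... | yes ≡.refl | _ = first-move-plane k′ i≢j (≡.trans (W.m-symmetric j i) f) b′ Q ¬st
                           (Facing-resp {u} (≋-trans e (plane-flip i≢j f k k′ (ℕ.m+[n∸m]≡n (ℕ.<⇒≤ b)))) F) eζ
    where
    k′ : ℕ
    -- The index seen from α j, with k + k′ = M - 1; that the facing root is not α i, i.e. k ≥ 1,
    -- leaves room for one more step.
    k′ = M ℕ.∸ suc k
    b′ : suc k′ ℕ.< M
    b′ = ℕ.≤-trans (s≤s (ℕ.+-monoˡ-≤ k′ 1≤k)) (ℕ.≤-reflexive (ℕ.m+[n∸m]≡n (ℕ.<⇒≤ b)))

  -- r is what remains of the first sweep; the letters of s have been found stuck.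
  no-return : ∀ r s u t {γ} → Queue (r ++ s) → length r ℕ.≤ t → (∀ {i} → i ∈ s → Stuck u i) →
              Steady (r ++ s) u t → Facing u γ → Small γ → ¬ play (r ++ s) u t ≈ᵂ u
  no-return [] s u t Q _ stuck _ F small _ = small-not-stuck {u} F small λ i → stuck (∈-resp-↭ (↭-sym Q) (∈-allFin i))
  no-return (l ∷ r) s′ u (suc t) {γ} Q (s≤s b) stuck st F small back with toggle-cases l u
  ... | inj₁ (stₗ , eq) = no-return r (s′ ∷ʳ l) u t (≡.subst Queue shift (rotate Q)) b stuck′
          (≡.subst₂ (λ q v → Steady q v t) shift eq (steady-step {l} {r ++ s′} {u} {t} st)) F small
          (≡.subst₂ (λ q v → play q v t ≈ᵂ u) shift eq back)
    where
    shift : (r ++ s′) ∷ʳ l ≡ r ++ (s′ ∷ʳ l)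
    shift = List.++-assoc r s′ [ l ]
    stuck′ : ∀ {i} → i ∈ s′ ∷ʳ l → Stuck u i
    stuck′ {i} i∈ with ∈-++⁻ s′ i∈
    ... | inj₁ i∈s           = stuck i∈s
    ... | inj₂ (here ≡.refl) = stₗ
  ... | inj₂ (¬st , eq) = root-nonzero (α-root l) (α-nonneg l) (Neg-resp returned (Pos-neg positive))
    where
    ζ : V
    ζ = neg (inv u · α l)
    uζ : u · ζ ≋ neg (α l)
    uζ = ≋-trans (·-neg u _) λ z → -‿cong (·-inverseʳ u (α l) z)
    start : (s l ∙ u) · ζ ≋ α l
    start = ≋-trans (moved {ζ} {u} l uζ) (≋-trans (reflect-cong l (≋-sym (reflect-self l))) (reflect-involutive l (α l)))
    positive : Pos (play ((r ++ s′) ∷ʳ l) (toggle L l u) t · ζ)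
    positive = run t ((r ++ s′) ∷ʳ l) (toggle L l u) (rotate Q) (steady-step {l} {r ++ s′} {u} {t} st)
      (≡.subst (State ζ ((r ++ s′) ∷ʳ l)) (≡.sym eq) (first-move {l} {r ++ s′} {u} {t} Q st ¬st F small start))
    returned : neg (play ((r ++ s′) ∷ʳ l) (toggle L l u) t · ζ) ≋ α l
    returned z = ≈-trans (-‿cong (≈-trans (·-congˡ back ζ z) (uζ z))) (-‿involutive _)

  play-sweep : ∀ xs ys u t → play (xs ++ ys) u (length xs ℕ.+ t) ≡ play (ys ++ xs) (foldl (λ v i → toggle L i v) u xs) t
  play-sweep []       ys u t = ≡.cong (λ q → play q u t) (≡.sym (List.++-identityʳ ys))
  play-sweep (x ∷ xs) ys u t = ≡.trans (≡.cong (λ q → play q (toggle L x u) (length xs ℕ.+ t)) (List.++-assoc xs ys [ x ]))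
    (≡.trans (play-sweep xs (ys ∷ʳ x) (toggle L x u) t)
      (≡.cong (λ q → play q (foldl (λ v i → toggle L i v) (toggle L x u) xs) t) (List.++-assoc ys [ x ] xs)))

  play-zero : ∀ q u → play q u 0 ≡ u
  play-zero []      u = ≡.refl
  play-zero (_ ∷ _) u = ≡.refl

  play-iterate : ∀ (o : Ordering W) K u → play (proj₁ o) u (K ℕ.* length (proj₁ o)) ≡ iterate (Pro L o) u K
  play-iterate o zero    u = play-zero (proj₁ o) u
  play-iterate o (suc K) u = ≡.trans
    (≡.trans (≡.cong (λ q → play q u (length (proj₁ o) ℕ.+ K ℕ.* length (proj₁ o))) (≡.sym (List.++-identityʳ (proj₁ o))))
             (play-sweep (proj₁ o) [] u (K ℕ.* length (proj₁ o))))
    (play-iterate o K (Pro L o u))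

  periodic-not-facing : ∀ (o : Ordering W) {u γ} → Periodic (Pro L o) u → ¬ Facing u γ
  periodic-not-facing o {u} (K , 1≤K , back) F with δ , Fδ , small ← facing-small {u} F =
    -- K ≥ 1 ensures that the T toggles contain a full first sweep.
    no-return is [] u T (≡.subst Queue (≡.sym (List.++-identityʳ is)) (proj₂ o)) (ℕ.m≤n*m (length is) K {{ℕ.>-nonZero 1≤K}}) (λ ())
      (≡.subst (λ q → Steady q u T) (≡.sym (List.++-identityʳ is)) steady) Fδ small
      (≡.subst (λ q → play q u T ≈ᵂ u) (≡.sym (List.++-identityʳ is)) back′)
    where
    is : List (Fin n)
    is = proj₁ o
    T : ℕ
    T = K ℕ.* length is
    back′ : play is u T ≈ᵂ u
    back′ = ≡.subst (_≈ᵂ u) (≡.sym (play-iterate o K u)) back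
    steady : Steady is u T
    -- The final position acts on roots as u does, so separation at the start is separation at the
    -- end.
    steady β (r , p , f) = r , p , Neg-resp (·-congˡ (W.≈-sym back′) β) f

theorem1p17 : (em : ExcludedMiddle 0ℓ) (ℝ : RealNumbers) (trig : Trigonometry ℝ)
    (n : ℕ) (W : CoxeterSystem n) →
    HasCompleteCoxeterGraph W → Billiards.Futuristic em ℝ trig W
theorem1p17 em ℝ trig n W complete-graph L (A , A⊆Root , L⊆H , H⊆L) (x₀ , x₀∈L) c _ o _ {u} periodic =
  H⊆L λ β β∈A → half-space β β∈A (root-sign (·-root u (Root⇒IsRoot (A⊆Root β∈A))))
  where
  open Play em ℝ trig W complete-graph L x₀ x₀∈L
  half-space : ∀ β → A β → Pos (u · β) ⊎ Neg (u · β) → HalfSpace β u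
  half-space β β∈A (inj₁ p) = IsRoot⇒Root (·-root u (Root⇒IsRoot (A⊆Root β∈A))) , p
  -- A violated half-space from the family defining L supplies the facing root - u β.
  half-space β β∈A (inj₂ q) = ⊥-elim (periodic-not-facing o periodic
    (Separating⇒Facing {u} (Root⇒IsRoot (A⊆Root β∈A) , (λ x x∈L → proj₂ (L⊆H x∈L β β∈A)) , q)))
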